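{- Let $m \geq 3$ and $k \geq 2$ be integers and let $\Delta$ be a lattice simplex of dimension $d$ whose $h^*$-polynomial is $1+(m-2)t^k+t^{2k}$. Assume that $\Delta$ is not a lattice pyramid over any lower-dimensional simplex. Then the integers $k,m,d$ satisfy one of the following: \begin{itemize} \item[(a)] $m \in \{3,4,6,8\}$ and $d = 3k-1$, or $m=4$ and $d=4k-1$; \item[(b)] $k=2^{\ell-3}a$, $m=2^\ell$ and $d=2^{\ell-1}a-1$, for integers $a \geq 1$ and $\ell \geq 3$ with $(a,\ell)\neq(1,3)$; \item[(c)] $k=3^{\ell-2}a$, $m=3^\ell$ and $d=3^{\ell-1}a-1$, for integers $a \geq 1$ and $\ell \geq 2$ with $(a,\ell)\neq(1,2)$. \end{itemize} Moreover, for a suitable ordering of the vertices of $\Delta$, a system of generators of the finite abelian group $\Lambda_\Delta$ is given by the set of row vectors of the following matrix, written up to permutation of the columns: \begin{itemize} \item[(a)] in the case $m=3$: the $1\times 3k$ matrix $(1/3\;1/3\;\cdots\;1/3)$; in the case $m=4$, $d=3k-1$: the $1\times 3k$ matrix whose first $2k$ entries are $1/4$ and last $k$ entries are $1/2$; in the case $m=4$, $d=4k-1$: the $2\times 4k$ matrix whose first row is $2k$ entries $1/2$ followed by $2k$ entries $0$, and whose second row has all $4k$ entries equal to $1/2$; in the case $m=6$: the $1\times 3k$ matrix consisting of $k$ entries $1/6$, then $k$ entries $1/3$, then $k$ entries $1/2$; in the case $m=8$: the $2\times 3k$ matrix whose columns are $k$ copies of $(1/2,1/4)^T$, then $k$ copies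 of $(0,1/4)^T$, then $k$ copies of $(1/2,1/2)^T$. \item[(b)] the $\ell\times 2^{\ell-1}a$ matrix $$\begin{pmatrix}(B_{\ell-1}^{(2)}, 0) &(B_{\ell-1}^{(2)}, 0) & \cdots &(B_{\ell-1}^{(2)},0) \\ 1/2 & 1/2&\cdots &1/2\end{pmatrix},$$ where $A_{\ell-1}^{(2)} \in \{0,1\}^{(\ell-1) \times (2^{\ell-1}-1)}$ is a generator matrix of the simplex code over $\mathbb{F}_2$ of dimension $\ell-1$ with block length $2^{\ell-1}-1$, $B_{\ell-1}^{(2)}\in\{0,\tfrac12\}^{(\ell-1)\times(2^{\ell-1}-1)}$ is obtained by dividing each entry of $A_{\ell-1}^{(2)}$ (viewed as an integer in $\{0,1\}$) by $2$, $(B_{\ell-1}^{(2)},0)$ denotes $B_{\ell-1}^{(2)}$ with one additional zero column appended, this block is repeated $a$ times, and the last row has all entries equal to $1/2$. \item[(c)] the $\ell\times 3^{\ell-1}a$ matrix $$\begin{pmatrix}(B_{\ell-1}^{(3)},-B_{\ell-1}^{(3)}, 0) & \cdots &(B_{\ell-1}^{(3)},-B_{\ell-1}^{(3)}, 0) \\ 1/3 & \cdots &1/3\end{pmatrix},$$ where $A_{\ell-1}^{(3)} \in \{0,1,2\}^{(\ell-1) \times (3^{\ell-1}-1)/2}$ is a generator matrix of the simplex code over $\mathbb{F}_3$ of dimension $\ell-1$ with block length $(3^{\ell-1}-1)/2$, $B_{\ell-1}^{(3)}$ (resp. $-B_{\ell-1}^{(3)}$) is obtained by dividing each entry of $A_{\ell-1}^{(3)}$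 (resp. of $-A_{\ell-1}^{(3)}$, with entries taken in $\{0,1,2\}$) by $3$, $(B,-B,0)$ denotes the concatenation with one additional zero column appended, this block is repeated $a$ times, and the last row has all entries equal to $1/3$. \end{itemize}
   Context: A lattice simplex of dimension $d$ is a $d$-dimensional simplex in $\mathbb{R}^d$ with vertices in $\mathbb{Z}^d$. Its Ehrhart series $1+\sum_{k\ge1}\#(k\Delta\cap\mathbb{Z}^d)t^k$ equals $h^*_\Delta(t)/(1-t)^{d+1}$ for a polynomial $h^*_\Delta$, the $h^*$-polynomial. The lattice pyramid over a lattice polytope $P\subset\mathbb{R}^{d}$ is $\mathrm{conv}(P\times\{0\},(0,\ldots,0,1))\subset\mathbb{R}^{d+1}$; $\Delta$ is a lattice pyramid if it is isomorphic (via an affine lattice-preserving map) to a lattice pyramid over a lower-dimensional lattice polytope. For a lattice simplex $\Delta$ with ordered vertices $v_0,\ldots,v_d$, set $\Lambda_\Delta=\{(x_0,\ldots,x_d)\in[0,1)^{d+1} : \sum_i x_i(v_i,1)\in\mathbb{Z}^{d+1}\}$, a finite subgroup of $(\mathbb{R}/\mathbb{Z})^{d+1}$ (identified with $[0,1)^{d+1}$, addition componentwise modulo $1$). A system of generators means a generating set of this group. For a prime $p$ and integer $r\ge1$, the simplex code of dimension $r$ over $\mathbb{F}_p$ has as generator matrix the $r\times\frac{p^r-1}{p-1}$ matrix whose columns consist of one nonzero vector from each $1$-dimensional subspace of $\mathbb{F}_p^r$. -}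

module Defs where

open import Data.Nat as ℕ using (ℕ; zero; suc; _∸_; _%_)
open import Data.Nat.Combinatorics using (_C_)
open import Data.Integer as ℤ using (ℤ; +_)
open import Data.Rational as ℚ using (ℚ; 0ℚ; 1ℚ; _/_)
open import Data.Fin using (Fin; toℕ; zero; suc)
open import Data.Vec using (Vec; []; _∷_; _∷ʳ_; tabulate; lookup; replicate; toList)
open import Data.List as List using (List; _++_; concat; map)
open import Data.List.Membership.Propositional using (_∈_)
open import Data.List.Relation.Binary.Permutation.Propositional using (_↭_)
open import Data.Product using (Σ; ∃; _×_; _,_)
open import Data.Unit using (⊤)
open import Data.Empty using (⊥)
open import Relation.Binary.PropositionalEquality using (_≡_; _≢_)
open import Relation.Nullary using (¬_; Dec; yes; no)
open import Function.Definitions using (Injective)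

sumℚ : {n : ℕ} → (Fin n → ℚ) → ℚ
sumℚ {zero}  f = 0ℚ
sumℚ {suc n} f = f zero ℚ.+ sumℚ (λ i → f (suc i))

sumℤ : {n : ℕ} → (Fin n → ℤ) → ℤ
sumℤ {zero}  f = + 0
sumℤ {suc n} f = f zero ℤ.+ sumℤ (λ i → f (suc i))

ℤ→ℚ : ℤ → ℚ
ℤ→ℚ z = z / 1

ℕ→ℚ : ℕ → ℚ
ℕ→ℚ n = + n / 1

IsInt : ℚ → Set
IsInt q = Σ ℤ λ z → q ≡ ℤ→ℚ z

Vertices : ℕ → Set
Vertices d = Fin (suc d) → Vec ℤ d

AffinelyIndependent : {d : ℕ} → Vertices d → Set
AffinelyIndependent {d} v =
  (λ' : Fin (suc d) → ℚ) →
  (∀ (j : Fin d) → sumℚ (λ i → λ' i ℚ.* ℤ→ℚ (lookup (v i) j)) ≡ 0ℚ) →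
  sumℚ λ' ≡ 0ℚ →
  ∀ i → λ' i ≡ 0ℚ

InDilate : {d : ℕ} → Vertices d → ℕ → Vec ℤ d → Set
InDilate {d} v n x =
  Σ (Fin (suc d) → ℚ) λ λ' →
    (∀ i → 0ℚ ℚ.≤ λ' i) ×
    (sumℚ λ' ≡ ℕ→ℚ n) ×
    (∀ (j : Fin d) → sumℚ (λ i → λ' i ℚ.* ℤ→ℚ (lookup (v i) j)) ≡ ℤ→ℚ (lookup x j))

LatticePointCount : {d : ℕ} → Vertices d → ℕ → ℕ → Set
LatticePointCount {d} v n c =
  Σ (Fin c → Vec ℤ d) λ f →
    Injective _≡_ _≡_ f ×
    (∀ i → InDilate v n (f i)) ×
    (∀ x → InDilate v n x → ∃ λ i → f i ≡ x)

-- L is the Ehrhart function of Δ:  L n = #(n·Δ ∩ ℤ^d) for all n ≥ 0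
-- (note L 0 = 1 automatically, matching the constant term of the series)
IsEhrhartFunction : {d : ℕ} → Vertices d → (ℕ → ℕ) → Set
IsEhrhartFunction v L = ∀ n → LatticePointCount v n (L n)

-- j-th coefficient of (1 - t)^(d+1) · Σ_{n ≥ 0} L(n) t^n,
--   = Σ_{i=0}^{j} (-1)^i C(d+1,i) L(j-i)
signℤ : ℕ → ℤ
signℤ zero = + 1
signℤ (suc i) = ℤ.- signℤ i

hstarCoeff : (d : ℕ) → (ℕ → ℕ) → ℕ → ℤ
hstarCoeff d L j =
  sumℤ {suc j} (λ i → signℤ (toℕ i) ℤ.* (+ (suc d C toℕ i)) ℤ.* (+ L (j ∸ toℕ i)))

indicator : ℕ → ℕ → ℤ
indicator a b with a ℕ.≟ b
... | yes _ = + 1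
... | no _  = + 0

targetCoeff : ℕ → ℕ → ℕ → ℤ
targetCoeff m k j =
  indicator j 0 ℤ.+ (+ (m ∸ 2)) ℤ.* indicator j k ℤ.+ indicator j (2 ℕ.* k)

HasHStar : {d : ℕ} → Vertices d → ℕ → ℕ → Set
HasHStar {d} v m k =
  Σ (ℕ → ℕ) λ L → IsEhrhartFunction v L × (∀ j → hstarCoeff d L j ≡ targetCoeff m k j)

matVec : {d : ℕ} → (Fin d → Fin d → ℤ) → Vec ℤ d → Vec ℤ d
matVec U x = tabulate λ i → sumℤ (λ j → U i j ℤ.* lookup x j)

matMul : {d : ℕ} → (Fin d → Fin d → ℤ) → (Fin d → Fin d → ℤ) → Fin d → Fin d → ℤ
matMul U V i k = sumℤ (λ j → U i j ℤ.* V j k)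

idMat : {d : ℕ} → Fin d → Fin d → ℤ
idMat i j with toℕ i ℕ.≟ toℕ j
... | yes _ = + 1
... | no _  = + 0

Unimodular : {d : ℕ} → (Fin d → Fin d → ℤ) → Set
Unimodular {d} U = Σ (Fin d → Fin d → ℤ) λ V →
  (∀ i j → matMul U V i j ≡ idMat i j) × (∀ i j → matMul V U i j ≡ idMat i j)

affMap : {d : ℕ} → (Fin d → Fin d → ℤ) → Vec ℤ d → Vec ℤ d → Vec ℤ d
affMap U b x = tabulate λ i → lookup (matVec U x) i ℤ.+ lookup b i

-- Δ is a lattice pyramid: some affine lattice isomorphism maps Δ onto
-- conv(P × {0}, (0,…,0,1)) with P a lattice simplex in ℝ^(d-1); since the
-- vertices of such a pyramid are the points (w,0), w a vertex of P, together
-- with (0,…,0,1), this means one vertex goes to (0,…,0,1) and all other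
-- vertices go to the hyperplane x_d = 0.
IsLatticePyramid : {d : ℕ} → Vertices d → Set
IsLatticePyramid {zero} v = ⊥
IsLatticePyramid {suc d} v =
  Σ (Fin (suc d) → Fin (suc d) → ℤ) λ U → Unimodular U ×
  Σ (Vec ℤ (suc d)) λ b → Σ (Fin (suc (suc d))) λ apex →
    (affMap U b (v apex) ≡ replicate d (+ 0) ∷ʳ + 1) ×
    (∀ i → i ≢ apex → lookup (affMap U b (v i)) (Data.Fin.fromℕ d) ≡ + 0)

InLambda : {d : ℕ} → Vertices d → (Fin (suc d) → ℚ) → Set
InLambda {d} v x =
  (∀ i → (0ℚ ℚ.≤ x i) × (x i ℚ.< 1ℚ)) ×
  (∀ (j : Fin d) → IsInt (sumℚ (λ i → x i ℚ.* ℤ→ℚ (lookup (v i) j)))) ×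
  IsInt (sumℚ x)

-- the rows g_1,…,g_r form a system of generators of Λ_Δ
-- (addition in (ℝ/ℤ)^(d+1) is componentwise mod 1)
Generates : {d r : ℕ} → Vertices d → (Fin r → Fin (suc d) → ℚ) → Set
Generates {d} {r} v g =
  (∀ s → InLambda v (g s)) ×
  (∀ x → InLambda v x →
     Σ (Fin r → ℤ) λ c → ∀ i → IsInt (x i ℚ.- sumℚ (λ s → ℤ→ℚ (c s) ℚ.* g s i)))

columns : {d r : ℕ} → (Fin r → Fin (suc d) → ℚ) → List (Vec ℚ r)
columns {d} g = toList (tabulate λ i → tabulate λ s → g s i)

-- "for a suitable ordering of the vertices, a system of generators of Λ_Δ is
-- given by the rows of the matrix M (columns given as a list), up to
-- permutation of the columns"
GeneratedByMatrix : {d r : ℕ} → Vertices d → List (Vec ℚ r) → Set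
GeneratedByMatrix {d} {r} v M =
  Σ (Fin r → Fin (suc d) → ℚ) λ g → (columns g ↭ M) × Generates v g

NonZeroVec : {p r : ℕ} → Vec (Fin p) r → Set
NonZeroVec {p} {r} w = ¬ (∀ i → toℕ (lookup w i) ≡ 0)

ScalarMultiple : {p r : ℕ} → .{{_ : ℕ.NonZero p}} → Vec (Fin p) r → Vec (Fin p) r → Set
ScalarMultiple {p} w c = Σ (Fin p) λ λ' →
  ∀ i → toℕ (lookup w i) ≡ (toℕ λ' ℕ.* toℕ (lookup c i)) % p

-- A (given by its list of columns) is a generator matrix of the simplex
-- code of dimension r over F_p: its columns consist of exactly one nonzero
-- vector from each 1-dimensional subspace of F_p^r.
IsSimplexCodeGenerator : (p r : ℕ) → .{{_ : ℕ.NonZero p}} → List (Vec (Fin p) r) → Set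
IsSimplexCodeGenerator p r A =
  (∀ (i : Fin (List.length A)) → NonZeroVec (List.lookup A i)) ×
  (∀ (i j : Fin (List.length A)) → i ≢ j →
     ¬ ScalarMultiple (List.lookup A i) (List.lookup A j)) ×
  (∀ (w : Vec (Fin p) r) → NonZeroVec w →
     Σ (Fin (List.length A)) λ i → ScalarMultiple w (List.lookup A i))

cst : ℕ → ℕ → ℚ
cst a zero = 0ℚ
cst a (suc b) = + a / suc b

col1 : ℚ → Vec ℚ 1
col1 a = a ∷ []

col2 : ℚ → ℚ → Vec ℚ 2
col2 a b = a ∷ b ∷ []

M-3 : ℕ → List (Vec ℚ 1)
M-3 k = List.replicate (3 ℕ.* k) (col1 (cst 1 3))

M-4a : ℕ → List (Vec ℚ 1)
M-4a k = List.replicate (2 ℕ.* k) (col1 (cst 1 4)) ++ List.replicate k (col1 (cst 1 2))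

M-4b : ℕ → List (Vec ℚ 2)
M-4b k = List.replicate (2 ℕ.* k) (col2 (cst 1 2) (cst 1 2))
      ++ List.replicate (2 ℕ.* k) (col2 0ℚ (cst 1 2))

M-6 : ℕ → List (Vec ℚ 1)
M-6 k = List.replicate k (col1 (cst 1 6)) ++ List.replicate k (col1 (cst 1 3))
     ++ List.replicate k (col1 (cst 1 2))

M-8 : ℕ → List (Vec ℚ 2)
M-8 k = List.replicate k (col2 (cst 1 2) (cst 1 4)) ++ List.replicate k (col2 0ℚ (cst 1 4))
     ++ List.replicate k (col2 (cst 1 2) (cst 1 2))

divCol : {p r : ℕ} → Vec (Fin p) r → Vec ℚ r
divCol {p} c = Data.Vec.map (λ a → cst (toℕ a) p) c

neg3 : Fin 3 → Fin 3
neg3 zero = zero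
neg3 (suc zero) = suc (suc zero)
neg3 (suc (suc zero)) = suc zero

zeroCol : (r : ℕ) → Vec ℚ r
zeroCol r = replicate r 0ℚ

M-b : {r : ℕ} → ℕ → List (Vec (Fin 2) r) → List (Vec ℚ (suc r))
M-b {r} a A = concat (List.replicate a
  (map (λ c → divCol c ∷ʳ cst 1 2) A ++ List.[ zeroCol r ∷ʳ cst 1 2 ]))

M-c : {r : ℕ} → ℕ → List (Vec (Fin 3) r) → List (Vec ℚ (suc r))
M-c {r} a A = concat (List.replicate a
  (map (λ c → divCol c ∷ʳ cst 1 3) A
   ++ map (λ c → divCol (Data.Vec.map neg3 c) ∷ʳ cst 1 3) A
   ++ List.[ zeroCol r ∷ʳ cst 1 3 ]))

{-# OPTIONS --safe #-}
module Submission where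

-- Write h for the inverse of the element g of height 2k.  An element x other than 0, g, h has height k,
-- and so does -x, so x has 2k non-zero coordinates; as x + g also has height k, every one of them carries
-- in the addition, which means h_i ≤ x_i ≤ 1 - h_i there.  Since Δ is no pyramid, all coordinates of h are
-- non-zero.  Moreover, if x is not a multiple of h, adding h repeatedly makes any given coordinate vanish.
-- If h = g, all entries are 0 or 1/2 and Λ is a binary code in which all words but 0 and g have half the
-- maximal weight; if 3h = 0, it is a ternary code in which all words but 0, h, 2h have k zeros.  Counting
-- pairs (word, column) shows that all columns of a generator matrix occur equally often, which gives the
-- simplex codes.  Otherwise the numbers of zeros of 2h, 3h, 4h, 5h force h to have order 4 or 6, and
-- comparing an element outside ⟨h⟩ with its multiples leaves a single further group, of order 8.
-- The coefficients of h* count the elements of Λ by height: restricting one more barycentric coordinate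
-- of the lattice points of nΔ to [0, 1) multiplies the generating function by 1 - t.

-- Why a coordinate can be made to vanish: a translate by `h` of an element `x` outside the subgroup
-- generated by `h` is again outside, so `x_i + h_i ≤ 1` holds at every stage. The coordinate
-- climbs, cannot jump over 1, and has to hit it. So `x_i` is a multiple of `h_i` modulo 1, and
-- `c x` vanishes wherever `c h_i = 1`. As the number of zeros is prescribed, vanishing on that many
-- coordinates excludes every other zero, whereas some translate by a multiple of `h` vanishes at
-- any chosen place. When `h` is not constant, this conflict drives small multiples of `x` back into
-- the subgroup; when `h` is constant, there is no conflict and a whole code survives. The absence
-- of a pyramid enters through one fact: if a coordinate were zero on all of Λ, the corresponding
-- barycentric coordinate would be an affine form with integer values on the lattice, equal to 1 at
-- one vertex and 0 at the others, and a unimodular map could turn it into the last coordinate.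

-- Finite sums, indicator counts and congruences modulo N.

module FiniteSums where

  open import Data.Nat
  open import Data.Nat.Properties
  open import Data.Nat.DivMod
  open import Data.Nat.Divisibility
  open import Data.Fin.Base using (Fin; zero; suc)
  open import Data.Product using (∃; _×_; _,_; proj₁; proj₂)
  open import Relation.Nullary using (¬_; Dec; yes; no; contradiction)
  open import Relation.Binary.PropositionalEquality
  open import Relation.Nullary.Decidable using (map′)
  open import Function using (_∘_)
  open import Algebra.Properties.Semiring.Sum +-*-semiring public using
      (sum; sum-cong-≗; ∑-distrib-+; *-distribˡ-sum; *-distribʳ-sum; ∑-comm)

  sum-const : ∀ n c → sum {n} (λ _ → c) ≡ n * c
  sum-const zero c = refl
  sum-const (suc n) c = cong (c +_) (sum-const n c)

  sum-mono-≤ : ∀ {n} {f g : Fin n → ℕ} → (∀ i → f i ≤ g i) → sum f ≤ sum g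
  sum-mono-≤ {zero} le = z≤n
  sum-mono-≤ {suc n} le = +-mono-≤ (le zero) (sum-mono-≤ (le ∘ suc))

  +-≤-≡ : ∀ {a b c d} → a ≤ c → b ≤ d → a + b ≡ c + d → a ≡ c × b ≡ d
  +-≤-≡ {a} {b} {c} {d} a≤c b≤d e = a≡c , +-cancelˡ-≡ a b d (trans e (cong (_+ d) (sym a≡c)))
    where
    a≡c : a ≡ c
    a≡c = ≤-antisym a≤c (+-cancelʳ-≤ b c a (≤-trans (+-monoʳ-≤ c b≤d) (≤-reflexive (sym e))))

  -- The bridge from counting to single coordinates: a termwise bound that is sharp in total is
  -- sharp at every index.
  sum-≤-≡ : ∀ {n} {f g : Fin n → ℕ} → (∀ i → f i ≤ g i) → sum f ≡ sum g → ∀ i → f i ≡ g i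
  sum-≤-≡ {suc n} le e zero = proj₁ (+-≤-≡ (le zero) (sum-mono-≤ (le ∘ suc)) e)
  sum-≤-≡ {suc n} le e (suc i) = sum-≤-≡ (le ∘ suc) (proj₂ (+-≤-≡ (le zero) (sum-mono-≤ (le ∘ suc)) e)) i

  sum-pos : ∀ {n} {f : Fin n → ℕ} → 0 < sum f → ∃ λ i → 0 < f i
  sum-pos {suc n} {f} p with f zero in eq
  ... | suc a = zero , subst (0 <_) (sym eq) z<s
  ... | zero = let i , q = sum-pos {n} p in suc i , q

  sum-≥ : ∀ {n} (f : Fin n → ℕ) → ∀ i → f i ≤ sum f
  sum-≥ f zero = m≤m+n _ _
  sum-≥ f (suc i) = ≤-trans (sum-≥ (f ∘ suc) i) (m≤n+m _ _)

  ⟦_⟧ : ∀ {p} {P : Set p} → Dec P → ℕ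
  ⟦ yes _ ⟧ = 1
  ⟦ no _ ⟧ = 0

  ⟦_⟧ᶜ : ∀ {p} {P : Set p} → Dec P → ℕ
  ⟦ yes _ ⟧ᶜ = 0
  ⟦ no _ ⟧ᶜ = 1

  module _ {p} {P : Set p} where
    indᶜ-no : (d : Dec P) → ¬ P → ⟦ d ⟧ᶜ ≡ 1
    indᶜ-no (yes p) ¬p = contradiction p ¬p
    indᶜ-no (no _) _ = refl

    indᶜ+ind : (d : Dec P) → ⟦ d ⟧ᶜ + ⟦ d ⟧ ≡ 1
    indᶜ+ind (yes _) = refl
    indᶜ+ind (no _) = refl

    ind-≤1 : (d : Dec P) → ⟦ d ⟧ ≤ 1
    ind-≤1 (yes _) = ≤-refl
    ind-≤1 (no _) = z≤n

    ind-yes : (d : Dec P) → P → ⟦ d ⟧ ≡ 1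
    ind-yes (yes _) _ = refl
    ind-yes (no ¬p) p = contradiction p ¬p

    ind-no : (d : Dec P) → ¬ P → ⟦ d ⟧ ≡ 0
    ind-no (yes p) ¬p = contradiction p ¬p
    ind-no (no _) _ = refl

    ind-1 : (d : Dec P) → ⟦ d ⟧ ≡ 1 → P
    ind-1 (yes p) _ = p

  ind-mono : ∀ {p q} {P : Set p} {Q : Set q} (d : Dec P) (e : Dec Q) → (P → Q) → ⟦ d ⟧ ≤ ⟦ e ⟧
  ind-mono (yes p) e f = ≤-reflexive (sym (ind-yes e (f p)))
  ind-mono (no _) e f = z≤n

  ind-cong : ∀ {p q} {P : Set p} {Q : Set q} (d : Dec P) (e : Dec Q) → (P → Q) → (Q → P) → ⟦ d ⟧ ≡ ⟦ e ⟧
  ind-cong d e f g = ≤-antisym (ind-mono d e f) (ind-mono e d g)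

  module Modular (N : ℕ) {{_ : NonZero N}} where
    infix 4 _≈_ _≈?_
    -- A record and not the bare equation of remainders, so that unification can recover `a` and `b`
    -- from the type.
    record _≈_ (a b : ℕ) : Set where
      constructor mk
      field un : a % N ≡ b % N
    open _≈_ public

    -- Keeps the decision from unfolding inside the indicators that are built on it.
    abstract
      _≈?_ : ∀ a b → Dec (a ≈ b)
      a ≈? b = map′ mk un (a % N ≟ b % N)

    ≈-refl : ∀ {a} → a ≈ a
    ≈-refl = mk refl

    ≡⇒≈ : ∀ {a b} → a ≡ b → a ≈ b
    ≡⇒≈ refl = ≈-refl

    ≈-sym : ∀ {a b} → a ≈ b → b ≈ a
    ≈-sym (mk e) = mk (sym e)

    ≈-trans : ∀ {a b c} → a ≈ b → b ≈ c → a ≈ c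
    ≈-trans (mk e) (mk f) = mk (trans e f)

    ≈-+ : ∀ {a b c d} → a ≈ b → c ≈ d → a + c ≈ b + d
    ≈-+ {a} {b} {c} {d} (mk e) (mk f) = mk (begin
      (a + c) % N ≡⟨ %-distribˡ-+ a c N ⟩
      (a % N + c % N) % N ≡⟨ cong₂ (λ u v → (u + v) % N) e f ⟩
      (b % N + d % N) % N ≡⟨ %-distribˡ-+ b d N ⟨
      (b + d) % N ∎) where open ≡-Reasoning

    ≈-* : ∀ {a b c d} → a ≈ b → c ≈ d → a * c ≈ b * d
    ≈-* {a} {b} {c} {d} (mk e) (mk f) = mk (begin
      (a * c) % N ≡⟨ %-distribˡ-* a c N ⟩
      ((a % N) * (c % N)) % N ≡⟨ cong₂ (λ u v → (u * v) % N) e f ⟩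
      ((b % N) * (d % N)) % N ≡⟨ %-distribˡ-* b d N ⟨
      (b * d) % N ∎) where open ≡-Reasoning

    ≈-*ˡ : ∀ j {a b} → a ≈ b → j * a ≈ j * b
    ≈-*ˡ j = ≈-* (≈-refl {j})

    ≈-% : ∀ a → a % N ≈ a
    ≈-% a = mk (m%n%n≡m%n a N)

    ≈-+N : ∀ a j → a + j * N ≈ a
    ≈-+N a j = mk ([m+kn]%n≡m%n a j N)

    N≈0 : N ≈ 0
    N≈0 = mk (trans (n%n≡0 N) (sym (0% N)))
      where
      0% : ∀ N {{_ : NonZero N}} → 0 % N ≡ 0
      0% (suc _) = refl

    0%N : 0 % N ≡ 0
    0%N = trans (sym (un N≈0)) (n%n≡0 N)

    ∣⇒≈0 : ∀ {a} → N ∣ a → a ≈ 0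
    ∣⇒≈0 (divides q refl) = ≈-+N 0 q

    ≈0⇒∣ : ∀ {a} → a ≈ 0 → N ∣ a
    ≈0⇒∣ {a} (mk e) = m%n≡0⇒n∣m a N (trans e 0%N)

    ≈0⇒% : ∀ {a} → a ≈ 0 → a % N ≡ 0
    ≈0⇒% (mk e) = trans e 0%N

    %⇒≈0 : ∀ {a} → a % N ≡ 0 → a ≈ 0
    %⇒≈0 e = mk (trans e (sym 0%N))

    <⇒≈⇒≡ : ∀ {a b} → a < N → b < N → a ≈ b → a ≡ b
    <⇒≈⇒≡ a< b< (mk e) = trans (sym (m<n⇒m%n≡m a<)) (trans e (m<n⇒m%n≡m b<))

    -- Multiplication by `N - 1` needs no reduced representative and is the same scalar at every
    -- coordinate, so closure under addition already gives closure under inverses.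
    neg : ℕ → ℕ
    neg a = pred N * a

    +-neg : ∀ a → a + neg a ≈ 0
    +-neg a = ≈-trans (≡⇒≈ (trans (cong (_* a) (suc-pred N)) (*-comm N a))) (≈-+N 0 a)

    ≈-cancelʳ : ∀ {a b} c → a + c ≈ b + c → a ≈ b
    ≈-cancelʳ {a} {b} c e = ≈-trans (≈-sym (lem a)) (≈-trans (≈-+ e (≈-refl {neg c})) (lem b))
      where
      lem : ∀ a → a + c + neg c ≈ a
      lem a = ≈-trans (≡⇒≈ (+-assoc a c (neg c))) (≈-trans (≈-+ ≈-refl (+-neg c)) (≡⇒≈ (+-identityʳ a)))

    ≈-cancelˡ : ∀ {a b} c → c + a ≈ c + b → a ≈ b
    ≈-cancelˡ {a} {b} c e = ≈-cancelʳ c (≈-trans (≡⇒≈ (+-comm a c)) (≈-trans e (≡⇒≈ (+-comm c b))))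

    +≈0⇒≈neg : ∀ {a b} → a + b ≈ 0 → a ≈ neg b
    +≈0⇒≈neg {a} {b} e = ≈-cancelʳ b (≈-trans e (≈-sym (≈-trans (≡⇒≈ (+-comm (neg b) b)) (+-neg b))))

-- Heights, supports and carries in a finite group of residue vectors.

module ResidueGroups where

  open FiniteSums
  open import Data.Nat
  open import Data.Nat.Properties
  open import Data.Nat.DivMod
  open import Data.Nat.Divisibility
  open import Data.Nat.Tactic.RingSolver using (solve-∀)
  open import Data.Fin.Base using (Fin; zero; suc)
  open import Data.Fin.Properties using (all?)
  open import Data.Vec using (Vec; lookup; tabulate)
  open import Data.Vec.Properties using (tabulate-cong)
  open import Data.List using (List; length)
  open import Data.List.Relation.Unary.Unique.Propositional using (Unique)
  open import Data.List.Membership.Propositional using (_∈_)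
  open import Data.Product using (∃; _×_; _,_; proj₂)
  open import Data.Sum using (_⊎_; inj₁; inj₂)
  open import Data.Empty using (⊥)
  open import Relation.Nullary using (¬_; Dec; yes; no; contradiction)
  open import Relation.Binary.PropositionalEquality
  open import Function using (_∘_)

  module Residues (n N : ℕ) {{_ : NonZero N}} (E : List (Vec ℕ n)) where
    open Modular N public

    -- Group elements are arbitrary unreduced representatives; only `res` compares them with the
    -- list `E`.
    Fun : Set
    Fun = Fin n → ℕ

    res : Fun → Vec ℕ n
    res f = tabulate (λ i → f i % N)

    InE : Fun → Set
    InE f = res f ∈ E

    infix 4 _≋_ _≋?_
    _≋_ : Fun → Fun → Set
    f ≋ g = ∀ i → f i ≈ g i

    _≋?_ : ∀ f g → Dec (f ≋ g)
    f ≋? g = all? (λ i → f i ≈? g i)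

    ≋-sym : ∀ {f g} → f ≋ g → g ≋ f
    ≋-sym e i = ≈-sym (e i)

    ≋-trans : ∀ {f g h} → f ≋ g → g ≋ h → f ≋ h
    ≋-trans e e' i = ≈-trans (e i) (e' i)

    InE-resp : ∀ {f g} → f ≋ g → InE f → InE g
    InE-resp e = subst (_∈ E) (tabulate-cong (un ∘ e))

    infixl 6 _⊞_
    _⊞_ : Fun → Fun → Fun
    (f ⊞ g) i = f i + g i

    infixl 7 _⊡_
    _⊡_ : ℕ → Fun → Fun
    (j ⊡ f) i = j * f i

    nz : Fun → Fin n → ℕ
    nz f i = ⟦ f i ≈? 0 ⟧ᶜ

    iz : Fun → Fin n → ℕ
    iz f i = ⟦ f i ≈? 0 ⟧

    nz+iz : ∀ f i → nz f i + iz f i ≡ 1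
    nz+iz f i = indᶜ+ind (f i ≈? 0)

    sum-nz+iz : ∀ f → sum (nz f) + sum (iz f) ≡ n
    sum-nz+iz f = trans (sym (∑-distrib-+ (nz f) (iz f))) (trans (sum-cong-≗ (nz+iz f))
        (trans (sum-const n 1) (*-identityʳ n)))

    nz-≉ : ∀ f i → ¬ f i ≈ 0 → nz f i ≡ 1
    nz-≉ f i = indᶜ-no (f i ≈? 0)

    ht : Fun → ℕ
    ht f = sum (λ i → f i % N)

    0<N : 0 < N
    0<N = >-nonZero⁻¹ N

  -- Λ multiplied by a common denominator N: its elements become vectors of residues modulo N,
  -- and an element of height j has coordinate sum j N.
  record Setting : Set where
    field
      n N k m : ℕ
      {{N≢0}} : NonZero N
      0<k : 0 < k
      E : List (Vec ℕ n)
      unique : Unique E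
      size : length E ≡ m
      bounded : ∀ {x} → x ∈ E → ∀ i → lookup x i < N
    open Residues n N E public
    field
      0∈ : InE (λ _ → 0)
      add : ∀ {f g} → InE f → InE g → InE (f ⊞ g)
      g : Fun
      g∈ : InE g
      g<N : ∀ i → g i < N
      ht-g : ht g ≡ N * (2 * k)
      hts : ∀ f → InE f → f ≋ (λ _ → 0) ⊎ f ≋ g ⊎ ht f ≡ N * k
      full : ∀ i → ∃ λ f → InE f × ¬ f i ≈ 0

  module Core (S : Setting) where
    open Setting S

    mul : ∀ j {f} → InE f → InE (j ⊡ f)
    mul zero f∈ = 0∈
    mul (suc j) f∈ = add f∈ (mul j f∈)

    ⊟_ : Fun → Fun
    (⊟ f) i = neg (f i)

    negate : ∀ {f} → InE f → InE (⊟ f)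
    negate = mul (pred N)

    -- In the second case the two residues add up to a multiple of `N` strictly between 0 and `2N`.
    neg-cases : ∀ a → (a ≈ 0 × neg a ≈ 0) ⊎ (¬ a ≈ 0 × a % N + neg a % N ≡ N)
    neg-cases a with a ≈? 0
    ... | yes e = inj₁ (e , ≈-trans (≈-*ˡ (pred N) e) (≡⇒≈ (*-zeroʳ (pred N))))
    ... | no ne = inj₂ (ne , ≤-antisym le ge)
      where
      z : a % N + neg a % N ≈ 0
      z = ≈-trans (≈-+ (≈-% a) (≈-% (neg a))) (+-neg a)
      pos : 0 < a % N
      pos = n≢0⇒n>0 (ne ∘ %⇒≈0)
      ge : N ≤ a % N + neg a % N
      ge = ∣⇒≤ {{>-nonZero (≤-trans pos (m≤m+n _ _))}} (≈0⇒∣ z)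
      lt : a % N + neg a % N < N + N
      lt = +-mono-< (m%n<n a N) (m%n<n (neg a) N)
      le : a % N + neg a % N ≤ N
      le with ≈0⇒∣ z
      ... | divides zero eq = ≤-trans (≤-reflexive eq) z≤n
      ... | divides (suc zero) eq = ≤-reflexive (trans eq (*-identityˡ N))
      ... | divides (suc (suc q)) eq =
          contradiction lt (≤⇒≯ (≤-trans (+-monoʳ-≤ N (m≤m+n N (q * N))) (≤-reflexive (sym eq))))

    neg-sum : ∀ f i → f i % N + neg (f i) % N ≡ N * nz f i
    neg-sum f i with neg-cases (f i) | f i ≈? 0
    ... | inj₁ (e , e') | yes _ = trans (cong₂ _+_ (≈0⇒% e) (≈0⇒% e')) (sym (*-zeroʳ N))
    ... | inj₁ (e , e') | no ne = contradiction e ne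
    ... | inj₂ (ne , eq) | yes e = contradiction e ne
    ... | inj₂ (ne , eq) | no _ = trans eq (sym (*-identityʳ N))

    -- A coordinate and its inverse contribute `N` together unless they vanish; so the heights of an
    -- element and its inverse determine the size of the support.
    ht-neg : ∀ f → ht f + ht (⊟ f) ≡ N * sum (nz f)
    ht-neg f = trans (sym (∑-distrib-+ (λ i → f i % N) (λ i → neg (f i) % N)))
      (trans (sum-cong-≗ (neg-sum f)) (sym (*-distribˡ-sum N (nz f))))

    h : Fun
    h i = neg (g i) % N

    h≋⊟g : h ≋ ⊟ g
    h≋⊟g i = ≈-% (neg (g i))

    h∈ : InE h
    h∈ = InE-resp (≋-sym h≋⊟g) (negate g∈)

    h<N : ∀ i → h i < N
    h<N i = m%n<n (neg (g i)) N

    g+h≈0 : ∀ i → g i + h i ≈ 0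
    g+h≈0 i = ≈-trans (≈-+ ≈-refl (h≋⊟g i)) (+-neg (g i))

    +h≈0⇒≋g : ∀ {f} → f ⊞ h ≋ (λ _ → 0) → f ≋ g
    +h≈0⇒≋g e i = ≈-cancelʳ (h i) (≈-trans (e i) (≈-sym (g+h≈0 i)))

    record Other (f : Fun) : Set where
      constructor other
      field
        ∈E : InE f
        ≢0 : ¬ f ≋ (λ _ → 0)
        ≢g : ¬ f ≋ g
        ≢h : ¬ f ≋ h
    open Other

    ht-other : ∀ {f} → InE f → ¬ f ≋ (λ _ → 0) → ¬ f ≋ g → ht f ≡ N * k
    ht-other {f} f∈ n0 ng with hts f f∈
    ... | inj₁ e = contradiction e n0
    ... | inj₂ (inj₁ e) = contradiction e ng
    ... | inj₂ (inj₂ e) = e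

    neg-neg : ∀ a → neg (neg a) ≈ a
    neg-neg a = ≈-cancelʳ (neg a) (≈-trans (≡⇒≈ (+-comm (neg (neg a)) (neg a)))
        (≈-trans (+-neg (neg a)) (≈-sym (+-neg a))))

    ≈neg⇒ : ∀ {a b} → neg a ≈ b → a ≈ neg b
    ≈neg⇒ {a} {b} e = ≈-trans (≈-sym (neg-neg a)) (≈-*ˡ (pred N) e)

    other-neg : ∀ {f} → Other f → Other (⊟ f)
    other-neg {f} (other i n0 ng nh) = other (negate i)
      (λ e → n0 (λ j → ≈-trans (≈neg⇒ (e j)) (≡⇒≈ (*-zeroʳ (pred N)))))
      (λ e → nh (λ j → ≈-trans (≈neg⇒ (e j)) (≈-sym (h≋⊟g j))))
      (λ e → ng (λ j → ≈-trans (≈neg⇒ (e j)) (≈-trans (≈-*ˡ (pred N) (h≋⊟g j)) (neg-neg (g j)))))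

    other-supp : ∀ {f} → Other f → sum (nz f) ≡ 2 * k
    other-supp {f} o = *-cancelˡ-≡ _ _ N (begin
      N * sum (nz f) ≡⟨ ht-neg f ⟨
      ht f + ht (⊟ f) ≡⟨ cong₂ _+_ (ht-other (∈E o) (≢0 o) (≢g o)) (ht-other (∈E o') (≢0 o') (≢g o')) ⟩
      N * k + N * k ≡⟨ lem N k ⟩
      N * (2 * k) ∎)
      where
      open ≡-Reasoning
      o' = other-neg o
      lem : ∀ N k → N * k + N * k ≡ N * (2 * k)
      lem = solve-∀

    carry : ℕ → ℕ → ℕ
    carry a b = ⟦ N ≤? a % N + b % N ⟧

    carry-eq : ∀ a b → (a + b) % N + N * carry a b ≡ a % N + b % N
    carry-eq a b with N ≤? a % N + b % N
    ... | no ≰ = trans (cong₂ _+_ (trans (un (≈-sym (≈-+ (≈-% a) (≈-% b)))) (m<n⇒m%n≡m (≰⇒> ≰))) (*-zeroʳ N))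
        (+-identityʳ _)
    ... | yes le = trans (cong₂ _+_ eq (*-identityʳ N)) (m∸n+n≡m le)
      where
      s = a % N + b % N
      s-N<N : s ∸ N < N
      s-N<N = +-cancelʳ-< N (s ∸ N) N (≤-trans (s≤s (≤-reflexive (m∸n+n≡m le)))
          (+-mono-< (m%n<n a N) (m%n<n b N)))
      eq : (a + b) % N ≡ s ∸ N
      eq = trans (un (≈-trans (≈-sym (≈-+ (≈-% a) (≈-% b)))
             (≈-trans (≡⇒≈ (sym (m∸n+n≡m le))) (≈-trans (≈-+ (≈-refl {s ∸ N}) N≈0) (≡⇒≈ (+-identityʳ _))))))
             (m<n⇒m%n≡m s-N<N)

    -- Each carry costs `N`, so three heights determine the number of carries.
    ht-add : ∀ (f f' : Fun) → ht (f ⊞ f') + N * sum (λ i → carry (f i) (f' i)) ≡ ht f + ht f'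
    ht-add f f' = begin
      ht (f ⊞ f') + N * sum (λ i → carry (f i) (f' i)) ≡⟨ cong (ht (f ⊞ f') +_)
          (*-distribˡ-sum N (λ i → carry (f i) (f' i))) ⟩
      ht (f ⊞ f') + sum (λ i → N * carry (f i) (f' i)) ≡⟨ ∑-distrib-+ (λ i → (f i + f' i) % N) _ ⟨
      sum (λ i → (f i + f' i) % N + N * carry (f i) (f' i)) ≡⟨ sum-cong-≗ (λ i → carry-eq (f i) (f' i)) ⟩
      sum (λ i → f i % N + f' i % N) ≡⟨ ∑-distrib-+ (λ i → f i % N) _ ⟩
      ht f + ht f' ∎ where open ≡-Reasoning

    carry≤nz : ∀ (f f' : Fun) i → carry (f i) (f' i) ≤ nz f i
    carry≤nz f f' i = go (f i ≈? 0)
      where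
      go : (d : Dec (f i ≈ 0)) → carry (f i) (f' i) ≤ ⟦ d ⟧ᶜ
      go (no _) = ind-≤1 (N ≤? f i % N + f' i % N)
      go (yes e) = ≤-reflexive (ind-no (N ≤? f i % N + f' i % N)
        (λ le → <⇒≱ (m%n<n (f' i) N) (≤-trans le (≤-reflexive (cong (_+ f' i % N) (≈0⇒% e))))))

    -- `f + g` is neither 0 nor `g`, because `f` is neither `h` nor 0, so it has height `k`. The
    -- heights `k`, `2k` and `k` leave room for exactly `2k` carries; these occur only in the
    -- support of `f`, which has `2k` elements.
    other-carry : ∀ {f} → Other f → ∀ i → ¬ f i ≈ 0 → N ≤ f i % N + g i
    other-carry {f} o i ne = subst (λ z → N ≤ f i % N + z) (m<n⇒m%n≡m (g<N i))
        (ind-1 (N ≤? f i % N + g i % N) (trans (sum-≤-≡ (carry≤nz f g) eq i) (nz-≉ f i ne)))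
      where
      open ≡-Reasoning
      eq : sum (λ i → carry (f i) (g i)) ≡ sum (nz f)
      eq = trans (*-cancelˡ-≡ _ _ N (+-cancelˡ-≡ (N * k) _ _ (begin
        N * k + N * sum (λ i → carry (f i) (g i)) ≡⟨ cong (_+ N * sum (λ i → carry (f i) (g i)))
            (ht-other (add (∈E o) g∈)
             (λ e → ≢h o (λ i → ≈-cancelˡ (g i) (≈-trans (≡⇒≈ (+-comm (g i) (f i)))
               (≈-trans (e i) (≈-sym (g+h≈0 i))))))
             (λ e → ≢0 o (λ i → ≈-cancelʳ (g i) (e i)))) ⟨
        ht (f ⊞ g) + N * sum (λ i → carry (f i) (g i)) ≡⟨ ht-add f g ⟩
        ht f + ht g ≡⟨ cong₂ _+_ (ht-other (∈E o) (≢0 o) (≢g o)) ht-g ⟩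
        N * k + N * (2 * k) ∎))) (sym (other-supp o))

    -- Where `g` vanishes nothing can carry, so by `other-carry` every element of the group would
    -- vanish there, against `full`.
    g≉0 : ∀ i → ¬ g i ≈ 0
    g≉0 i g0 with full i
    ... | f , f∈ , fi with f ≋? (λ _ → 0) | f ≋? g | f ≋? h
    ... | yes e | _ | _ = fi (e i)
    ... | no _ | yes e | _ = fi (≈-trans (e i) g0)
    ... | no _ | no _ | yes e =
        fi (≈-trans (e i) (≈-trans (h≋⊟g i) (≈-trans (≈-*ˡ (pred N) g0) (≡⇒≈ (*-zeroʳ (pred N))))))
    ... | no a | no b | no c = <⇒≱ (m%n<n (f i) N) (≤-trans (other-carry (other f∈ a b c) i fi)
        (≤-reflexive (trans (cong (f i % N +_) (trans (sym (m<n⇒m%n≡m (g<N i))) (≈0⇒% g0))) (+-identityʳ _))))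

    g+h : ∀ i → g i + h i ≡ N
    g+h i with neg-cases (g i)
    ... | inj₁ (e , _) = contradiction e (g≉0 i)
    ... | inj₂ (_ , e) = trans (cong (_+ h i) (sym (m<n⇒m%n≡m (g<N i)))) e

    0<h : ∀ i → 0 < h i
    0<h i = n≢0⇒n>0 (λ e → <-irrefl (trans (sym (+-identityʳ _)) (trans (cong (g i +_) (sym e)) (g+h i)))
        (g<N i))

    other-low : ∀ {f} → Other f → ∀ i → ¬ f i ≈ 0 → h i ≤ f i % N
    other-low {f} o i ne = +-cancelˡ-≤ (g i) _ _ (≤-trans (≤-reflexive (g+h i))
      (≤-trans (other-carry o i ne) (≤-reflexive (+-comm _ (g i)))))

    -- The lower bound `other-low`, applied to the inverse of `f`.
    other-high : ∀ {f} → Other f → ∀ i → ¬ f i ≈ 0 → f i % N + h i ≤ N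
    other-high {f} o i ne with neg-cases (f i)
    ... | inj₁ (e , _) = contradiction e ne
    ... | inj₂ (_ , e) = ≤-trans (+-monoʳ-≤ (f i % N) (other-low (other-neg o) i nn)) (≤-reflexive e)
      where
      nn : ¬ neg (f i) ≈ 0
      nn e' = ne (≈-trans (≈neg⇒ e') (≡⇒≈ (*-zeroʳ (pred N))))

    sum-g+h : ht g + ht h ≡ N * n
    sum-g+h = begin
      ht g + ht h ≡⟨ ∑-distrib-+ (λ i → g i % N) _ ⟨
      sum (λ i → g i % N + h i % N) ≡⟨ sum-cong-≗ (λ i → trans (cong₂ _+_ (m<n⇒m%n≡m (g<N i))
          (m<n⇒m%n≡m (h<N i))) (g+h i)) ⟩
      sum {n} (λ i → N) ≡⟨ sum-const n N ⟩
      n * N ≡⟨ *-comm n N ⟩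
      N * n ∎ where open ≡-Reasoning

    h≉0 : ∀ i → ¬ h i ≈ 0
    h≉0 i e = <-irrefl (trans (sym (≈0⇒% e)) (m<n⇒m%n≡m (h<N i))) (0<h i)

    n>0 : 0 < n
    n>0 = n≢0⇒n>0 λ n≡0 →
        <-irrefl (sym (m+n≡0⇒m≡0 (ht g) (trans sum-g+h (trans (cong (N *_) n≡0) (*-zeroʳ N)))))
       (≤-trans (*-mono-≤ 0<N (*-mono-≤ {1} {2} (s≤s z≤n) 0<k)) (≤-reflexive (sym ht-g)))

    i₀ : Fin n
    i₀ = toFin n>0
      where
      toFin : ∀ {n} → 0 < n → Fin n
      toFin (s≤s _) = zero

    -- Stronger than `Other`, as 0, `h` and `g = (N - 1) h` are all multiples of `h`, and, unlike
    -- `Other`, stable under translation by `h`, which the repeated addition of `h` requires.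
    record Out (f : Fun) : Set where
      constructor out
      field
        ∈E′ : InE f
        ≢m : ∀ j → ¬ f ≋ j ⊡ h
    open Out public

    0≋ : (λ _ → 0) ≋ 0 ⊡ h
    0≋ i = ≈-refl

    h≋ : h ≋ 1 ⊡ h
    h≋ i = ≡⇒≈ (sym (+-identityʳ (h i)))

    g≋ : g ≋ pred N ⊡ h
    g≋ i = +≈0⇒≈neg (g+h≈0 i)

    Out⇒Other : ∀ {f} → Out f → Other f
    Out⇒Other (out f∈ nm) =
        other f∈ (λ e → nm 0 (≋-trans e 0≋)) (λ e → nm (pred N) (≋-trans e g≋)) (λ e → nm 1 (≋-trans e h≋))

    Out-shift : ∀ {f} t → Out f → Out (f ⊞ t ⊡ h)
    Out-shift {f} t (out f∈ nm) = out (add f∈ (mul t h∈))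
      -- The coefficient stands for `j - t`.
      (λ j e → nm (j + pred N * t) (λ i → ≈-cancelʳ (t * h i) (≈-trans (e i) (≈-sym (unshift j i)))))
      where
      unshift : ∀ j i → (j + pred N * t) * h i + t * h i ≈ j * h i
      unshift j i = ≈-trans (≡⇒≈ (lem j (pred N) t (h i))) (≈-trans (≈-+ (≈-refl {j * h i}) (+-neg (t * h i)))
          (≡⇒≈ (+-identityʳ _)))
        where
        lem : ∀ j P t h → (j + P * t) * h + t * h ≡ j * h + (t * h + P * (t * h))
        lem = solve-∀

    Out-resp : ∀ {f f'} → f ≋ f' → Out f → Out f'
    Out-resp e (out i nm) = out (InE-resp e i) (λ j e' → nm j (≋-trans e e'))

    out-step : ∀ {f} → Out f → ∀ i → ¬ f i ≈ 0 → ¬ f i + h i ≈ 0 →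
        f i % N + h i < N × (f i + h i) % N ≡ f i % N + h i
    out-step {f} o i ne ne' = lt , trans (un (≈-sym (≈-+ (≈-% (f i)) (≈-refl {h i})))) (m<n⇒m%n≡m lt)
      where
      lt : f i % N + h i < N
      lt = ≤∧≢⇒< (other-high (Out⇒Other o) i ne)
        (λ e → ne' (≈-trans (≈-+ (≈-sym (≈-% (f i))) (≈-refl {h i})) (≈-trans (≡⇒≈ e) N≈0)))

    shift1 : ∀ f → f ⊞ 1 ⊡ h ≋ f ⊞ h
    shift1 f i = ≈-+ (≈-refl {f i}) (≈-sym (h≋ i))

    -- While f i + h i does not wrap around, adding h to f strictly increases the residue at i.
    descend : ∀ fuel {f} → Out f → ∀ i → N ≤ f i % N + fuel → ∃ λ t → (f ⊞ t ⊡ h) i ≈ 0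
    descend zero {f} o i le = contradiction (≤-trans le (≤-reflexive (+-identityʳ _))) (<⇒≱ (m%n<n (f i) N))
    descend (suc fuel) {f} o i le with f i ≈? 0 | (f i + h i) ≈? 0
    ... | yes e | _ = 0 , ≈-trans (≡⇒≈ (+-identityʳ (f i))) e
    ... | no _ | yes e = 1 , ≈-trans (shift1 f i) e
    ... | no ne | no ne' = let t , e = descend fuel (Out-resp (shift1 f) (Out-shift 1 o)) i le' in
         suc t , ≈-trans (≡⇒≈ (sym (+-assoc (f i) (h i) (t * h i)))) e
      where
      le' : N ≤ (f i + h i) % N + fuel
      le' = ≤-trans le (≤-trans (≤-trans (≤-reflexive (sym (+-assoc (f i % N) 1 fuel)))
          (+-monoˡ-≤ fuel (+-monoʳ-≤ (f i % N) (0<h i))))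
         (≤-reflexive (cong (_+ fuel) (sym (proj₂ (out-step o i ne ne'))))))

    out-zero : ∀ {f} → Out f → ∀ i → ∃ λ t → (f ⊞ t ⊡ h) i ≈ 0
    out-zero {f} o i = descend N o i (m≤n+m N (f i % N))

    ht-h≡sum : ht h ≡ sum h
    ht-h≡sum = sum-cong-≗ (λ i → m<n⇒m%n≡m (h<N i))

    module Self (h≋g : h ≋ g) where
      -- Here `g` and `h` both have height `2k`, and their coordinates are complementary to each
      -- other.
      n≡4k : n ≡ 4 * k
      n≡4k = *-cancelˡ-≡ n (4 * k) N (trans (sym sum-g+h) (trans
          (cong₂ _+_ ht-g (trans (sum-cong-≗ (un ∘ h≋g)) ht-g)) (lem N k)))
        where
        lem : ∀ N k → N * (2 * k) + N * (2 * k) ≡ N * (4 * k)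
        lem = solve-∀

      2h≡N : ∀ i → 2 * h i ≡ N
      2h≡N i = trans (cong₂ _+_ (<⇒≈⇒≡ (h<N i) (g<N i) (h≋g i)) (+-identityʳ (h i))) (g+h i)

      zeros : ∀ {f} → Out f → sum (iz f) ≡ 2 * k
      zeros {f} o = +-cancelˡ-≡ (2 * k) _ _ (trans (cong (_+ sum (iz f)) (sym (other-supp (Out⇒Other o))))
          (trans (sum-nz+iz f) (trans n≡4k (lem k))))
        where
        lem : ∀ k → 4 * k ≡ 2 * k + 2 * k
        lem = solve-∀

    module NonSelf (h≉g : ¬ h ≋ g) where

      sum-h : sum h ≡ N * k
      sum-h = trans (sym ht-h≡sum) (ht-other h∈ (λ e → h≉0 i₀ (e i₀)) h≉g)

      -- Complementary coordinates again, now with heights `2k` for `g` and `k` for `h`.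
      n≡3k : n ≡ 3 * k
      n≡3k = *-cancelˡ-≡ n (3 * k) N (trans (sym sum-g+h) (trans (cong₂ _+_ ht-g (trans ht-h≡sum sum-h))
          (lem N k)))
        where
        lem : ∀ N k → N * (2 * k) + N * k ≡ N * (3 * k)
        lem = solve-∀

      zeros : ∀ {f} → Other f → sum (iz f) ≡ k
      zeros {f} o = +-cancelˡ-≡ (2 * k) _ _ (trans (cong (_+ sum (iz f)) (sym (other-supp o)))
          (trans (sum-nz+iz f) (trans n≡3k (lem k))))
        where
        lem : ∀ k → 3 * k ≡ 2 * k + k
        lem = solve-∀

      -- `(j + 1) h` equals `g = -h` only if `(j + 2) h` vanishes, and equals `h` only if `j h`
      -- vanishes.
      multiple-other : ∀ j → ¬ suc j ⊡ h ≋ (λ _ → 0) → ¬ j ⊡ h ≋ (λ _ → 0) → ¬ suc (suc j) ⊡ h ≋ (λ _ → 0) →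
          Other (suc j ⊡ h)
      multiple-other j a b c = other (mul (suc j) h∈) a
        (λ e → c (λ i → ≈-trans (≈-+ (≈-refl {h i}) (e i)) (≈-trans (≡⇒≈ (+-comm (h i) (g i))) (g+h≈0 i))))
        (λ e → b (λ i → ≈-cancelˡ (h i) (≈-trans (e i) (≡⇒≈ (sym (+-identityʳ (h i)))))))

      1h≉0 : 1 ⊡ h ≋ (λ _ → 0) → ⊥
      1h≉0 e = h≉0 i₀ (≈-trans (h≋ i₀) (e i₀))

      2h≉0 : ¬ 2 ⊡ h ≋ (λ _ → 0)
      2h≉0 e = h≉g (+h≈0⇒≋g (λ i → ≈-trans (≈-+ (≈-refl {h i}) (h≋ i)) (e i)))

      ∣-small : ∀ {a} → a ≈ 0 → 0 < a → a < 2 * N → a ≡ N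
      ∣-small {a} e pos lt with ≈0⇒∣ e
      ... | divides zero eq = contradiction (subst (0 <_) eq pos) λ ()
      ... | divides (suc zero) eq = trans eq (*-identityˡ N)
      ... | divides (suc (suc q)) eq =
          contradiction lt (≤⇒≯ (≤-trans (*-monoˡ-≤ N {2} {2 + q} (s≤s (s≤s z≤n))) (≤-reflexive (sym eq))))

      module Three (3h≋0 : 3 ⊡ h ≋ (λ _ → 0)) where
        3h≥N : ∀ i → N ≤ 3 * h i
        3h≥N i = ∣⇒≤ {{m*n≢0 3 (h i) {{_}} {{>-nonZero (0<h i)}}}} (≈0⇒∣ (3h≋0 i))

        -- Every `3 h_i` is a positive multiple of `N`, and their sum is `n N`, so none can exceed
        -- `N`.
        3h≡N : ∀ i → 3 * h i ≡ N
        3h≡N i = sym (sum-≤-≡ 3h≥N (begin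
          sum {n} (λ _ → N) ≡⟨ sum-const n N ⟩
          n * N ≡⟨ cong (_* N) n≡3k ⟩
          3 * k * N ≡⟨ lem k N ⟩
          3 * (N * k) ≡⟨ cong (3 *_) sum-h ⟨
          3 * sum h ≡⟨ *-distribˡ-sum 3 h ⟩
          sum (λ i → 3 * h i) ∎) i)
          where
          open ≡-Reasoning
          lem : ∀ k N → 3 * k * N ≡ 3 * (N * k)
          lem = solve-∀

      module NotThree (3h≉0 : ¬ 3 ⊡ h ≋ (λ _ → 0)) where
        2h-other : Other (2 ⊡ h)
        2h-other = multiple-other 1 2h≉0 1h≉0 3h≉0

        -- Both bounds for the element `2h` combine to `2 h_i ≤ N`; hence its residue is `2 h_i`
        -- unless that is `N`, and the upper bound then reads `2 h_i + h_i ≤ N`.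
        3h≤N : ∀ i → ¬ 2 * h i ≡ N → 3 * h i ≤ N
        3h≤N i ne = ≤-trans (≤-reflexive (trans (+-comm (h i) (2 * h i)) (cong (_+ h i) (sym (m<n⇒m%n≡m lt)))))
            (other-high 2h-other i nz')
          where
          nz' : ¬ 2 * h i ≈ 0
          nz' e = ne (∣-small e (≤-trans (0<h i) (m≤m+n _ _)) (*-monoʳ-< 2 (h<N i)))
          lt : 2 * h i < N
          lt = ≤∧≢⇒< (≤-trans (≤-reflexive (cong (h i +_) (+-identityʳ (h i))))
              (≤-trans (+-monoˡ-≤ (h i) (other-low 2h-other i nz')) (other-high 2h-other i nz'))) ne

        B : Fin n → ℕ
        B i = ⟦ 2 * h i ≟ N ⟧

        -- The entries 1/2 of `h` are the zeros of `2h`, and an `Other` element has `k` zeros.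
        B≡ : sum B ≡ k
        B≡ = trans (sum-cong-≗ (λ i → ind-cong (2 * h i ≟ N) (2 * h i ≈? 0)
          (λ e → ≈-trans (≡⇒≈ e) N≈0)
          (λ e → ∣-small e (≤-trans (0<h i) (m≤m+n _ _)) (*-monoʳ-< 2 (h<N i))))) (zeros 2h-other)

        iB : ∃ λ i → 2 * h i ≡ N
        iB = let i , p = sum-pos (subst (0 <_) (sym B≡) 0<k) in i , ind-1 (2 * h i ≟ N) (≤-antisym (ind-≤1 _) p)

        -- Since an `Other` element has exactly `k` zeros, `k` known zeros are all of them.
        nonzero-off : ∀ {f} → Other f → ∀ {p} {P : Fin n → Set p} (P? : ∀ i → Dec (P i)) →
            sum (λ i → ⟦ P? i ⟧) ≡ k
          → (∀ i → P i → f i ≈ 0) → ∀ i → f i ≈ 0 → P i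
        nonzero-off {f} o P? eq z i e = ind-1 (P? i) (trans
           (sum-≤-≡ (λ i → ind-mono (P? i) (f i ≈? 0) (z i)) (trans eq (sym (zeros o))) i)
             (ind-yes (f i ≈? 0) e))

-- Multiplicities and permutations of lists.

module Multiplicities where

  open FiniteSums
  open import Defs using (cst)
  open import Data.Nat hiding (_/_)
  open import Data.Nat.Properties
  import Data.Integer as ℤ
  import Data.Integer.Properties as ℤP
  open import Data.Rational.Properties using (fromℚᵘ-cong)
  open import Data.Rational.Unnormalised using (mkℚᵘ; *≡*)
  open import Data.Fin.Base using (Fin; zero; suc)
  open import Data.Vec as Vec using (Vec; []; _∷_; toList; tabulate; lookup)
  open import Data.Vec.Properties using (tabulate∘lookup; tabulate-cong)
  open import Data.List as List using (List; []; _∷_; _++_; map; length; replicate; concat)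
  open import Data.List.Properties using (map-++; map-replicate)
  open import Data.List.Membership.Propositional using (_∈_; _∉_)
  open import Data.List.Membership.Propositional.Properties using (∈-∃++)
  open import Data.List.Relation.Unary.Any using (here; there)
  open import Data.List.Relation.Unary.All as All using (All; []; _∷_)
  open import Data.List.Relation.Unary.AllPairs using ([]; _∷_)
  open import Data.List.Relation.Unary.Unique.Propositional using (Unique)
  open import Data.List.Relation.Binary.Permutation.Propositional using (_↭_; ↭-refl; ↭-sym; ↭-trans; prep)
  open import Data.List.Relation.Binary.Permutation.Propositional.Properties using (shift; map⁺; ↭-length)
  open import Data.Product using (_,_)
  open import Relation.Nullary using (Dec; yes; no; contradiction)
  open import Relation.Binary.Definitions using (DecidableEquality)
  open import Relation.Binary.PropositionalEquality
  open import Function using (_∘_)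

  Vec-ext : ∀ {A : Set} {r} {u v : Vec A r} → (∀ i → lookup u i ≡ lookup v i) → u ≡ v
  Vec-ext {u = u} {v} e = trans (sym (tabulate∘lookup u)) (trans (tabulate-cong e) (tabulate∘lookup v))

  module Count {A : Set} (_≟A_ : DecidableEquality A) where

    cnt : A → List A → ℕ
    cnt x [] = 0
    cnt x (y ∷ ys) = ⟦ x ≟A y ⟧ + cnt x ys

    cnt-++ : ∀ x xs ys → cnt x (xs ++ ys) ≡ cnt x xs + cnt x ys
    cnt-++ x [] ys = refl
    cnt-++ x (y ∷ xs) ys = trans (cong (⟦ x ≟A y ⟧ +_) (cnt-++ x xs ys)) (sym (+-assoc ⟦ x ≟A y ⟧ _ _))

    cnt-replicate : ∀ x a y → cnt x (replicate a y) ≡ a * ⟦ x ≟A y ⟧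
    cnt-replicate x zero y = refl
    cnt-replicate x (suc a) y = cong (⟦ x ≟A y ⟧ +_) (cnt-replicate x a y)

    cnt-concat-replicate : ∀ x a ys → cnt x (concat (replicate a ys)) ≡ a * cnt x ys
    cnt-concat-replicate x zero ys = refl
    cnt-concat-replicate x (suc a) ys = trans (cnt-++ x ys _) (cong (cnt x ys +_) (cnt-concat-replicate x a ys))

    cnt-tabulate : ∀ x {n} (f : Fin n → A) → cnt x (toList (tabulate f)) ≡ sum (λ i → ⟦ x ≟A f i ⟧)
    cnt-tabulate x {zero} f = refl
    cnt-tabulate x {suc n} f = cong (⟦ x ≟A f zero ⟧ +_) (cnt-tabulate x (f ∘ suc))

    cnt-∈ : ∀ x ys → 0 < cnt x ys → x ∈ ys
    cnt-∈ x (y ∷ ys) p with x ≟A y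
    ... | yes e = here e
    ... | no _ = there (cnt-∈ x ys p)

    cnt-∉ : ∀ x ys → x ∉ ys → cnt x ys ≡ 0
    cnt-∉ x ys x∉ with cnt x ys in eq
    ... | zero = refl
    ... | suc _ = contradiction (cnt-∈ x ys (subst (0 <_) (sym eq) z<s)) x∉

    cnt-unique : ∀ x {ys} → Unique ys → x ∈ ys → cnt x ys ≡ 1
    cnt-unique x {y ∷ ys} (y∉ ∷ u) x∈ with x ≟A y | x∈
    ... | yes refl | _ = cong suc (cnt-∉ x ys (λ x∈' → All.lookup y∉ x∈' refl))
    ... | no ne | here e = contradiction e ne
    ... | no ne | there x∈' = cnt-unique x u x∈'

    -- Reduces "equal up to permutation of the columns" to counting how often each column occurs.
    cnt-≡⇒↭ : ∀ xs ys → (∀ x → cnt x xs ≡ cnt x ys) → xs ↭ ys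
    cnt-≡⇒↭ [] [] e = ↭-refl
    cnt-≡⇒↭ [] (y ∷ ys) e = contradiction (trans (e y) (cong (_+ cnt y ys) (ind-yes (y ≟A y) refl))) λ ()
    cnt-≡⇒↭ (x ∷ xs) ys e with ∈-∃++ (cnt-∈ x ys (subst (0 <_) (e x)
        (subst (λ z → 0 < z + cnt x xs) (sym (ind-yes (x ≟A x) refl)) z<s)))
    ... | as , bs , refl = ↭-trans (prep x (cnt-≡⇒↭ xs (as ++ bs) eq)) (↭-sym (shift x as bs))
      where
      eq : ∀ y → cnt y xs ≡ cnt y (as ++ bs)
      eq y = +-cancelˡ-≡ ⟦ y ≟A x ⟧ _ _ (begin
        ⟦ y ≟A x ⟧ + cnt y xs ≡⟨ e y ⟩
        cnt y (as ++ x ∷ bs) ≡⟨ cnt-++ y as (x ∷ bs) ⟩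
        cnt y as + (⟦ y ≟A x ⟧ + cnt y bs) ≡⟨ +-assoc (cnt y as) _ _ ⟨
        cnt y as + ⟦ y ≟A x ⟧ + cnt y bs ≡⟨ cong (_+ cnt y bs) (+-comm (cnt y as) _) ⟩
        ⟦ y ≟A x ⟧ + cnt y as + cnt y bs ≡⟨ +-assoc ⟦ y ≟A x ⟧ _ _ ⟩
        ⟦ y ≟A x ⟧ + (cnt y as + cnt y bs) ≡⟨ cong (⟦ y ≟A x ⟧ +_) (cnt-++ y as bs) ⟨
        ⟦ y ≟A x ⟧ + cnt y (as ++ bs) ∎) where open ≡-Reasoning

    unique-↭ : ∀ {xs ys} → Unique xs → Unique ys → (∀ x → x ∈ xs → x ∈ ys) → (∀ x → x ∈ ys → x ∈ xs) → xs ↭ ys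
    unique-↭ {xs} {ys} ux uy f g = cnt-≡⇒↭ xs ys λ x → go x (x ∈? xs)
      where
      open import Data.List.Membership.DecPropositional _≟A_ using (_∈?_)
      go : ∀ x → Dec (x ∈ xs) → cnt x xs ≡ cnt x ys
      go x (yes x∈) = trans (cnt-unique x ux x∈) (sym (cnt-unique x uy (f x x∈)))
      go x (no x∉) = trans (cnt-∉ x xs x∉) (sym (cnt-∉ x ys (x∉ ∘ g x)))

    unique-length : ∀ {xs ys} → Unique xs → Unique ys → (∀ x → x ∈ xs → x ∈ ys) → (∀ x → x ∈ ys → x ∈ xs) →
        length xs ≡ length ys
    unique-length ux uy f g = ↭-length (unique-↭ ux uy f g)

  module _ {A : Set} where
    map-toList-tabulate : ∀ {B : Set} {n} (f : B → A) (τ : Fin n → B) →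
        map f (toList (tabulate τ)) ≡ toList (tabulate (f ∘ τ))
    map-toList-tabulate {n = zero} f τ = refl
    map-toList-tabulate {n = suc n} f τ = cong (f (τ zero) ∷_) (map-toList-tabulate f (τ ∘ suc))

    toList-tabulate-cong : ∀ {n} {f g : Fin n → A} → (∀ i → f i ≡ g i) →
        toList (tabulate f) ≡ toList (tabulate g)
    toList-tabulate-cong {zero} e = refl
    toList-tabulate-cong {suc n} e = cong₂ _∷_ (e zero) (toList-tabulate-cong (e ∘ suc))

    private
      _≟₃_ = Data.Fin.Properties._≟_ {3}
        where import Data.Fin.Properties
      open Count _≟₃_

    -- Serves matrices with at most three kinds of columns, `τ` naming the kind. Two multiplicities
    -- have to be supplied; the first one is what remains of `n`.
    tabulate-↭ : ∀ {n a b c} (τ : Fin n → Fin 3) (val : Fin 3 → A) (f : Fin n → A) → (∀ i → f i ≡ val (τ i))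
      → n ≡ a + (b + c) → sum (λ i → ⟦ suc zero ≟₃ τ i ⟧) ≡ b → sum (λ i → ⟦ suc (suc zero) ≟₃ τ i ⟧) ≡ c
      → toList (tabulate f) ↭ replicate a (val zero) ++ replicate b (val (suc zero)) ++ replicate c
          (val (suc (suc zero)))
    tabulate-↭ {n} {a} {b} {c} τ val f fτ tot eb ec =
      subst₂ _↭_ (trans (map-toList-tabulate val τ) (toList-tabulate-cong (λ i → sym (fτ i))))
        (trans (map-++ val (replicate a zero) _) (cong₂ _++_ (map-replicate val a zero)
          (trans (map-++ val (replicate b (suc zero)) _) (cong₂ _++_ (map-replicate val b (suc zero))
            (map-replicate val c (suc (suc zero)))))))
        (map⁺ val (cnt-≡⇒↭ (toList (tabulate τ)) R eq))
      where
      R = replicate a zero ++ replicate b (suc zero) ++ replicate c (suc (suc zero))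
      I : Fin 3 → Fin n → ℕ
      I t i = ⟦ t ≟₃ τ i ⟧
      S : Fin 3 → ℕ
      S t = sum (I t)
      rhs : ∀ t → cnt t R ≡ a * ⟦ t ≟₃ zero ⟧ + (b * ⟦ t ≟₃ suc zero ⟧ + c * ⟦ t ≟₃ suc (suc zero) ⟧)
      rhs t = trans (cnt-++ t (replicate a zero) _) (cong₂ _+_ (cnt-replicate t a zero)
        (trans (cnt-++ t (replicate b (suc zero)) _) (cong₂ _+_ (cnt-replicate t b (suc zero))
          (cnt-replicate t c (suc (suc zero))))))
      one : ∀ u → ⟦ zero ≟₃ u ⟧ + ⟦ suc zero ≟₃ u ⟧ + ⟦ suc (suc zero) ≟₃ u ⟧ ≡ 1
      one zero = refl
      one (suc zero) = refl
      one (suc (suc zero)) = refl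
      tot' : S zero + S (suc zero) + S (suc (suc zero)) ≡ n
      tot' = trans (cong (_+ S (suc (suc zero))) (sym (∑-distrib-+ (I zero) (I (suc zero)))))
          (trans (sym (∑-distrib-+ (λ i → I zero i + I (suc zero) i) (I (suc (suc zero)))))
         (trans (sum-cong-≗ (one ∘ τ)) (trans (sum-const n 1) (*-identityʳ n))))
      ea : S zero ≡ a
      ea = +-cancelʳ-≡ (b + c) _ _ (trans (cong (S zero +_) (sym (cong₂ _+_ eb ec)))
          (trans (sym (+-assoc (S zero) _ _)) (trans tot' tot)))
      z : ∀ x → x * 0 ≡ 0
      z = *-zeroʳ
      lhs : ∀ t → cnt t (toList (tabulate τ)) ≡ S t
      lhs t = cnt-tabulate t τ
      eq : ∀ t → cnt t (toList (tabulate τ)) ≡ cnt t R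
      eq zero = trans (lhs zero)
          (trans ea (sym (trans (rhs zero) (trans (cong₂ _+_ (*-identityʳ a) (cong₂ _+_ (z b) (z c)))
          (+-identityʳ a)))))
      eq (suc zero) =
          trans (lhs (suc zero))
          (trans eb (sym (trans (rhs (suc zero)) (cong₂ _+_ (z a)
          (trans (cong₂ _+_ (*-identityʳ b) (z c)) (+-identityʳ b))))))
      eq (suc (suc zero)) =
          trans (lhs (suc (suc zero)))
          (trans ec (sym (trans (rhs (suc (suc zero))) (cong₂ _+_ (z a) (cong₂ _+_ (z b) (*-identityʳ c))))))

  cst-≡ : ∀ a N b c → .{{NonZero N}} → .{{NonZero c}} → a * c ≡ b * N → cst a N ≡ cst b c
  cst-≡ a (suc N) b (suc c) e = fromℚᵘ-cong {mkℚᵘ (ℤ.+ a) N} {mkℚᵘ (ℤ.+ b) c}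
    (*≡* (trans (sym (ℤP.pos-* a (suc c))) (trans (cong ℤ.+_ e) (ℤP.pos-* b (suc N)))))

-- The groups in which h has order 4 or 6.

module CyclicCases where

  open FiniteSums
  open ResidueGroups
  open Multiplicities
  open import Defs using (cst; M-4a; M-6; M-8; col1; col2)
  open import Data.Nat hiding (_/_)
  open import Data.Nat.Properties
  open import Data.Nat.DivMod using (m%n<n; m<n⇒m%n≡m; m≡m%n+[m/n]*n; _/_)
  open import Data.Nat.Tactic.RingSolver using (solve-∀)
  open import Data.Rational using (ℚ; 0ℚ)
  open import Data.Fin.Base using (Fin; zero; suc; toℕ; fromℕ<)
  open import Data.Fin.Properties using (any?; toℕ<n; toℕ-fromℕ<) renaming (_≟_ to _≟F_)
  open import Data.Vec as Vec using (Vec; []; _∷_; lookup; tabulate; toList)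
  open import Data.Vec.Properties using (tabulate-cong; tabulate∘lookup; lookup∘tabulate; ≡-dec)
  open import Data.List as List using (List; []; _∷_; length; map; applyUpTo; _++_; replicate)
  open import Data.List.Properties using (length-map; length-applyUpTo; ++-identityʳ)
  open import Data.List.Membership.Propositional using (_∈_; find)
  open import Data.List.Membership.Propositional.Properties using (∈-map⁻)
  open import Data.List.Relation.Unary.Any as Any using (Any)
  import Data.List.Relation.Unary.Any.Properties as Any
  open import Data.List.Relation.Unary.All as All using (All; []; _∷_)
  import Data.List.Relation.Unary.All.Properties as All
  open import Data.List.Relation.Unary.AllPairs as AllPairs using (AllPairs)
  import Data.List.Relation.Unary.AllPairs.Properties as AllPairs
  open import Data.List.Relation.Binary.Permutation.Propositional using (_↭_)
  open import Data.Product using (∃; _×_; _,_)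
  open import Data.Sum using (_⊎_; inj₁; inj₂; [_,_]′)
  open import Relation.Nullary using (¬_; Dec; yes; no; contradiction; ¬?)
  open import Relation.Binary.PropositionalEquality
  open import Function using (_∘_)

  dot : ∀ {r} → Vec ℕ r → Vec ℕ r → ℕ
  dot [] [] = 0
  dot (a ∷ u) (b ∷ c) = a * b + dot u c

  class₃ : ∀ {P Q : Set} → Dec P → Dec Q → Fin 3
  class₃ (yes _) _ = suc (suc zero)
  class₃ (no _) (yes _) = suc zero
  class₃ (no _) (no _) = zero

  class₃-1 : ∀ {P Q : Set} (d : Dec P) (d' : Dec Q) → (P → ¬ Q) → ⟦ suc zero ≟F class₃ d d' ⟧ ≡ ⟦ d' ⟧
  class₃-1 (yes p) (yes q) c = contradiction q (c p)
  class₃-1 (yes p) (no _) c = refl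
  class₃-1 (no _) (yes _) c = refl
  class₃-1 (no _) (no _) c = refl

  class₃-2 : ∀ {P Q : Set} (d : Dec P) (d' : Dec Q) → ⟦ suc (suc zero) ≟F class₃ d d' ⟧ ≡ ⟦ d ⟧
  class₃-2 (yes p) _ = refl
  class₃-2 (no _) (yes _) = refl
  class₃-2 (no _) (no _) = refl

  module Generation (S : Setting) where
    open Setting S

    -- The form of `GeneratedByMatrix` after clearing denominators: `C i` is `N` times the i-th
    -- column, and the division by `N` happens only in the comparison with `M`.
    record GenBy {r} (M : List (Vec ℚ r)) : Set where
      field
        C : Fin n → Vec ℕ r
        C<N : ∀ i s → lookup (C i) s < N
        rows∈ : ∀ s → InE (λ i → lookup (C i) s)
        generate : ∀ f → InE f → ∃ λ c → f ≋ λ i → dot c (C i)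
        columns↭ : toList (tabulate (λ i → Vec.map (λ y → cst y N) (C i))) ↭ M

    res-cong : ∀ {f f'} → f ≋ f' → res f ≡ res f'
    res-cong e = tabulate-cong (un ∘ e)

    res-inj : ∀ {f f'} → res f ≡ res f' → f ≋ f'
    res-inj {f} {f'} e i =
        mk (trans (sym (lookup∘tabulate (λ i → f i % N) i)) (trans (cong (λ x → lookup x i) e)
        (lookup∘tabulate (λ i → f' i % N) i)))

    res-lookup : ∀ {x} → x ∈ E → res (lookup x) ≡ x
    res-lookup {x} x∈ = trans (tabulate-cong (λ i → m<n⇒m%n≡m (bounded x∈ i))) (tabulate∘lookup x)

    ∈⇒InE : ∀ {x} → x ∈ E → InE (lookup x)
    ∈⇒InE x∈ = subst (_∈ E) (sym (res-lookup x∈)) x∈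

    card : (F : List Fun) → AllPairs (λ f f' → ¬ f ≋ f') F → All InE F → (∀ f → InE f → Any (f ≋_) F) →
        m ≡ length F
    card F F! F∈ F⊇ = trans (sym size) (trans (unique-length unique
        (AllPairs.map⁺ (AllPairs.map (λ ne e → ne (res-inj e)) F!))
        (λ x x∈ → subst (_∈ map res F) (res-lookup x∈) (Any.map⁺ (Any.map res-cong (F⊇ (lookup x) (∈⇒InE x∈)))))
        λ x x∈ → let f , f∈ , e = ∈-map⁻ res x∈ in subst (_∈ E) (sym e) (All.lookup F∈ f∈)) (length-map res F))
      where open Count (≡-dec {n = n} _≟_)

  module Cases (S : Setting) where
    open Setting S
    open Core S
    open Generation S

    module Order (r : ℕ) {{_ : NonZero r}} (rh : r ⊡ h ≋ (λ _ → 0)) where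
      reduce : ∀ j → j ⊡ h ≋ (j % r) ⊡ h
      reduce j i = ≈-trans (≡⇒≈ (trans (cong (_* h i) (m≡m%n+[m/n]*n j r)) (lem (j % r) (j / r) r (h i))))
        (≈-trans (≈-+ ≈-refl (≈-trans (≈-*ˡ (j / r) (rh i)) (≡⇒≈ (*-zeroʳ (j / r))))) (≡⇒≈ (+-identityʳ _)))
        where
        lem : ∀ a q r h → (a + q * r) * h ≡ a * h + q * (r * h)
        lem = solve-∀

      -- `Out` speaks of all multiples of `h`; as `r h = 0`, testing the first `r` of them decides
      -- it.
      out? : ∀ {f} → InE f → Out f ⊎ ∃ λ j → j < r × f ≋ j ⊡ h
      out? {f} f∈ with any? {r} (λ j → f ≋? toℕ j ⊡ h)
      ... | yes (j , e) = inj₂ (toℕ j , toℕ<n j , e)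
      ... | no ne = inj₁ (out f∈ λ j e → ne (fromℕ< (m%n<n j r) ,
             ≋-trans e (≋-trans (reduce j) (λ i → ≡⇒≈ (cong (_* h i) (sym (toℕ-fromℕ< (m%n<n j r))))))))

      exhaust : ∃ Out ⊎ (∀ f → InE f → ∃ λ j → j < r × f ≋ j ⊡ h)
      exhaust with All.all? (λ x → any? {r} (λ j → lookup x ≋? toℕ j ⊡ h)) E
      ... | yes a = inj₂ λ f f∈ → let j , e = All.lookup a f∈ in toℕ j , toℕ<n j ,
              λ i → ≈-trans (≈-sym (≈-trans (≡⇒≈ (lookup∘tabulate (λ i → f i % N) i)) (≈-% (f i)))) (e i)
      ... | no na with find (All.¬All⇒Any¬ (λ x → any? {r} (λ j → lookup x ≋? toℕ j ⊡ h)) E na)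
      ...   | x , x∈ , ne with out? (∈⇒InE x∈)
      ...     | inj₁ o = inj₁ (lookup x , o)
      ...     | inj₂ (j , lt , e) =
          contradiction (fromℕ< lt , ≋-trans e (λ i → ≡⇒≈ (cong (_* h i) (sym (toℕ-fromℕ< lt))))) ne

      module _ (ord : ∀ j → 0 < j → j < r → ¬ j ⊡ h ≋ (λ _ → 0)) where
        distinct : ∀ {i j} → i < j → j < r → ¬ i ⊡ h ≋ j ⊡ h
        distinct {i} {j} i<j j<r e = ord (j ∸ i) (m<n⇒0<n∸m i<j) (≤-<-trans (m∸n≤m j i) j<r)
          λ l → ≈-cancelʳ (i * h l)
              (≈-trans (≡⇒≈ (trans (sym (*-distribʳ-+ (h l) (j ∸ i) i)) (cong (_* h l) (m∸n+n≡m (<⇒≤ i<j)))))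
              (≈-sym (e l)))

        multiples : List Fun
        multiples = applyUpTo (_⊡ h) r

        multiples! : AllPairs (λ f f' → ¬ f ≋ f') multiples
        multiples! = AllPairs.applyUpTo⁺₁ (_⊡ h) r distinct

        cyclic-size : (∀ f → InE f → ∃ λ j → j < r × f ≋ j ⊡ h) → m ≡ r
        cyclic-size c = trans (card multiples multiples! (All.applyUpTo⁺₂ (_⊡ h) r (λ j → mul j h∈))
          (λ f f∈ → let j , j< , e = c f f∈ in Any.applyUpTo⁺ (_⊡ h) e j<)) (length-applyUpTo (_⊡ h) r)

    -- Some `f + t h` vanishes at `i`, and multiplication by `c` turns the correction `t h_i` into
    -- `t N`.
    out-kill : ∀ {f} → Out f → ∀ c i → c * h i ≡ N → c * f i ≈ 0
    out-kill {f} o c i e = let t , z = out-zero o i in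
      ≈-trans (≈-trans (≡⇒≈ (sym (+-identityʳ _))) (≈-sym (≈-+ (≈-refl {c * f i}) (≈-+N 0 t))))
        (≈-trans (≡⇒≈ (trans (cong (λ w → c * f i + t * w) (sym e)) (lem c (f i) t (h i))))
          (≈-trans (≈-*ˡ c z) (≡⇒≈ (*-zeroʳ c))))
      where
      lem : ∀ c f t h → c * f + t * (c * h) ≡ c * (f + t * h)
      lem = solve-∀

    cyclic-generate : (∀ f → InE f → ∃ λ j → f ≋ j ⊡ h) → ∀ f → InE f → ∃ λ c → f ≋ λ i → dot c (h i ∷ [])
    cyclic-generate c f f∈ = let j , e = c f f∈ in j ∷ [] , λ i → ≈-trans (e i) (≡⇒≈ (sym (+-identityʳ _)))

    cyclic-GenBy : (∀ f → InE f → ∃ λ j → f ≋ j ⊡ h) → ∀ {M} →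
        toList (tabulate (λ i → col1 (cst (h i) N))) ↭ M → GenBy M
    cyclic-GenBy c p = record { C = λ i → h i ∷ [] ; C<N = λ { i zero → h<N i } ; rows∈ = λ { zero → h∈ }
      ; generate = cyclic-generate c ; columns↭ = p }

    multiple≈0 : ∀ {a} c → c * a ≡ N → ∀ t → t * c * a ≈ 0
    multiple≈0 {a} c e t = ≈-trans (≡⇒≈ (trans (*-assoc t c a) (cong (t *_) e))) (≈-+N 0 t)

    module _ (h≉g : ¬ h ≋ g) where
      open NonSelf h≉g
      module _ (3h≉0 : ¬ 3 ⊡ h ≋ (λ _ → 0)) where
        open NotThree 3h≉0

        -- The multiple is congruent to `h_i`, and `h` vanishes nowhere. With `c = 2` this keeps all
        -- odd multiples of `h` from vanishing at the entries 1/2.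
        odd≉ : ∀ i c t → c * h i ≡ N → ¬ (t * c + 1) * h i ≈ 0
        odd≉ i c t e z =
            h≉0 i (≈-trans (≈-sym (≈-trans (≈-+ (multiple≈0 c e t) ≈-refl) (≡⇒≈ (+-identityʳ (h i)))))
           (≈-trans (≡⇒≈ (lem t c (h i))) z))
          where
          lem : ∀ t c h → t * c * h + (h + 0) ≡ (t * c + 1) * h
          lem = solve-∀

        -- Counterpart of `nonzero-off`: if the `k` zeros of `f` lie in a set of `k` coordinates,
        -- they fill it.
        zero-on : ∀ {f} → Other f → ∀ {p} {P : Fin n → Set p} (P? : ∀ i → Dec (P i)) → sum (λ i → ⟦ P? i ⟧) ≡ k
          → (∀ i → f i ≈ 0 → P i) → ∀ i → P i → f i ≈ 0
        zero-on {f} o P? eq z i p = ind-1 (f i ≈? 0) (trans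
           (sum-≤-≡ (λ i → ind-mono (f i ≈? 0) (P? i) (z i)) (trans (zeros o) (sym eq)) i) (ind-yes (P? i) p))

        B? : ∀ i → Dec (2 * h i ≡ N)
        B? i = 2 * h i ≟ N

        -- Only `k` of the `3k` entries of `h` are 1/2, and `k` is positive.
        iA : ∃ λ i → ¬ 2 * h i ≡ N
        iA with any? (λ i → ¬? (B? i))
        ... | yes r = r
        ... | no ne = contradiction 0<k (subst (λ z → ¬ 0 < z) (sym k≡0) λ ())
          where
          allB : ∀ i → ⟦ B? i ⟧ ≡ 1
          allB i with B? i
          ... | yes _ = refl
          ... | no nb = contradiction (i , nb) ne
          3k≡k : 3 * k ≡ k
          3k≡k = trans (sym n≡3k) (trans (sym (*-identityʳ n)) (trans (sym (sum-const n 1))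
              (trans (sum-cong-≗ (λ i → sym (allB i))) B≡)))
          k≡0 : k ≡ 0
          k≡0 = m+n≡0⇒m≡0 k (+-cancelˡ-≡ k (k + (k + 0)) 0 (trans 3k≡k (sym (+-identityʳ k))))

        shifted-zero : ∀ {f} c t i → (f ⊞ t ⊡ h) i ≈ 0 → (c ⊡ f ⊞ (t * c) ⊡ h) i ≈ 0
        shifted-zero {f} c t i z = ≈-trans (≡⇒≈ (lem c (f i) t (h i))) (≈-trans (≈-*ˡ c z) (≡⇒≈ (*-zeroʳ c)))
          where
          lem : ∀ c f t h → c * f + t * c * h ≡ c * (f + t * h)
          lem = solve-∀

        -- c f vanishes where c h does; when these are k coordinates it vanishes nowhere else,
        -- yet shifting f by a multiple of h makes it vanish at any prescribed coordinate.
        no-out : ∀ {f} → Out f → ∀ c → sum (λ i → ⟦ c * h i ≟ N ⟧) ≡ k → (∃ λ i → ¬ c * h i ≡ N) → ¬ Out (c ⊡ f)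
        no-out {f} o c eq (i , ne) o' = let t , z = out-zero o i in
          ne (nonzero-off (Out⇒Other (Out-shift (t * c) o')) (λ i → c * h i ≟ N) eq
            (λ i e → ≈-+ (out-kill o c i e) (multiple≈0 c e t)) i (shifted-zero {f} c t i z))

        module Four (4h≋0 : 4 ⊡ h ≋ (λ _ → 0)) where
          open Order 4 4h≋0

          -- The bound `3 h_i ≤ N` rules out the entry 3/4.
          4h≡N : ∀ i → ¬ 2 * h i ≡ N → 4 * h i ≡ N
          4h≡N i ne = ∣-small (4h≋0 i) (≤-trans (0<h i) (m≤m+n _ _))
            (subst (4 * h i <_) (cong (N +_) (sym (+-identityʳ N))) (+-mono-<-≤ (h<N i) (3h≤N i ne)))

          ord : ∀ j → 0 < j → j < 4 → ¬ j ⊡ h ≋ (λ _ → 0)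
          ord 1 _ _ = 1h≉0
          ord 2 _ _ = 2h≉0
          ord 3 _ _ = 3h≉0
          ord (suc (suc (suc (suc _)))) _ (s≤s (s≤s (s≤s (s≤s ()))))

          class₂ : ∀ {p} {P : Set p} → Dec P → Fin 3
          class₂ (yes _) = suc zero
          class₂ (no _) = zero

          M-4a↭ : toList (tabulate (λ i → col1 (cst (h i) N))) ↭ M-4a k
          M-4a↭ = subst (toList (tabulate (λ i → col1 (cst (h i) N))) ↭_)
              (cong (replicate (2 * k) (col1 (cst 1 4)) ++_) (++-identityʳ _))
            -- The third kind of column does not occur in `M-4a`, so its multiplicity is 0 and its
            -- value is arbitrary.
            (tabulate-↭ {a = 2 * k} {b = k} {c = 0} (class₂ ∘ B?) val (λ i → col1 (cst (h i) N))
              (λ i → go i (B? i)) (trans n≡3k (lem k))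
              (trans (sum-cong-≗ (λ i → ind₁ (B? i))) B≡) (trans (sum-cong-≗ (λ i → ind₂ (B? i)))
                (trans (sum-const n 0) (*-zeroʳ n))))
            where
            lem : ∀ k → 3 * k ≡ 2 * k + (k + 0)
            lem = solve-∀
            val : Fin 3 → Vec ℚ 1
            val zero = col1 (cst 1 4)
            val (suc zero) = col1 (cst 1 2)
            val (suc (suc zero)) = col1 (cst 1 2)
            go : ∀ i (d : Dec (2 * h i ≡ N)) → col1 (cst (h i) N) ≡ val (class₂ d)
            go i (yes e) =
                cong col1 (cst-≡ (h i) N 1 2 (trans (*-comm (h i) 2) (trans e (sym (*-identityˡ N)))))
            go i (no ne) =
                cong col1 (cst-≡ (h i) N 1 4 (trans (*-comm (h i) 4) (trans (4h≡N i ne) (sym (*-identityˡ N)))))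
            ind₁ : ∀ {p} {P : Set p} (d : Dec P) → ⟦ suc zero ≟F class₂ d ⟧ ≡ ⟦ d ⟧
            ind₁ (yes _) = refl
            ind₁ (no _) = refl
            ind₂ : ∀ {p} {P : Set p} (d : Dec P) → ⟦ suc (suc zero) ≟F class₂ d ⟧ ≡ 0
            ind₂ (yes _) = refl
            ind₂ (no _) = refl

          -- An element `y` of order 2 in the coset of `f` modulo the subgroup generated by `h`.
          record Half (f : Fun) : Set where
            field
              y : Fun
              y-out : Out y
              2y≋0 : 2 ⊡ y ≋ (λ _ → 0)
              rel : ∃ λ t → f ≋ y ⊞ t ⊡ h

          -- By `no-out`, `2f` is some multiple `j h`. Where `h` is 1/2, `2f` vanishes but odd
          -- multiples of `h` do not, so `j` is even. For `j = 2` the translate `f + h` works, since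
          -- its double is `4h = 0`, and three further copies of `h` lead back to `f`.
          half : ∀ {f} → Out f → Half f
          half {f} o with out? (mul 2 (∈E′ o))
          ... | inj₁ o' = contradiction o' (no-out o 2 B≡ iA)
          ... | inj₂ (0 , _ , e) = record { y = f ; y-out = o ; 2y≋0 = e ; rel =
              0 , λ i → ≡⇒≈ (sym (+-identityʳ (f i))) }
          ... | inj₂ (1 , _ , e) = let i , b = iB in contradiction (≈-trans (≈-sym (e i)) (out-kill o 2 i b)) (odd≉ i 2 0 b)
          ... | inj₂ (3 , _ , e) = let i , b = iB in contradiction (≈-trans (≈-sym (e i)) (out-kill o 2 i b)) (odd≉ i 2 1 b)
          ... | inj₂ (suc (suc (suc (suc _))) , s≤s (s≤s (s≤s (s≤s ()))) , _)
          ... | inj₂ (2 , _ , e) = record { y = f ⊞ 1 ⊡ h ; y-out = Out-shift 1 o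
                ; 2y≋0 = λ i → ≈-trans (≡⇒≈ (lem₁ (f i) (h i))) (≈-trans (≈-+ (e i) (≈-refl {2 * h i}))
                  (≈-trans (≡⇒≈ (lem₂ (h i))) (4h≋0 i)))
                ; rel = 3 , λ i → ≈-trans (≈-sym (≈-trans (≈-+ (≈-refl {f i}) (4h≋0 i)) (≡⇒≈ (+-identityʳ _))))
                  (≡⇒≈ (lem₃ (f i) (h i))) }
            where
            lem₁ : ∀ f h → 2 * (f + 1 * h) ≡ 2 * f + 2 * h
            lem₁ = solve-∀
            lem₂ : ∀ h → 2 * h + 2 * h ≡ 4 * h
            lem₂ = solve-∀
            lem₃ : ∀ f h → f + 4 * h ≡ f + 1 * h + 3 * h
            lem₃ = solve-∀

          -- At a zero of `y + h` one has `2h = 2(y + h) = 0`, so all zeros of `y + h` lie among the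
          -- `k` coordinates where `h` is 1/2. There are `k` of them, so `y = -h = h` at all of
          -- these coordinates.
          on-B : ∀ {y} → Out y → 2 ⊡ y ≋ (λ _ → 0) → ∀ i → 2 * h i ≡ N → y i ≈ h i
          on-B {y} o 2y i b =
              ≈-cancelʳ (h i) (≈-trans (≈-trans (≈-+ (≈-refl {y i}) (h≋ i))
              (zero-on (Out⇒Other (Out-shift 1 o)) B? B≡ sub i b))
              (≈-sym (≈-trans (≡⇒≈ (trans (cong (h i +_) (sym (+-identityʳ (h i)))) b)) N≈0)))
            where
            lem : ∀ y h → 2 * (y + 1 * h) ≡ 2 * y + 2 * h
            lem = solve-∀
            sub : ∀ i → (y ⊞ 1 ⊡ h) i ≈ 0 → 2 * h i ≡ N
            sub i e = ∣-small (≈-cancelˡ (2 * y i) (≈-trans (≡⇒≈ (sym (lem (y i) (h i))))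
                (≈-trans (≈-*ˡ 2 e) (≈-sym (≈-trans (≡⇒≈ (+-identityʳ _)) (2y i))))))
              (≤-trans (0<h i) (m≤m+n _ _)) (*-monoʳ-< 2 (h<N i))

          module Eight {y : Fun} (y-out : Out y) (2y≋0 : 2 ⊡ y ≋ (λ _ → 0)) where

            -- If `y + y'` were not a multiple of `h`, then by `on-B` it would equal `h` wherever
            -- `h` is 1/2; but there both summands equal `h` and cancel. So the quotient by the
            -- multiples of `h` has order 2, and the group has order 8.
            related : ∀ {y'} → Out y' → 2 ⊡ y' ≋ (λ _ → 0) → ∃ λ j → y' ≋ y ⊞ j ⊡ h
            related {y'} o 2y' with out? (add (∈E′ y-out) (∈E′ o))
            ... | inj₂ (j , _ , e) = j , λ i → ≈-trans (≈-sym (≈-+ (2y≋0 i) (≈-refl {y' i})))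
                    (≈-trans (≡⇒≈ (lem (y i) (y' i))) (≈-+ (≈-refl {y i}) (e i)))
              where
              lem : ∀ y y' → 2 * y + y' ≡ y + (y + y')
              lem = solve-∀
            ... | inj₁ o' = let i , b = iB in contradiction
                    (≈-trans (≈-sym (on-B o' (λ i → ≈-trans (≡⇒≈ (*-distribˡ-+ 2 (y i) (y' i)))
                      (≈-+ (2y≋0 i) (2y' i))) i b))
                      (≈-trans (≈-+ (on-B y-out 2y≋0 i b) (on-B o 2y' i b))
                        (≈-trans (≡⇒≈ (trans (cong (h i +_) (sym (+-identityʳ (h i)))) b)) N≈0)))
                    (h≉0 i)

            every : ∀ f → InE f → (∃ λ j → j < 4 × f ≋ j ⊡ h) ⊎ (∃ λ j → j < 4 × f ≋ y ⊞ j ⊡ h)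
            every f f∈ with out? f∈
            ... | inj₂ r = inj₁ r
            ... | inj₁ o = let t , e = Half.rel (half o)
                               j , e' = related (Half.y-out (half o)) (Half.2y≋0 (half o))
               in inj₂ ((j + t) % 4 , m%n<n (j + t) 4 , λ i → ≈-trans (e i) (≈-trans (≈-+ (e' i) ≈-refl)
                    (≈-trans (≡⇒≈ (lem (y i) j t (h i))) (≈-+ (≈-refl {y i}) (reduce (j + t) i)))))
              where
              lem : ∀ y j t h → y + j * h + t * h ≡ y + (j + t) * h
              lem = solve-∀

            size8 : m ≡ 8
            size8 = card (applyUpTo (_⊡ h) 4 ++ applyUpTo (λ j → y ⊞ j ⊡ h) 4)
              (AllPairs.++⁺ (multiples! ord) (AllPairs.applyUpTo⁺₁ (λ j → y ⊞ j ⊡ h) 4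
                  (λ i<j j< e → distinct ord i<j j< (λ l → ≈-cancelˡ (y l) (e l))))
                (All.applyUpTo⁺₂ _ 4 (λ j → All.applyUpTo⁺₂ _ 4 (λ j' e →
                  ≢m (Out-shift j' y-out) j (≋-sym e)))))
              (All.++⁺ (All.applyUpTo⁺₂ _ 4 (λ j → mul j h∈)) (All.applyUpTo⁺₂ _ 4
                (λ j → add (∈E′ y-out) (mul j h∈))))
              (λ f f∈ → [ (λ { (j , j< , e) → Any.++⁺ˡ (Any.applyUpTo⁺ (_⊡ h) e j<) })
                        , (λ { (j , j< , e) → Any.++⁺ʳ (applyUpTo (_⊡ h) 4)
                            (Any.applyUpTo⁺ (λ j → y ⊞ j ⊡ h) e j<) }) ]′ (every f f∈))

            C : Fin n → Vec ℕ 2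
            C i = (y i % N) ∷ h i ∷ []

            M-8↭ : toList (tabulate (λ i → Vec.map (λ y → cst y N) (C i))) ↭ M-8 k
            M-8↭ = tabulate-↭ {a = k} {b = k} {c = k} (λ i → class₃ (B? i) (y i ≈? 0)) val _
                (λ i → go i (B? i) (y i ≈? 0)) (trans n≡3k (lem k))
                (trans (sum-cong-≗ (λ i → class₃-1 (B? i) (y i ≈? 0)
                  (λ b e → h≉0 i (≈-trans (≈-sym (on-B y-out 2y≋0 i b)) e)))) (zeros (Out⇒Other y-out)))
                (trans (sum-cong-≗ (λ i → class₃-2 (B? i) (y i ≈? 0))) B≡)
              where
              lem : ∀ k → 3 * k ≡ k + (k + k)
              lem = solve-∀
              val : Fin 3 → Vec ℚ 2
              val zero = col2 (cst 1 2) (cst 1 4)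
              val (suc zero) = col2 0ℚ (cst 1 4)
              val (suc (suc zero)) = col2 (cst 1 2) (cst 1 2)
              half-cst : ∀ a → 2 * a ≡ N → cst a N ≡ cst 1 2
              half-cst a e = cst-≡ a N 1 2 (trans (*-comm a 2) (trans e (sym (*-identityˡ N))))
              quarter-cst : ∀ a → 4 * a ≡ N → cst a N ≡ cst 1 4
              quarter-cst a e = cst-≡ a N 1 4 (trans (*-comm a 4) (trans e (sym (*-identityˡ N))))
              go : ∀ i (d : Dec (2 * h i ≡ N)) (d' : Dec (y i ≈ 0)) →
                  Vec.map (λ y → cst y N) (C i) ≡ val (class₃ d d')
              go i (yes b) _ =
                  cong₂ col2 (half-cst (y i % N)
                  (trans (cong (2 *_) (trans (un (on-B y-out 2y≋0 i b)) (m<n⇒m%n≡m (h<N i)))) b))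
                  (half-cst (h i) b)
              go i (no b) (yes e) =
                  cong₂ col2 (cst-≡ (y i % N) N 0 1 (trans (*-identityʳ _) (≈0⇒% e)))
                  (quarter-cst (h i) (4h≡N i b))
              go i (no b) (no e) =
                  cong₂ col2 (half-cst (y i % N) (∣-small (≈-trans (≈-*ˡ 2 (≈-% (y i))) (2y≋0 i))
                   (≤-trans (n≢0⇒n>0 (e ∘ %⇒≈0)) (m≤m+n _ _)) (*-monoʳ-< 2 (m%n<n (y i) N))))
                     (quarter-cst (h i) (4h≡N i b))

            genBy8 : GenBy (M-8 k)
            genBy8 = record { C = C ; C<N = λ { i zero → m%n<n (y i) N ; i (suc zero) → h<N i }
              ; rows∈ = λ { zero → InE-resp (λ i → ≈-sym (≈-% (y i))) (∈E′ y-out) ; (suc zero) → h∈ }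
              ; generate = λ f f∈ → [ (λ { (j , _ , e) → 0 ∷ j ∷ [] , λ i →
                ≈-trans (e i) (≡⇒≈ (sym (+-identityʳ _))) })
                  , (λ { (j , _ , e) → 1 ∷ j ∷ [] , λ i → ≈-trans (e i)
                      (≈-+ (≈-sym (≈-trans (≡⇒≈ (+-identityʳ _)) (≈-% (y i)))) (≡⇒≈ (sym (+-identityʳ _)))) })
                      ]′ (every f f∈)
              ; columns↭ = M-8↭ }

          result : (m ≡ 4 × GenBy (M-4a k)) ⊎ (m ≡ 8 × GenBy (M-8 k))
          result with exhaust
          ... | inj₁ (f , o) = inj₂ (Eight.size8 (Half.y-out (half o)) (Half.2y≋0 (half o)) , Eight.genBy8
              (Half.y-out (half o)) (Half.2y≋0 (half o)))
          ... | inj₂ c = inj₁ (cyclic-size ord c , cyclic-GenBy (λ f f∈ → let j , _ , e = c f f∈ in j , e) M-4a↭)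

        module Six (4h≉0 : ¬ 4 ⊡ h ≋ (λ _ → 0)) where

          B₃? : ∀ i → Dec (3 * h i ≡ N)
          B₃? i = 3 * h i ≟ N

          3h-other : Other (3 ⊡ h)
          3h-other = multiple-other 2 3h≉0 2h≉0 4h≉0

          B≢B₃ : ∀ i → 2 * h i ≡ N → ¬ 3 * h i ≡ N
          B≢B₃ i b b₃ = odd≉ i 2 1 b (≈-trans (≡⇒≈ b₃) N≈0)

          3h<2N : ∀ i → 3 * h i < 2 * N
          3h<2N i = subst (3 * h i <_) (cong (N +_) (sym (+-identityʳ N))) (+-mono-<-≤ (h<N i) (2h≤N (B? i)))
            where
            2h≤N : Dec (2 * h i ≡ N) → 2 * h i ≤ N
            2h≤N (yes b) = ≤-reflexive b
            2h≤N (no b) = ≤-trans (m≤n+m _ (h i)) (3h≤N i b)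

          -- The entries 1/3 of `h` are the zeros of `3h`, because `3 h_i < 2N` leaves `N` as the
          -- only multiple that can be attained.
          B₃≡ : sum (λ i → ⟦ B₃? i ⟧) ≡ k
          B₃≡ = trans (sum-cong-≗ (λ i → ind-cong (B₃? i) (3 * h i ≈? 0)
            (λ e → ≈-trans (≡⇒≈ e) N≈0)
            (λ e → ∣-small e (≤-trans (0<h i) (m≤m+n _ _)) (3h<2N i)))) (zeros 3h-other)

          module _ (i : Fin n) (b : ¬ 2 * h i ≡ N) (b₃ : ¬ 3 * h i ≡ N) where
            3h<N : 3 * h i < N
            3h<N = ≤∧≢⇒< (3h≤N i b) b₃

            -- The pattern of `3h≤N` goes on: as long as `j h` is `Other` and `j h_i < N`, the upper
            -- bound for `j h` gives `(j + 1) h_i ≤ N`.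
            4h≤N : 4 * h i ≤ N
            4h≤N = ≤-trans (≤-reflexive (trans (+-comm (h i) (3 * h i)) (cong (_+ h i) (sym (m<n⇒m%n≡m 3h<N)))))
              (other-high 3h-other i (λ e → b₃ (∣-small e (≤-trans (0<h i) (m≤m+n _ _)) (3h<2N i))))

          -- At an entry 1/2 the multiple `5h` agrees with `h`. This is what makes `4h` an `Other`
          -- element.
          5h≉0 : ¬ 5 ⊡ h ≋ (λ _ → 0)
          5h≉0 e = let i , b = iB in odd≉ i 2 2 b (e i)

          4h-other : Other (4 ⊡ h)
          4h-other = multiple-other 3 4h≉0 3h≉0 5h≉0

          module _ (i : Fin n) (b : ¬ 2 * h i ≡ N) (b₃ : ¬ 3 * h i ≡ N) where
            -- `4h` vanishes wherever `h` is 1/2, which already accounts for its `k` zeros.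
            4h≉0ᵢ : ¬ 4 * h i ≈ 0
            4h≉0ᵢ e = b (nonzero-off 4h-other B? B≡ (λ i b → multiple≈0 {h i} 2 b 2) i e)

            4h<N : 4 * h i < N
            4h<N = ≤∧≢⇒< (4h≤N i b b₃) (λ e → 4h≉0ᵢ (≈-trans (≡⇒≈ e) N≈0))

            5h≤N : 5 * h i ≤ N
            5h≤N = ≤-trans (≤-reflexive (trans (+-comm (h i) (4 * h i)) (cong (_+ h i) (sym (m<n⇒m%n≡m 4h<N)))))
                (other-high 4h-other i 4h≉0ᵢ)

          -- Otherwise h would consist of k entries each of 1/2, 1/3 and 1/5, whose sum exceeds k.
          6h≋0 : ¬ ¬ 6 ⊡ h ≋ (λ _ → 0)
          6h≋0 6h≉0 = contradiction total (<⇒≱ (*-monoʳ-< N (*-monoˡ-< k {{>-nonZero 0<k}} (≤-refl {31}))))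
            where
            5h-other : Other (5 ⊡ h)
            5h-other = multiple-other 4 5h≉0 4h≉0 6h≉0
            Z? : ∀ i → Dec (5 * h i ≈ 0)
            Z? i = 5 * h i ≈? 0
            -- The weights are 30/2, 30/3 and 30/5. The three conditions exclude each other, so at
            -- most one weight counts at each coordinate; the weights add up to 31, which is more
            -- than 30.
            pointwise : ∀ i (d : Dec (2 * h i ≡ N)) (d₃ : Dec (3 * h i ≡ N)) (z : Dec (5 * h i ≈ 0)) →
                N * (15 * ⟦ d ⟧ + 10 * ⟦ d₃ ⟧ + 6 * ⟦ z ⟧) ≤ 30 * h i
            pointwise i (yes b) (yes b₃) _ = contradiction b₃ (B≢B₃ i b)
            pointwise i (yes b) (no _) (yes z) = contradiction z (odd≉ i 2 2 b)
            pointwise i (yes b) (no _) (no _) =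
                ≤-reflexive (trans (*-comm N 15) (trans (cong (15 *_) (sym b)) (sym (*-assoc 15 2 (h i)))))
            pointwise i (no _) (yes b₃) (yes z) =
                contradiction (≈-trans (≡⇒≈ (lem (h i))) (≈-*ˡ 2 z)) (odd≉ i 3 3 b₃)
              where
              lem : ∀ h → (3 * 3 + 1) * h ≡ 2 * (5 * h)
              lem = solve-∀
            pointwise i (no _) (yes b₃) (no _) =
                ≤-reflexive (trans (*-comm N 10) (trans (cong (10 *_) (sym b₃)) (sym (*-assoc 10 3 (h i)))))
            pointwise i (no b) (no b₃) (yes z) =
                ≤-reflexive (trans (*-comm N 6)
                (trans (cong (6 *_) (sym (∣-small z (≤-trans (0<h i) (m≤m+n _ _)) lt)))
                (sym (*-assoc 6 5 (h i)))))
              where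
              lt : 5 * h i < 2 * N
              lt = ≤-<-trans (5h≤N i b b₃) (m<m+n N (≤-trans 0<N (m≤m+n N 0)))
            pointwise i (no _) (no _) (no _) = ≤-trans (≤-reflexive (*-zeroʳ N)) z≤n
            total : N * (31 * k) ≤ N * (30 * k)
            total = begin
              N * (31 * k) ≡⟨ cong (N *_) (lem₁ k) ⟩
              N * (15 * k + 10 * k + 6 * k) ≡⟨ cong (N *_) (cong₂ _+_
                  (cong₂ _+_ (cong (15 *_) B≡) (cong (10 *_) B₃≡)) (cong (6 *_) (zeros 5h-other))) ⟨
              N * (15 * sum (λ i → ⟦ B? i ⟧) + 10 * sum (λ i → ⟦ B₃? i ⟧) + 6 * sum (λ i → ⟦ Z? i ⟧))
                ≡⟨ cong (N *_)
                  (trans (cong₂ _+_ (trans (cong₂ _+_ (*-distribˡ-sum 15 (λ i → ⟦ B? i ⟧))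
                  (*-distribˡ-sum 10 (λ i → ⟦ B₃? i ⟧))) (sym (∑-distrib-+ (λ i → 15 * ⟦ B? i ⟧)
                  (λ i → 10 * ⟦ B₃? i ⟧)))) (*-distribˡ-sum 6 (λ i → ⟦ Z? i ⟧)))
                      (sym (∑-distrib-+ (λ i → 15 * ⟦ B? i ⟧ + 10 * ⟦ B₃? i ⟧) (λ i → 6 * ⟦ Z? i ⟧)))) ⟩
              N * sum (λ i → 15 * ⟦ B? i ⟧ + 10 * ⟦ B₃? i ⟧ + 6 * ⟦ Z? i ⟧) ≡⟨ *-distribˡ-sum N
                  (λ i → 15 * ⟦ B? i ⟧ + 10 * ⟦ B₃? i ⟧ + 6 * ⟦ Z? i ⟧) ⟩
              sum (λ i → N * (15 * ⟦ B? i ⟧ + 10 * ⟦ B₃? i ⟧ + 6 * ⟦ Z? i ⟧)) ≤⟨ sum-mono-≤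
                  (λ i → pointwise i (B? i) (B₃? i) (Z? i)) ⟩
              sum (λ i → 30 * h i) ≡⟨ *-distribˡ-sum 30 h ⟨
              30 * sum h ≡⟨ cong (30 *_) sum-h ⟩
              30 * (N * k) ≡⟨ lem₂ N k ⟩
              N * (30 * k) ∎
              where
              open ≤-Reasoning
              lem₁ : ∀ k → 31 * k ≡ 15 * k + 10 * k + 6 * k
              lem₁ = solve-∀
              lem₂ : ∀ N k → 30 * (N * k) ≡ N * (30 * k)
              lem₂ = solve-∀

          module _ (6h : 6 ⊡ h ≋ (λ _ → 0)) where
            open Order 6 6h

            6h≡N : ∀ i → ¬ 2 * h i ≡ N → ¬ 3 * h i ≡ N → 6 * h i ≡ N
            6h≡N i b b₃ = ∣-small (6h i) (≤-trans (0<h i) (m≤m+n _ _))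
              (subst (6 * h i <_) (cong (N +_) (sym (+-identityʳ N))) (+-mono-<-≤ (h<N i) (5h≤N i b b₃)))

            ord : ∀ j → 0 < j → j < 6 → ¬ j ⊡ h ≋ (λ _ → 0)
            ord 1 _ _ = 1h≉0
            ord 2 _ _ = 2h≉0
            ord 3 _ _ = 3h≉0
            ord 4 _ _ = 4h≉0
            ord 5 _ _ = 5h≉0
            ord (suc (suc (suc (suc (suc (suc _)))))) _ (s≤s (s≤s (s≤s (s≤s (s≤s (s≤s ()))))))

            -- By `no-out`, both `2f` and `3f` are multiples of `h`, hence so is their difference
            -- `f`.
            no-Out : ∀ {f} → ¬ Out f
            no-Out {f} o with out? (mul 2 (∈E′ o)) | out? (mul 3 (∈E′ o))
            ... | inj₁ o' | _ = no-out o 2 B≡ iA o'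
            ... | inj₂ _ | inj₁ o' = no-out o 3 B₃≡ (let i , b = iB in i , B≢B₃ i b) o'
            ... | inj₂ (j , _ , e) | inj₂ (j' , _ , e') = ≢m (Out-shift j o) j'
                  (λ i → ≈-trans (≈-+ (≈-refl {f i}) (≈-sym (e i))) (e' i))

            M-6↭ : toList (tabulate (λ i → col1 (cst (h i) N))) ↭ M-6 k
            M-6↭ = tabulate-↭ {a = k} {b = k} {c = k} (λ i → class₃ (B? i) (B₃? i)) val _
                (λ i → go i (B? i) (B₃? i)) (trans n≡3k (lem k))
                (trans (sum-cong-≗ (λ i → class₃-1 (B? i) (B₃? i) (B≢B₃ i))) B₃≡)
                (trans (sum-cong-≗ (λ i → class₃-2 (B? i) (B₃? i))) B≡)
              where
              lem : ∀ k → 3 * k ≡ k + (k + k)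
              lem = solve-∀
              val : Fin 3 → Vec ℚ 1
              val zero = col1 (cst 1 6)
              val (suc zero) = col1 (cst 1 3)
              val (suc (suc zero)) = col1 (cst 1 2)
              go : ∀ i (d : Dec (2 * h i ≡ N)) (d' : Dec (3 * h i ≡ N)) → col1 (cst (h i) N) ≡ val (class₃ d d')
              go i (yes b) _ =
                  cong col1 (cst-≡ (h i) N 1 2 (trans (*-comm (h i) 2) (trans b (sym (*-identityˡ N)))))
              go i (no b) (yes b₃) =
                  cong col1 (cst-≡ (h i) N 1 3 (trans (*-comm (h i) 3) (trans b₃ (sym (*-identityˡ N)))))
              go i (no b) (no b₃) =
                  cong col1 (cst-≡ (h i) N 1 6 (trans (*-comm (h i) 6)
                  (trans (6h≡N i b b₃) (sym (*-identityˡ N)))))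

            result' : m ≡ 6 × GenBy (M-6 k)
            result' with exhaust
            ... | inj₁ (f , o) = contradiction o no-Out
            ... | inj₂ c = cyclic-size ord c , cyclic-GenBy (λ f f∈ → let j , _ , e = c f f∈ in j , e) M-6↭

          result : m ≡ 6 × GenBy (M-6 k)
          result with 6 ⊡ h ≋? (λ _ → 0)
          ... | yes 6h = result' 6h
          ... | no 6h≉0 = contradiction 6h≉0 6h≋0

-- Linear codes over a prime field and the equidistribution of their columns.

module LinearCodes where

  open FiniteSums
  open ResidueGroups
  open Multiplicities
  open CyclicCases
  open import Defs using (cst; divCol)
  open import Data.Nat hiding (_/_)
  open import Data.Nat.Properties
  open import Data.Nat.DivMod using (m%n<n; m≡m%n+[m/n]*n; _/_)
  open import Data.Nat.Divisibility
  open import Data.Nat.Tactic.RingSolver using (solve-∀)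
  open import Data.Rational using (ℚ)
  open import Data.Fin.Base using (Fin; zero; suc; toℕ; fromℕ<)
  open import Data.Fin.Properties using (any?; toℕ<n; toℕ-fromℕ<; toℕ-injective) renaming (_≟_ to _≟F_)
  open import Data.Vec as Vec using (Vec; []; _∷_; _∷ʳ_; lookup; tabulate; toList; initLast; zipWith)
  open import Data.Vec.Properties using (lookup∘tabulate; ≡-dec; ∷-injective; lookup-map; map-∷ʳ; map-∘;
      map-cong; tabulate∘lookup; tabulate-cong)
  open import Data.List as List using (List; []; _∷_; length; map; _++_; allFin; cartesianProductWith)
  open import Data.List.Properties using (length-map)
  open import Data.List.Membership.Propositional using (_∈_; find; lose)
  open import Data.List.Membership.Propositional.Properties using
      (∈-cartesianProductWith⁺; ∈-allFin; ∈-∃++; ∈-++⁻; ∈-++⁺ˡ; ∈-++⁺ʳ)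
  open import Data.List.Relation.Unary.Any as Any using (Any; here; there)
  import Data.List.Relation.Unary.Any.Properties as Any
  open import Data.List.Relation.Unary.All as All using (All; []; _∷_)
  import Data.List.Relation.Unary.All.Properties as All
  open import Data.List.Relation.Unary.AllPairs as AllPairs using (AllPairs; []; _∷_)
  import Data.List.Relation.Unary.AllPairs.Properties as AllPairs
  open import Data.List.Relation.Unary.Unique.Propositional using (Unique)
  import Data.List.Relation.Unary.Unique.Propositional.Properties as Unique
  open import Data.List.Relation.Binary.Permutation.Propositional using (_↭_)
  open import Data.Product using (Σ; ∃; _×_; _,_; proj₁; proj₂)
  open import Data.Sum using (_⊎_; inj₁; inj₂)
  open import Data.Empty using (⊥)
  open import Relation.Nullary using (¬_; Dec; yes; no; contradiction; ¬?)
  open import Relation.Binary.Definitions using (DecidableEquality)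
  open import Relation.Binary.PropositionalEquality
  open import Function using (_∘_)

  length-⊆ : ∀ {A : Set} {xs ys : List A} → Unique xs → (∀ x → x ∈ xs → x ∈ ys) → length xs ≤ length ys
  length-⊆ {xs = []} _ _ = z≤n
  length-⊆ {xs = x ∷ xs} (x∉ ∷ u) sub with ∈-∃++ (sub x (here refl))
  ... | as , bs , refl = ≤-trans (s≤s (length-⊆ u sub')) (≤-reflexive eq)
    where
    open import Data.List.Properties using (length-++)
    eq : suc (length (as ++ bs)) ≡ length (as ++ x ∷ bs)
    eq = trans (cong suc (length-++ as)) (trans (sym (+-suc (length as) (length bs))) (sym (length-++ as)))
    sub' : ∀ y → y ∈ xs → y ∈ as ++ bs
    sub' y y∈ with ∈-++⁻ as (sub y (there y∈))
    ... | inj₁ l = ∈-++⁺ˡ l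
    ... | inj₂ (here refl) = contradiction refl (All.lookup x∉ y∈)
    ... | inj₂ (there r) = ∈-++⁺ʳ as r

  sum-δ : ∀ {n} (b : Fin n) → sum (λ a → ⟦ a ≟F b ⟧) ≡ 1
  sum-δ {suc n} zero = cong suc (trans (sum-const n 0) (*-zeroʳ n))
  sum-δ {suc n} (suc b) =
      trans (sum-cong-≗ {n} (λ a → ind-cong (suc a ≟F suc b) (a ≟F b) (λ { refl → refl }) (cong suc))) (sum-δ b)

  length-cartesianProductWith : ∀ {A B C : Set} (f : A → B → C) xs ys →
      length (cartesianProductWith f xs ys) ≡ length xs * length ys
  length-cartesianProductWith f [] ys = refl
  length-cartesianProductWith f (x ∷ xs) ys =
      trans (length-++ (map (f x) ys)) (cong₂ _+_ (length-map (f x) ys) (length-cartesianProductWith f xs ys))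
    where open import Data.List.Properties using (length-++)

  module Vectors (p : ℕ) where

    _≟V_ : ∀ {r} → DecidableEquality (Vec (Fin p) r)
    _≟V_ = ≡-dec _≟F_

    allVec : ∀ r → List (Vec (Fin p) r)
    allVec zero = [] ∷ []
    allVec (suc r) = cartesianProductWith _∷_ (allFin p) (allVec r)

    ∈-allVec : ∀ {r} (u : Vec (Fin p) r) → u ∈ allVec r
    ∈-allVec [] = here refl
    ∈-allVec (a ∷ u) = ∈-cartesianProductWith⁺ _∷_ (∈-allFin a) (∈-allVec u)

    allVec! : ∀ r → Unique (allVec r)
    allVec! zero = [] ∷ []
    allVec! (suc r) = Unique.cartesianProductWith⁺ _∷_ ∷-injective (Unique.allFin⁺ p) (allVec! r)

    length-allVec : ∀ r → length (allVec r) ≡ p ^ r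
    length-allVec zero = refl
    length-allVec (suc r) = trans (length-cartesianProductWith _∷_ (allFin p) (allVec r))
        (cong₂ _*_ (length-tabulate {n = p} (λ i → i)) (length-allVec r))
      where open import Data.List.Properties using (length-tabulate)

    sumV : ∀ r → (Vec (Fin p) r → ℕ) → ℕ
    sumV zero F = F []
    sumV (suc r) F = sum (λ a → sumV r (λ u → F (a ∷ u)))

    sumV-cong : ∀ r {F G} → (∀ u → F u ≡ G u) → sumV r F ≡ sumV r G
    sumV-cong zero e = e []
    sumV-cong (suc r) e = sum-cong-≗ (λ a → sumV-cong r (λ u → e (a ∷ u)))

    sumV-+ : ∀ r F G → sumV r (λ u → F u + G u) ≡ sumV r F + sumV r G
    sumV-+ zero F G = refl
    sumV-+ (suc r) F G = trans (sum-cong-≗ (λ a → sumV-+ r (λ u → F (a ∷ u)) (λ u → G (a ∷ u))))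
      (∑-distrib-+ (λ a → sumV r (λ u → F (a ∷ u))) (λ a → sumV r (λ u → G (a ∷ u))))

    sumV-const : ∀ r c → sumV r (λ _ → c) ≡ p ^ r * c
    sumV-const zero c = sym (+-identityʳ c)
    sumV-const (suc r) c =
        trans (sum-cong-≗ {p} (λ a → sumV-const r c)) (trans (sum-const p (p ^ r * c))
        (sym (*-assoc p (p ^ r) c)))

    sumV-*ʳ : ∀ r F c → sumV r (λ u → F u * c) ≡ sumV r F * c
    sumV-*ʳ zero F c = refl
    sumV-*ʳ (suc r) F c =
        trans (sum-cong-≗ (λ a → sumV-*ʳ r (λ u → F (a ∷ u)) c))
        (sym (*-distribʳ-sum c (λ a → sumV r (λ u → F (a ∷ u)))))

    sumV-swap : ∀ r {n} (F : Vec (Fin p) r → Fin n → ℕ) → sumV r (λ u → sum (F u)) ≡ sum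
        (λ i → sumV r (λ u → F u i))
    sumV-swap zero F = refl
    sumV-swap (suc r) F =
        trans (sum-cong-≗ (λ a → sumV-swap r (λ u → F (a ∷ u)))) (∑-comm (λ a i → sumV r (λ u → F (a ∷ u) i)))

    sumV-δ : ∀ r v → sumV r (λ u → ⟦ u ≟V v ⟧) ≡ 1
    sumV-δ zero [] = refl
    sumV-δ (suc r) (b ∷ v) = trans (sum-cong-≗ (λ a → go a (a ≟F b))) (sum-δ b)
      where
      go : ∀ a (d : Dec (a ≡ b)) → sumV r (λ u → ⟦ (a ∷ u) ≟V (b ∷ v) ⟧) ≡ ⟦ d ⟧
      go a (yes refl) =
          trans (sumV-cong r (λ u → ind-cong ((a ∷ u) ≟V (b ∷ v)) (u ≟V v) (λ { refl → refl }) (cong (b ∷_))))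
          (sumV-δ r v)
      go a (no ne) = trans (sumV-cong r (λ u → ind-no ((a ∷ u) ≟V (b ∷ v)) (λ { refl → ne refl })))
          (trans (sumV-const r 0) (*-zeroʳ (p ^ r)))

    ↑ : ∀ {r} → Vec (Fin p) r → Vec ℕ r
    ↑ = Vec.map toℕ

  -- With `c = p - 1` the combination represents a difference modulo `p`.
  dot-+ʳ : ∀ {r} (u a b : Vec ℕ r) c → dot u (zipWith (λ a b → a + c * b) a b) ≡ dot u a + c * dot u b
  dot-+ʳ [] [] [] c = sym (*-zeroʳ c)
  dot-+ʳ (x ∷ u) (y ∷ a) (z ∷ b) c =
      trans (cong (x * (y + c * z) +_) (dot-+ʳ u a b c)) (lem x y z c (dot u a) (dot u b))
    where
    lem : ∀ x y z c d e → x * (y + c * z) + (d + c * e) ≡ x * y + d + c * (x * z + e)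
    lem = solve-∀

  dot-*ˡ : ∀ {r} c (u a : Vec ℕ r) → dot (Vec.map (c *_) u) a ≡ c * dot u a
  dot-*ˡ c [] [] = sym (*-zeroʳ c)
  dot-*ˡ c (x ∷ u) (y ∷ a) =
      trans (cong₂ _+_ (*-assoc c x y) (dot-*ˡ c u a)) (sym (*-distribˡ-+ c (x * y) (dot u a)))

  dot-*ʳ : ∀ {r} c (u a : Vec ℕ r) → dot u (Vec.map (c *_) a) ≡ c * dot u a
  dot-*ʳ c [] [] = sym (*-zeroʳ c)
  dot-*ʳ c (x ∷ u) (y ∷ a) = trans (cong (x * (c * y) +_) (dot-*ʳ c u a)) (lem x y c (dot u a))
    where
    lem : ∀ x y c d → x * (c * y) + c * d ≡ c * (x * y + d)
    lem = solve-∀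

  dot-+ˡ : ∀ {r} c (u v a : Vec ℕ r) → dot (zipWith (λ a b → a + c * b) u v) a ≡ dot u a + c * dot v a
  dot-+ˡ c [] [] [] = sym (*-zeroʳ c)
  dot-+ˡ c (x ∷ u) (y ∷ v) (z ∷ a) =
      trans (cong ((x + c * y) * z +_) (dot-+ˡ c u v a)) (lem x y z c (dot u a) (dot v a))
    where
    lem : ∀ x y z c d e → (x + c * y) * z + (d + c * e) ≡ x * z + d + c * (y * z + e)
    lem = solve-∀

  dot-∷ʳ : ∀ {r} (u a : Vec ℕ r) t b → dot (u ∷ʳ t) (a ∷ʳ b) ≡ dot u a + t * b
  dot-∷ʳ [] [] t b = +-identityʳ (t * b)
  dot-∷ʳ (x ∷ u) (y ∷ a) t b = trans (cong (x * y +_) (dot-∷ʳ u a t b)) (sym (+-assoc (x * y) _ _))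

  zeroes : ∀ {r} → Vec ℕ r
  zeroes = Vec.replicate _ 0

  dot-zeroes : ∀ {r} (a : Vec ℕ r) → dot zeroes a ≡ 0
  dot-zeroes [] = refl
  dot-zeroes (_ ∷ a) = dot-zeroes a

  unit : ∀ {r} → Fin r → Vec ℕ r
  unit zero = 1 ∷ zeroes
  unit (suc s) = 0 ∷ unit s

  dot-unit : ∀ {r} (s : Fin r) (a : Vec ℕ r) → dot (unit s) a ≡ lookup a s
  dot-unit zero (x ∷ a) = trans (cong₂ _+_ (+-identityʳ x) (dot-zeroes a)) (+-identityʳ x)
  dot-unit (suc s) (_ ∷ a) = dot-unit s a

  lookup-∷ʳ-< : ∀ {r N} (a : Vec ℕ r) {b} → (∀ s → lookup a s < N) → b < N → ∀ s → lookup (a ∷ʳ b) s < N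
  lookup-∷ʳ-< [] a< b< zero = b<
  lookup-∷ʳ-< (x ∷ a) a< b< zero = a< zero
  lookup-∷ʳ-< (x ∷ a) a< b< (suc s) = lookup-∷ʳ-< a (a< ∘ suc) b< s

  -- The hypothesis solve-linear plays the role of the primality of p.
  module Linear (p : ℕ) {{_ : NonZero p}}
    (solve-linear : ∀ e t → ¬ Modular._≈_ p e 0 → sum {p} (λ a → ⟦ Modular._≈?_ p (toℕ a * e + t) 0 ⟧) ≡
      1) where
    open Modular p
    open Vectors p

    dot-≈0 : ∀ {r} (u e : Vec ℕ r) → (∀ s → lookup e s ≈ 0) → dot u e ≈ 0
    dot-≈0 [] [] z = ≈-refl
    dot-≈0 (x ∷ u) (y ∷ e) z = ≈-+ (≈-trans (≈-*ˡ x (z zero)) (≡⇒≈ (*-zeroʳ x))) (dot-≈0 u e (z ∘ suc))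

    dot-≈ˡ : ∀ {r} (u v e : Vec ℕ r) → (∀ s → lookup u s ≈ lookup v s) → dot u e ≈ dot v e
    dot-≈ˡ [] [] [] z = ≈-refl
    dot-≈ˡ (x ∷ u) (y ∷ v) (c ∷ e) z = ≈-+ (≈-* (z zero) ≈-refl) (dot-≈ˡ u v e (z ∘ suc))

    -- Multiplied by `p` to avoid the exponent `r - 1`. If the tail of `e` is non-zero modulo `p`,
    -- every first coordinate leaves an affine hyperplane in the remaining ones; otherwise the
    -- equation concerns the first coordinate alone, and `solve-linear` gives it one solution.
    hyperplane : ∀ {r} (e : Vec ℕ r) t → (∃ λ s → ¬ lookup e s ≈ 0) →
        p * sumV r (λ u → ⟦ dot (↑ u) e + t ≈? 0 ⟧) ≡ p ^ r
    hyperplane {suc r} (x ∷ e) t ne with any? (λ s → ¬? (lookup e s ≈? 0))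
    ... | yes ne' = trans (*-distribˡ-sum {p} p (λ a → sumV r (λ u → ⟦ toℕ a * x + dot (↑ u) e + t ≈? 0 ⟧)))
        (trans (sum-cong-≗ {p} (λ a →
         trans (cong (p *_) (sumV-cong r (λ u → ind-cong (toℕ a * x + dot (↑ u) e + t ≈? 0)
             (dot (↑ u) e + (toℕ a * x + t) ≈? 0)
           (≈-trans (≡⇒≈ (lem (toℕ a * x) (dot (↑ u) e) t))) (≈-trans
             (≡⇒≈ (sym (lem (toℕ a * x) (dot (↑ u) e) t)))))))
          (hyperplane e (toℕ a * x + t) ne'))) (sum-const p (p ^ r)))
      where
      lem : ∀ a d t → d + (a + t) ≡ a + d + t
      lem = solve-∀
    ... | no nn =
        cong (p *_) (trans
        (sum-cong-≗ {p}
        (λ a → trans (sumV-cong r (λ u → ind-cong (toℕ a * x + dot (↑ u) e + t ≈? 0) (toℕ a * x + t ≈? 0)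
            (≈-trans (≈-sym (drop a u))) (≈-trans (drop a u)))) (trans (sumV-const r _) (*-comm (p ^ r) _))))
          (trans (sym (*-distribʳ-sum {p} (p ^ r) (λ a → ⟦ toℕ a * x + t ≈? 0 ⟧)))
            (trans (cong (_* p ^ r) (solve-linear x t x≉)) (+-identityʳ _))))
      where
      e≈0 : ∀ s → lookup e s ≈ 0
      e≈0 s with lookup e s ≈? 0
      ... | yes z = z
      ... | no z = contradiction (s , z) nn
      x≉ : ¬ x ≈ 0
      x≉ x≈ = go ne
        where
        go : (∃ λ s → ¬ lookup (x ∷ e) s ≈ 0) → ⊥
        go (zero , z) = z x≈
        go (suc s , z) = z (e≈0 s)
      drop : ∀ (a : Fin p) u → toℕ a * x + dot (↑ u) e + t ≈ toℕ a * x + t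
      drop a u = ≈-+ (≈-trans (≈-+ (≈-refl {toℕ a * x}) (dot-≈0 (↑ u) e e≈0)) (≡⇒≈ (+-identityʳ _)))
          (≈-refl {t})

    -- The inverse `b` is the solution of `b a + (p - 1) = 0`.
    inverse : ∀ a → ¬ a ≈ 0 → ∃ λ b → b * a ≈ 1
    inverse a a≉ = let b , q = sum-pos {p} {λ b → ⟦ toℕ b * a + pred p ≈? 0 ⟧} (subst (0 <_) (sym (solve-linear a (pred p) a≉)) z<s) in
      toℕ b , ≈-cancelʳ (pred p) (≈-trans (ind-1 (toℕ b * a + pred p ≈? 0) (≤-antisym (ind-≤1 _) q))
          (≈-sym (≈-trans (≡⇒≈ (suc-pred p)) N≈0)))

    ≈⇒≡ : ∀ {a b : Fin p} → toℕ a ≈ toℕ b → a ≡ b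
    ≈⇒≡ {a} {b} e = toℕ-injective (<⇒≈⇒≡ (toℕ<n a) (toℕ<n b) e)

  -- Common frame of the binary case, with `q = 2k`, and the ternary case, with `q = k`: `h` is
  -- constant with value `M`, that is `1/p`, and an element that is not a multiple of `h` has `q`
  -- zeros among its `p q` coordinates.
  module Code (S : Setting) (p : ℕ) {{_ : NonZero p}} (2≤p : 2 ≤ p)
    (solve-linear : ∀ e t → ¬ Modular._≈_ p e 0 → sum {p} (λ a → ⟦ Modular._≈?_ p (toℕ a * e + t) 0 ⟧) ≡ 1)
    (M q : ℕ) (pM : p * M ≡ Setting.N S) (hM : ∀ i → Core.h S i ≡ M) (pq : Setting.n S ≡ p * q)
    (zeros : ∀ {f} → Core.Out S f → sum (Setting.iz S f) ≡ q) where
    open Setting S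
    open Core S
    open Generation S
    open Cases S
    open Vectors p
    open Linear p solve-linear
    module P = Modular p

    instance
      M≢0 : NonZero M
      M≢0 = m*n≢0⇒n≢0 p {{subst NonZero (sym pM) N≢0}}

    scale : ∀ {a b} → a P.≈ b → M * a ≈ M * b
    scale {a} {b} e = ≈-trans (lem a) (≈-trans (≡⇒≈ (cong (M *_) (P.un e))) (≈-sym (lem b)))
      where
      ring : ∀ M a q p → M * (a + q * p) ≡ M * a + q * (p * M)
      ring = solve-∀
      lem : ∀ a → M * a ≈ M * (a % p)
      lem a = ≈-trans (≡⇒≈ (trans (cong (M *_) (m≡m%n+[m/n]*n a p))
          (trans (ring M (a % p) (a / p) p) (cong (λ z → M * (a % p) + a / p * z) pM)))) (≈-+N _ (a / p))

    unscale₀ : ∀ {a} → M * a ≈ 0 → a P.≈ 0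
    unscale₀ {a} e with ≈0⇒∣ e
    ... | divides k eq =
        P.∣⇒≈0 (divides k (*-cancelˡ-≡ a (k * p) M (trans eq (trans (cong (k *_) (sym pM)) (lem k p M)))))
      where
      lem : ∀ k p M → k * (p * M) ≡ M * (k * p)
      lem = solve-∀

    unscale : ∀ {a b} → M * a ≈ M * b → a P.≈ b
    unscale {a} {b} e = P.≈-cancelʳ (P.neg b) (P.≈-trans (unscale₀ (≈-trans (≡⇒≈ (*-distribˡ-+ M a (P.neg b)))
      (≈-trans (≈-+ e ≈-refl) (≈-trans (≡⇒≈ (sym (*-distribˡ-+ M b (P.neg b))))
        (≈-trans (scale (P.+-neg b)) (≡⇒≈ (*-zeroʳ M))))))) (P.≈-sym (P.+-neg b)))

    ph : p ⊡ h ≋ (λ _ → 0)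
    ph i = ≈-trans (≡⇒≈ (trans (cong (p *_) (hM i)) pM)) N≈0

    open Order p ph

    -- For elements outside the multiples of `h`, `out-kill` with `c = p` shows `p f_i = 0`, so
    -- `f_i` is a multiple of `1/p`.
    digit : ∀ {f} → InE f → ∀ i → ∃ λ (w : Fin p) → f i ≈ M * toℕ w
    digit {f} f∈ i = let w , e = lift (out? f∈) in fromℕ< (m%n<n w p) ,
        ≈-trans e (scale (P.≈-trans (P.≈-sym (P.≈-% w)) (P.≡⇒≈ (sym (toℕ-fromℕ< (m%n<n w p))))))
      where
      lift : (Out f ⊎ ∃ λ j → j < p × f ≋ j ⊡ h) → ∃ λ w → f i ≈ M * w
      lift (inj₂ (j , _ , e)) = j , ≈-trans (e i) (≡⇒≈ (trans (cong (j *_) (hM i)) (*-comm j M)))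
      lift (inj₁ o) with ≈0⇒∣ (out-kill o p i (trans (cong (p *_) (hM i)) pM))
      ... | divides k eq = k , ≡⇒≈ (*-cancelˡ-≡ (f i) (M * k) p
          (trans eq (trans (cong (k *_) (sym pM)) (lem k p M))))
        where
        lem : ∀ k p M → k * (p * M) ≡ p * (M * k)
        lem = solve-∀

    -- The combination of the rows with coefficients `u`, plus `t` times the constant row `h`.
    word : ∀ {r} → (Fin n → Vec (Fin p) r) → Vec ℕ r → ℕ → Fun
    word col u t i = M * (dot u (↑ (col i)) + t)

    -- Elements linearly independent modulo `h`, stored column by column: `t` in `independent`
    -- allows for a multiple of `h`.
    record Frame (r : ℕ) : Set where
      field
        col : Fin n → Vec (Fin p) r
        word∈ : ∀ u t → InE (word col u t)
        independent : ∀ u t → (∀ i → dot u (↑ (col i)) + t P.≈ 0) → ∀ s → lookup u s P.≈ 0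

      value : Vec (Fin p) (suc r) → Fun
      value (t ∷ u) = word col (↑ u) (toℕ t)

      Spans : Set
      Spans = ∀ f → InE f → ∃ λ U → f ≋ value U

      normalise : ∀ u t → ∃ λ U → word col u t ≋ value U
      normalise u t = fin t ∷ Vec.map fin u , λ i → scale (P.≈-+ (dot-≈ˡ u (↑ (Vec.map fin u)) (↑ (col i)) λ s →
             P.≈-trans (fin≈ (lookup u s))
                 (P.≡⇒≈ (sym (trans (lookup-map s toℕ (Vec.map fin u)) (cong toℕ (lookup-map s fin u))))))
                 (fin≈ t))
        where
        fin : ℕ → Fin p
        fin a = fromℕ< (m%n<n a p)
        fin≈ : ∀ a → a P.≈ toℕ (fin a)
        fin≈ a = P.≈-trans (P.≈-sym (P.≈-% a)) (P.≡⇒≈ (sym (toℕ-fromℕ< (m%n<n a p))))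

      spans? : Spans ⊎ ∃ λ f → InE f × ∀ u t → ¬ f ≋ word col u t
      spans? with All.all? (λ x → Any.any? (λ U → lookup x ≋? value U) (allVec (suc r))) E
      ... | yes a = inj₁ λ f f∈ → let U , _ , e = find (All.lookup a f∈) in
              U , λ i → ≈-trans (≈-sym (≈-trans (≡⇒≈ (lookup∘tabulate (λ i → f i % N) i)) (≈-% (f i)))) (e i)
      ... | no na with find (All.¬All⇒Any¬ (λ x → Any.any? (λ U → lookup x ≋? value U) (allVec (suc r))) E na)
      ...   | x , x∈ , ne = inj₂ (lookup x , ∈⇒InE x∈ , λ u t e → ne (let U , e' = normalise u t in lose (∈-allVec U) (≋-trans e e')))

      independent-≡ : ∀ u v t t' → word col (↑ u) t ≋ word col (↑ v) t' → u ≡ v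
      independent-≡ u v t t' e =
          trans (sym (tabulate∘lookup u)) (trans (tabulate-cong (λ s → ≈⇒≡ (go s))) (tabulate∘lookup v))
        where
        W = zipWith (λ a b → a + pred p * b) (↑ u) (↑ v)
        ring : ∀ d c e t t' → d + c * e + (t + c * t') ≡ d + t + c * (e + t')
        ring = solve-∀
        van : ∀ i → dot W (↑ (col i)) + (t + pred p * t') P.≈ 0
        van i = P.≈-trans (P.≡⇒≈ (trans (cong (_+ (t + pred p * t')) (dot-+ˡ (pred p) (↑ u) (↑ v) (↑ (col i))))
            (ring (dot (↑ u) (↑ (col i))) (pred p) (dot (↑ v) (↑ (col i))) t t')))
          (P.≈-trans (P.≈-+ (unscale (e i)) P.≈-refl) (P.+-neg _))
        go : ∀ s → toℕ (lookup u s) P.≈ toℕ (lookup v s)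
        go s = P.≈-cancelʳ (P.neg (toℕ (lookup v s))) (P.≈-trans (P.≡⇒≈ (sym eq))
            (P.≈-trans (independent W (t + pred p * t') van s) (P.≈-sym (P.+-neg _))))
          where
          open import Data.Vec.Properties using (lookup-zipWith)
          eq : lookup W s ≡ toℕ (lookup u s) + pred p * toℕ (lookup v s)
          eq = trans (lookup-zipWith (λ a b → a + pred p * b) s (↑ u) (↑ v))
              (cong₂ (λ a b → a + pred p * b) (lookup-map s toℕ u) (lookup-map s toℕ v))

      value-injective : ∀ U V → value U ≋ value V → U ≡ V
      value-injective (t ∷ u) (t' ∷ v) e with independent-≡ u v (toℕ t) (toℕ t') e
      ... | refl = cong (_∷ u) (≈⇒≡ (P.≈-cancelˡ (dot (↑ u) (↑ (col i₀))) (unscale (e i₀))))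

      values : List Fun
      values = map value (allVec (suc r))

      values! : AllPairs (λ f f' → ¬ f ≋ f') values
      values! = AllPairs.map⁺ (AllPairs.map (λ ne e → ne (value-injective _ _ e)) (allVec! (suc r)))

      value∈ : ∀ U → InE (value U)
      value∈ (t ∷ u) = word∈ (↑ u) (toℕ t)

      length-values : length values ≡ p ^ suc r
      length-values = trans (length-map value (allVec (suc r))) (length-allVec (suc r))

      -- The words of a frame are pairwise distinct elements of the group. This bounds the rank and
      -- so makes the search in `basis` stop.
      size-≤ : p ^ suc r ≤ m
      size-≤ = subst₂ _≤_ (trans (length-map res values) length-values) size
        (length-⊆ (AllPairs.map⁺ (AllPairs.map (λ ne e → ne (res-inj e)) values!)) sub)
        where
        open import Data.List.Membership.Propositional.Properties using (∈-map⁻)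
        sub : ∀ x → x ∈ map res values → x ∈ E
        sub x x∈ with ∈-map⁻ res x∈
        ... | f , f∈ , refl with ∈-map⁻ value f∈
        ...   | U , _ , refl = value∈ U

      spans-size : Spans → m ≡ p ^ suc r
      spans-size sp = trans (card values values! (All.map⁺ (All.tabulate (λ {U} _ → value∈ U)))
        (λ f f∈ → let U , e = sp f f∈ in Any.map⁺ (lose (∈-allVec U) e))) length-values

      count : Vec (Fin p) r → ℕ
      count c = sum (λ i → ⟦ c ≟V col i ⟧)

      -- Double counting of the pairs (u, i) with u · col i = u · c.
      equidistributed : ∀ c → count c * p ^ r ≡ n
      -- Both ways of counting contain `p (p^r q)`. After cancelling it, both sides carry the factor
      -- `p - 1`, which is non-zero as `p ≥ 2`.
      equidistributed c = *-cancelʳ-≡ _ _ (pred p) {{>-nonZero (pred-mono-≤ 2≤p)}}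
          (+-cancelˡ-≡ (p * (p ^ r * q)) _ _ (begin
        p * (p ^ r * q) + count c * p ^ r * pred p ≡⟨ ring₁ p (p ^ r) q (count c) (pred p) ⟩
        p * q * p ^ r + count c * (pred p * p ^ r) ≡⟨ cong (λ z → z * p ^ r + count c * (pred p * p ^ r)) pq ⟨
        n * p ^ r + count c * (pred p * p ^ r) ≡⟨ cong₂ _+_ (sum-const n (p ^ r))
            (sym (*-distribʳ-sum (pred p * p ^ r) (λ i → ⟦ c ≟V col i ⟧))) ⟨
        sum {n} (λ _ → p ^ r) + sum (λ i → ⟦ c ≟V col i ⟧ * (pred p * p ^ r)) ≡⟨ ∑-distrib-+ {n} (λ _ → p ^ r) _
            ⟨
        sum (λ i → p ^ r + ⟦ c ≟V col i ⟧ * (pred p * p ^ r)) ≡⟨ sum-cong-≗ (λ i → vertical i (c ≟V col i)) ⟨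
        sum (λ i → p * sumV r (λ u → ⟦ hit u i ≈? 0 ⟧ₚ)) ≡⟨ *-distribˡ-sum p
            (λ i → sumV r (λ u → ⟦ hit u i ≈? 0 ⟧ₚ)) ⟨
        p * sum (λ i → sumV r (λ u → ⟦ hit u i ≈? 0 ⟧ₚ)) ≡⟨ cong (p *_)
            (sumV-swap r (λ u i → ⟦ hit u i ≈? 0 ⟧ₚ)) ⟨
        p * sumV r (λ u → sum (λ i → ⟦ hit u i ≈? 0 ⟧ₚ)) ≡⟨ cong (p *_)
            (sumV-cong r (λ u → horizontal u (u ≟V zeroV))) ⟩
        p * sumV r (λ u → q + ⟦ u ≟V zeroV ⟧ * (pred p * q)) ≡⟨ cong (p *_)
            (trans (sumV-+ r (λ _ → q) _) (cong₂ _+_ (sumV-const r q)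
                  (trans (sumV-*ʳ r (λ u → ⟦ u ≟V zeroV ⟧) (pred p * q))
                    (trans (cong (_* (pred p * q)) (sumV-δ r zeroV)) (+-identityʳ _))))) ⟩
        p * (p ^ r * q + pred p * q) ≡⟨ ring₂ p (p ^ r) q (pred p) ⟩
        p * (p ^ r * q) + p * q * pred p ≡⟨ cong (λ z → p * (p ^ r * q) + z * pred p) pq ⟨
        p * (p ^ r * q) + n * pred p ∎))
        where
        open ≡-Reasoning
        -- The difference of `u · col i` and `u · c`. Its second term does not depend on `i`, so it
        -- amounts to a multiple of `h`, and the difference is again a word of the group.
        hit : Vec (Fin p) r → Fin n → ℕ
        hit u i = dot (↑ u) (↑ (col i)) + pred p * dot (↑ u) (↑ c)
        ⟦_≈?_⟧ₚ : ℕ → ℕ → ℕ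
        ⟦ a ≈? b ⟧ₚ = ⟦ a P.≈? b ⟧
        finZero : ∀ {p} → NonZero p → Fin p
        finZero {suc _} _ = zero
        toℕ-finZero : ∀ {p} (x : NonZero p) → toℕ (finZero x) ≡ 0
        toℕ-finZero {suc _} _ = refl
        nzp : NonZero p
        nzp = >-nonZero (≤-trans (s≤s z≤n) 2≤p)
        zeroV : Vec (Fin p) r
        zeroV = Vec.replicate r (finZero nzp)
        ↑zeroV : ∀ s → toℕ (lookup zeroV s) ≡ 0
        ↑zeroV s = trans (cong toℕ (lookup-replicate s (finZero nzp))) (toℕ-finZero nzp)
          where open import Data.Vec.Properties using (lookup-replicate)
        ring₁ : ∀ p P q c p' → p * (P * q) + c * P * p' ≡ p * q * P + c * (p' * P)
        ring₁ = solve-∀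
        ring₂ : ∀ p P q p' → p * (P * q + p' * q) ≡ p * (P * q) + p * q * p'
        ring₂ = solve-∀
        -- For a fixed column: every `u` counts if the column is `c`; otherwise the `u` that count
        -- form the hyperplane orthogonal to `col i - c`.
        vertical : ∀ i (d : Dec (c ≡ col i)) → p * sumV r (λ u → ⟦ hit u i ≈? 0 ⟧ₚ) ≡ p ^ r + ⟦ d ⟧ *
            (pred p * p ^ r)
        vertical i (yes refl) = begin
          p * sumV r (λ u → ⟦ hit u i ≈? 0 ⟧ₚ) ≡⟨ cong (p *_) (sumV-cong r
              (λ u → ind-yes (hit u i P.≈? 0) (P.+-neg _))) ⟩
          p * sumV r (λ u → 1) ≡⟨ cong (p *_) (trans (sumV-const r 1) (*-identityʳ _)) ⟩
          p * p ^ r ≡⟨ cong (_* p ^ r) (suc-pred p) ⟨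
          p ^ r + pred p * p ^ r ≡⟨ cong (p ^ r +_) (+-identityʳ _) ⟨
          p ^ r + 1 * (pred p * p ^ r) ∎
        vertical i (no ne) =
            trans (cong (p *_) (sumV-cong r (λ u → ind-cong (hit u i P.≈? 0) (dot (↑ u) e + 0 P.≈? 0)
              (P.≈-trans (P.≡⇒≈ (eq u))) (P.≈-trans (P.≡⇒≈ (sym (eq u)))))))
                (trans (hyperplane e 0 differ) (sym (+-identityʳ _)))
          where
          open import Data.Vec.Properties using (lookup-zipWith)
          e = zipWith (λ a b → a + pred p * b) (↑ (col i)) (↑ c)
          eq : ∀ u → dot (↑ u) e + 0 ≡ hit u i
          eq u = trans (+-identityʳ _) (dot-+ʳ (↑ u) (↑ (col i)) (↑ c) (pred p))
          differ : ∃ λ s → ¬ lookup e s P.≈ 0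
          differ with any? (λ s → ¬? (lookup e s P.≈? 0))
          ... | yes r = r
          ... | no nn = contradiction (trans (sym (tabulate∘lookup c))
              (trans (tabulate-cong (λ s → sym (same s))) (tabulate∘lookup (col i)))) ne
            where
            same : ∀ s → lookup (col i) s ≡ lookup c s
            same s with lookup e s P.≈? 0
            ... | no z = contradiction (s , z) nn
            ... | yes z = ≈⇒≡ (P.≈-cancelʳ (P.neg (toℕ (lookup c s))) (P.≈-trans (P.≈-trans (P.≡⇒≈ (sym
                    (trans (lookup-zipWith (λ a b → a + pred p * b) s (↑ (col i)) (↑ c))
                      (cong₂ (λ a b → a + pred p * b) (lookup-map s toℕ (col i)) (lookup-map s toℕ c))))) z)
                      (P.≈-sym (P.+-neg _))))
        -- For a fixed `u`: if it is non-zero, independence makes the word a non-multiple of `h`,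
        -- with `q` zeros; if it is zero, all `p q` columns count.
        horizontal : ∀ u (d : Dec (u ≡ zeroV)) → sum (λ i → ⟦ hit u i ≈? 0 ⟧ₚ) ≡ q + ⟦ d ⟧ * (pred p * q)
        horizontal u (yes refl) = begin
          sum (λ i → ⟦ hit u i ≈? 0 ⟧ₚ) ≡⟨ sum-cong-≗ (λ i → ind-yes (hit u i P.≈? 0)
              (P.≈-trans (P.≈-+ (van (col i)) (P.≈-*ˡ (pred p) (van c))) (P.≡⇒≈ (*-zeroʳ (pred p))))) ⟩
          sum {n} (λ _ → 1) ≡⟨ trans (sum-const n 1) (*-identityʳ n) ⟩
          n ≡⟨ pq ⟩
          p * q ≡⟨ cong (_* q) (suc-pred p) ⟨
          q + pred p * q ≡⟨ cong (q +_) (+-identityʳ _) ⟨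
          q + 1 * (pred p * q) ∎
          where
          van : ∀ v → dot (↑ zeroV) (↑ v) P.≈ 0
          van v = P.≈-trans (dot-≈ˡ (↑ zeroV) zeroes (↑ v) (λ s →
              P.≡⇒≈ (trans (trans (lookup-map s toℕ zeroV) (↑zeroV s)) (sym (lookup-replicate s 0)))))
              (P.≡⇒≈ (dot-zeroes (↑ v)))
            where open import Data.Vec.Properties using (lookup-replicate)
        horizontal u (no ne) =
            trans (sum-cong-≗ (λ i → ind-cong (hit u i P.≈? 0) (word col (↑ u) (pred p * dot (↑ u) (↑ c)) i ≈?
            0)
              (λ e → ≈-trans (scale e) (≡⇒≈ (*-zeroʳ M))) unscale₀))
                (trans (zeros (out (word∈ (↑ u) _) notMult)) (sym (+-identityʳ q)))
          where
          notMult : ∀ j → ¬ word col (↑ u) (pred p * dot (↑ u) (↑ c)) ≋ j ⊡ h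
          notMult j e =
              ne (independent-≡ u zeroV _ j (λ i → ≈-trans (e i) (≈-trans
              (≡⇒≈ (trans (cong (j *_) (hM i)) (*-comm j M)))
              (scale (P.≈-sym (P.≈-+ (van (col i)) (P.≈-refl {j})))))))
            where
            van : ∀ v → dot (↑ zeroV) (↑ v) P.≈ 0
            van v = P.≈-trans (dot-≈ˡ (↑ zeroV) zeroes (↑ v) (λ s →
                P.≡⇒≈ (trans (trans (lookup-map s toℕ zeroV) (↑zeroV s)) (sym (lookup-replicate s 0)))))
                (P.≡⇒≈ (dot-zeroes (↑ v)))
              where open import Data.Vec.Properties using (lookup-replicate)

      genBy : Spans → ∀ {R : List (Vec ℚ (suc r))} → toList (tabulate (λ i → divCol (col i) ∷ʳ cst 1 p)) ↭ R →
          GenBy R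
      genBy sp {R} perm = record
        { C = C
        ; C<N = λ i → lookup-∷ʳ-< (Vec.map (λ a → M * toℕ a) (col i))
            (λ s → subst (_< N) (sym (lookup-map s (λ a → M * toℕ a) (col i))) (<N (toℕ<n (lookup (col i) s))))
              (subst (_< N) (*-identityʳ M) (<N 2≤p))
        ; rows∈ = λ s → rows s (initLast (unit s))
        ; generate = λ f f∈ → coefficients (sp f f∈)
        ; columns↭ = subst (_↭ R) (toList-tabulate-cong (λ i → sym (column i))) perm }
        where
        C : Fin n → Vec ℕ (suc r)
        C i = Vec.map (λ a → M * toℕ a) (col i) ∷ʳ M
        <N : ∀ {a} → a < p → M * a < N
        <N {a} a<p = subst (M * a <_) (trans (*-comm M p) pM) (*-monoʳ-< M a<p)
        dotC : ∀ u t i → dot (u ∷ʳ t) (C i) ≡ word col u t i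
        dotC u t i = trans (dot-∷ʳ u (Vec.map (λ a → M * toℕ a) (col i)) t M)
          (trans (cong₂ _+_ (trans (cong (dot u) (map-∘ (M *_) toℕ (col i))) (dot-*ʳ M u (↑ (col i))))
            (*-comm t M)) (sym (*-distribˡ-+ M (dot u (↑ (col i))) t)))
        coefficients : ∀ {f} → (∃ λ U → f ≋ value U) → ∃ λ c → f ≋ λ i → dot c (C i)
        coefficients (t ∷ u , e) = ↑ u ∷ʳ toℕ t , λ i → ≈-trans (e i) (≡⇒≈ (sym (dotC (↑ u) (toℕ t) i)))
        -- Splitting the unit vector as `u ∷ʳ t` treats the rows of `col` and the last row `h`
        -- alike.
        rows : ∀ s → (∃ λ u → ∃ λ t → unit s ≡ u ∷ʳ t) → InE (λ i → lookup (C i) s)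
        rows s (u , t , e) =
            InE-resp (λ i → ≡⇒≈ (trans (sym (dotC u t i)) (trans (cong (λ z → dot z (C i)) (sym e))
            (dot-unit s (C i))))) (word∈ u t)
        column : ∀ i → Vec.map (λ y → cst y N) (C i) ≡ divCol (col i) ∷ʳ cst 1 p
        column i = trans (map-∷ʳ (λ y → cst y N) M (Vec.map (λ a → M * toℕ a) (col i))) (cong₂ _∷ʳ_
          (trans (sym (map-∘ (λ y → cst y N) (λ a → M * toℕ a) (col i)))
            (map-cong (λ a → cst-≡ (M * toℕ a) N (toℕ a) p
               (trans (lem M (toℕ a) p) (cong (toℕ a *_) pM))) (col i)))
          (cst-≡ M N 1 p (trans (*-comm M p) (trans pM (sym (+-identityʳ N))))))
          where
          lem : ∀ M a p → M * a * p ≡ a * (p * M)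
          lem = solve-∀

    frame₀ : Frame 0
    frame₀ = record { col = λ _ → [] ; word∈ =
        λ { [] t → InE-resp (λ i → ≡⇒≈ (trans (cong (t *_) (hM i)) (*-comm t M))) (mul t h∈) }
      ; independent = λ { u t e () } }

    -- In a relation whose coefficient `a` at the new element is non-zero, inverting `a` and
    -- changing the sign would express `f` as a word of the old frame.
    extend : ∀ {r} (F : Frame r) {f} → InE f → (∀ u t → ¬ f ≋ word (Frame.col F) u t) → Frame (suc r)
    extend F {f} f∈ new = record { col = λ i → proj₁ (digit f∈ i) ∷ col i ; word∈ = ∈′ ; independent = ind′ }
      where
      open Frame F
      w : Fin n → ℕ
      w i = toℕ (proj₁ (digit f∈ i))
      ∈′ : ∀ u t → InE (word (λ i → proj₁ (digit f∈ i) ∷ col i) u t)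
      ∈′ (a ∷ u) t = InE-resp (λ i → ≈-trans (≈-+ (≈-*ˡ a (proj₂ (digit f∈ i))) ≈-refl)
          (≡⇒≈ (lem a M (w i) (dot u (↑ (col i))) t))) (add (mul a f∈) (word∈ u t))
        where
        lem : ∀ a M w d t → a * (M * w) + M * (d + t) ≡ M * (a * w + d + t)
        lem = solve-∀
      ind′ : ∀ u t → (∀ i → dot u (w i ∷ ↑ (col i)) + t P.≈ 0) → ∀ s → lookup u s P.≈ 0
      ind′ (a ∷ u) t e with a P.≈? 0
      ... | yes a≈0 = λ { zero → a≈0 ; (suc s) → independent u t
          (λ i → P.≈-trans (P.≈-sym (P.≈-+ (P.≈-+ (P.≈-* a≈0 (P.≈-refl {w i})) P.≈-refl) (P.≈-refl {t}))) (e i))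
          s }
      ... | no a≉0 = contradiction (λ i → ≈-trans (proj₂ (digit f∈ i)) (scale (main i)))
          (new (Vec.map (pred p * b *_) u) (pred p * b * t))
        where
        b = proj₁ (inverse a a≉0)
        ba : b * a P.≈ 1
        ba = proj₂ (inverse a a≉0)
        ring : ∀ b a w d t → b * (a * w + d + t) ≡ b * a * w + b * (d + t)
        ring = solve-∀
        ring' : ∀ p b d t → p * (b * (d + t)) ≡ p * b * d + p * b * t
        ring' = solve-∀
        main : ∀ i → w i P.≈ dot (Vec.map (pred p * b *_) u) (↑ (col i)) + pred p * b * t
        main i = P.≈-trans
            (P.+≈0⇒≈neg (P.≈-trans
            (P.≈-+ (P.≈-sym (P.≈-trans (P.≈-* ba (P.≈-refl {w i})) (P.≡⇒≈ (+-identityʳ (w i))))) P.≈-refl)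
                  (P.≈-trans (P.≡⇒≈ (sym (ring b a (w i) (dot u (↑ (col i))) t)))
                    (P.≈-trans (P.≈-*ˡ b (e i)) (P.≡⇒≈ (*-zeroʳ b))))))
            (P.≡⇒≈ (trans (ring' (pred p) b (dot u (↑ (col i))) t)
              (cong (_+ pred p * b * t) (sym (dot-*ˡ (pred p * b) u (↑ (col i)))))))

    r<p^ : ∀ r → r < p ^ r
    r<p^ zero = z<s
    r<p^ (suc r) = ≤-trans (+-mono-≤ (≤-trans z<s (r<p^ r)) (≤-trans (r<p^ r) (m≤m+n _ 0)))
        (*-monoˡ-≤ (p ^ r) 2≤p)

    basis : ∃ λ r → Σ (Frame r) Frame.Spans
    basis = grow m frame₀ (m≤m+n m 0)
      where
      grow : ∀ fuel {r} (F : Frame r) → m ≤ fuel + r → ∃ λ r → Σ (Frame r) Frame.Spans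
      -- Now `m ≤ r`, while a frame of rank `r` yields `p ^ (r + 1) > r` elements of the group.
      grow zero {r} F le = contradiction (≤-trans (Frame.size-≤ F) le)
          (<⇒≱ (<-≤-trans (r<p^ r) (m≤n*m (p ^ r) p)))
      grow (suc fuel) {r} F le with Frame.spans? F
      ... | inj₁ sp = r , F , sp
      ... | inj₂ (f , f∈ , new) = grow fuel (extend F f∈ new) (≤-trans le (≤-reflexive (sym (+-suc fuel r))))

-- Simplex codes and the list of cases.

module Classification where

  open FiniteSums
  open ResidueGroups
  open Multiplicities
  open CyclicCases
  open LinearCodes
  open import Defs
  open import Data.Nat hiding (_/_)
  open import Data.Nat.Properties
  open import Data.Nat.DivMod using (m%n<n; m<n⇒m%n≡m)
  open import Data.Nat.Tactic.RingSolver using (solve-∀)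
  open import Data.Rational using (ℚ)
  open import Data.Fin.Base using (Fin; zero; suc; toℕ)
  open import Data.Fin.Properties using (all?; toℕ<n; toℕ-injective)
  open import Data.Vec as Vec using (Vec; []; _∷_; _∷ʳ_; lookup; tabulate; toList)
  open import Data.Vec.Properties as Vec using (lookup-map; map-∘; map-cong; map-id; map-replicate;
      lookup-replicate)
  open import Data.List as List using (List; []; _∷_; length; map; _++_; replicate; concat; filter)
  import Data.List.Properties as List
  open import Data.List.Membership.Propositional using (_∈_)
  open import Data.List.Membership.Propositional.Properties using
      (∈-filter⁺; ∈-filter⁻; ∈-lookup; ∈-++⁺ˡ; ∈-++⁺ʳ; ∈-++⁻; ∈-map⁺; ∈-map⁻)
  open import Data.List.Relation.Unary.Any as Any using (Any; here)
  import Data.List.Relation.Unary.Any.Properties as Any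
  open import Data.List.Relation.Unary.All as All using (All; []; _∷_)
  open import Data.List.Relation.Unary.AllPairs using ([]; _∷_)
  open import Data.List.Relation.Unary.Unique.Propositional using (Unique)
  import Data.List.Relation.Unary.Unique.Propositional.Properties as Unique
  open import Data.List.Relation.Binary.Permutation.Propositional using (_↭_; ↭-refl; ↭-trans; ↭-reflexive)
  open import Data.List.Relation.Binary.Permutation.Propositional.Properties using (map⁺; ++⁺)
  open import Data.Product using (Σ; ∃; _×_; _,_; proj₂)
  open import Data.Sum using (_⊎_; inj₁; inj₂; [_,_]′)
  open import Data.Empty using (⊥)
  open import Data.Unit using (⊤; tt)
  open import Relation.Nullary using (¬_; Dec; yes; no; contradiction; ¬?)
  open import Relation.Binary.PropositionalEquality
  open import Function using (_∘_)

  lookup-injective : ∀ {A : Set} {xs : List A} → Unique xs → ∀ i j → List.lookup xs i ≡ List.lookup xs j → i ≡ j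
  lookup-injective (x∉ ∷ u) zero zero e = refl
  lookup-injective {xs = x ∷ xs} (x∉ ∷ u) zero (suc j) e =
      contradiction e (All.lookup x∉ (∈-lookup {xs = xs} j))
  lookup-injective {xs = x ∷ xs} (x∉ ∷ u) (suc i) zero e =
      contradiction (sym e) (All.lookup x∉ (∈-lookup {xs = xs} i))
  lookup-injective (x∉ ∷ u) (suc i) (suc j) e = cong suc (lookup-injective u i j e)

  concat-replicate-↭ : ∀ {A : Set} a {xs ys : List A} → xs ↭ ys →
      concat (replicate a xs) ↭ concat (replicate a ys)
  concat-replicate-↭ zero p = ↭-refl
  concat-replicate-↭ (suc a) p = ++⁺ p (concat-replicate-↭ a p)

  map-concat-replicate : ∀ {A B : Set} (f : A → B) a xs → map f (concat (replicate a xs)) ≡ concat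
      (replicate a (map f xs))
  map-concat-replicate f a xs =
      trans (sym (List.concat-map (replicate a xs))) (cong concat (List.map-replicate (map f) a xs))

  [1*]% : ∀ {p} .{{_ : NonZero p}} (c : Fin p) → (1 * toℕ c) % p ≡ toℕ c
  [1*]% {p} c = trans (cong (_% p) (*-identityˡ (toℕ c))) (m<n⇒m%n≡m (toℕ<n c))

  module _ {p r : ℕ} where
    zeroV : Vec (Fin (suc p)) r
    zeroV = Vec.replicate r zero

    nonZeroV? : (u : Vec (Fin (suc p)) r) → Dec (NonZeroVec u)
    nonZeroV? u = ¬? (all? (λ i → toℕ (lookup u i) ≟ 0))

    ¬NonZero⇒zeroV : ∀ {u} → ¬ NonZeroVec u → u ≡ zeroV
    ¬NonZero⇒zeroV {u} nz with all? (λ i → toℕ (lookup u i) ≟ 0)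
    ... | yes z = Vec-ext (λ i → toℕ-injective (trans (z i) (cong toℕ (sym (lookup-replicate i zero)))))
    ... | no z = contradiction z nz

    ¬NonZero-zeroV : ¬ NonZeroVec zeroV
    ¬NonZero-zeroV nz = nz (λ i → cong toℕ (lookup-replicate i zero))

    divCol-zeroV : divCol zeroV ≡ zeroCol r
    divCol-zeroV = trans (map-replicate (λ a → cst (toℕ a) (suc p)) zero r)
        (cong (Vec.replicate r) (cst-≡ 0 (suc p) 0 1 refl))

  module Binary (r : ℕ) where
    open Vectors 2

    -- Over the field with two elements each line contains a single non-zero vector, so there is
    -- nothing to choose.
    A : List (Vec (Fin 2) r)
    A = filter nonZeroV? (allVec r)

    A! : Unique A
    A! = Unique.filter⁺ nonZeroV? (allVec! r)

    A-nonzero : ∀ i → NonZeroVec (List.lookup A i)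
    A-nonzero i = proj₂ (∈-filter⁻ nonZeroV? {xs = allVec r} (∈-lookup {xs = A} i))

    isCode : IsSimplexCodeGenerator 2 r A
    isCode = A-nonzero , distinct , complete
      where
      distinct : ∀ i j → i ≢ j → ¬ ScalarMultiple (List.lookup A i) (List.lookup A j)
      distinct i j i≢j (zero , e) = A-nonzero i e
      distinct i j i≢j (suc zero , e) =
          i≢j (lookup-injective A! i j (Vec-ext λ s → toℕ-injective
          (trans (e s) ([1*]% (lookup (List.lookup A j) s)))))
      complete : ∀ w → NonZeroVec w → Σ (Fin (length A)) λ i → ScalarMultiple w (List.lookup A i)
      complete w nz = Any.index w∈ , suc zero , λ s → trans (sym ([1*]% (lookup w s)))
          (cong (λ c → (1 * toℕ (lookup c s)) % 2) (Any.lookup-index w∈))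
        where
        w∈ : w ∈ A
        w∈ = ∈-filter⁺ nonZeroV? (∈-allVec w) nz

    all↭ : allVec r ↭ A ++ List.[ zeroV ]
    all↭ = unique-↭ (allVec! r) (Unique.++⁺ A! ([] ∷ []) disj) (λ u _ → mem u (nonZeroV? u))
        (λ u _ → ∈-allVec u)
      where
      open Count (_≟V_ {r})
      disj : ∀ {u} → ¬ (u ∈ A × u ∈ List.[ zeroV ])
      disj (u∈ , here refl) = ¬NonZero-zeroV {1} {r} (proj₂ (∈-filter⁻ nonZeroV? {xs = allVec r} u∈))
      mem : ∀ u → Dec (NonZeroVec u) → u ∈ A ++ List.[ zeroV ]
      mem u (yes nz) = ∈-++⁺ˡ (∈-filter⁺ nonZeroV? (∈-allVec u) nz)
      mem u (no nz) = ∈-++⁺ʳ A (here (¬NonZero⇒zeroV nz))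

    M-b↭ : ∀ a → map (λ c → divCol c ∷ʳ cst 1 2) (concat (replicate a (allVec r))) ↭ M-b a A
    M-b↭ a = ↭-trans (↭-reflexive (map-concat-replicate F a (allVec r)))
      (concat-replicate-↭ a (↭-trans (map⁺ F all↭) (↭-reflexive (trans (List.map-++ F A _)
        (cong (λ z → map F A ++ List.[ z ∷ʳ cst 1 2 ]) (divCol-zeroV {1} {r}))))))
      where
      F : Vec (Fin 2) r → Vec ℚ (suc r)
      F c = divCol c ∷ʳ cst 1 2

  -- The first non-zero entry is 1. This selects one of `u` and `-u`, hence one vector from each
  -- line over the field with three elements.
  Lead : ∀ {r} → Vec (Fin 3) r → Set
  Lead [] = ⊥
  Lead (zero ∷ u) = Lead u
  Lead (suc zero ∷ u) = ⊤
  Lead (suc (suc zero) ∷ u) = ⊥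

  lead? : ∀ {r} (u : Vec (Fin 3) r) → Dec (Lead u)
  lead? [] = no λ ()
  lead? (zero ∷ u) = lead? u
  lead? (suc zero ∷ u) = yes tt
  lead? (suc (suc zero) ∷ u) = no λ ()

  negV : ∀ {r} → Vec (Fin 3) r → Vec (Fin 3) r
  negV = Vec.map neg3

  neg3-neg3 : ∀ a → neg3 (neg3 a) ≡ a
  neg3-neg3 zero = refl
  neg3-neg3 (suc zero) = refl
  neg3-neg3 (suc (suc zero)) = refl

  negV-negV : ∀ {r} (u : Vec (Fin 3) r) → negV (negV u) ≡ u
  negV-negV u = trans (sym (map-∘ neg3 neg3 u)) (trans (map-cong neg3-neg3 u) (map-id u))

  negV-injective : ∀ {r} {u v : Vec (Fin 3) r} → negV u ≡ negV v → u ≡ v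
  negV-injective {u = u} {v} e = trans (sym (negV-negV u)) (trans (cong negV e) (negV-negV v))

  lead-neg : ∀ {r} (u : Vec (Fin 3) r) → Lead u → ¬ Lead (negV u)
  lead-neg (zero ∷ u) l l' = lead-neg u l l'
  lead-neg (suc zero ∷ u) l ()
  lead-neg (suc (suc zero) ∷ u) ()

  lead-nonzero : ∀ {r} (u : Vec (Fin 3) r) → Lead u → NonZeroVec u
  lead-nonzero (zero ∷ u) l z = lead-nonzero u l (z ∘ suc)
  lead-nonzero (suc zero ∷ u) l z = contradiction (z zero) λ ()
  lead-nonzero (suc (suc zero) ∷ u) ()

  lead-neg-nonzero : ∀ {r} (u : Vec (Fin 3) r) → Lead (negV u) → NonZeroVec u
  lead-neg-nonzero (zero ∷ u) l z = lead-neg-nonzero u l (z ∘ suc)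
  lead-neg-nonzero (suc zero ∷ u) ()
  lead-neg-nonzero (suc (suc zero) ∷ u) l z = contradiction (z zero) λ ()

  lead-cases : ∀ {r} (u : Vec (Fin 3) r) → u ≡ zeroV ⊎ Lead u ⊎ Lead (negV u)
  lead-cases [] = inj₁ refl
  lead-cases (zero ∷ u) with lead-cases u
  ... | inj₁ e = inj₁ (cong (zero ∷_) e)
  ... | inj₂ l = inj₂ l
  lead-cases (suc zero ∷ u) = inj₂ (inj₁ tt)
  lead-cases (suc (suc zero) ∷ u) = inj₂ (inj₂ tt)

  [2*]% : ∀ (c : Fin 3) → (2 * toℕ c) % 3 ≡ toℕ (neg3 c)
  [2*]% zero = refl
  [2*]% (suc zero) = refl
  [2*]% (suc (suc zero)) = refl

  module Ternary (r : ℕ) where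
    open Vectors 3

    A : List (Vec (Fin 3) r)
    A = filter lead? (allVec r)

    A! : Unique A
    A! = Unique.filter⁺ lead? (allVec! r)

    ∈A⇒ : ∀ {u} → u ∈ A → Lead u
    ∈A⇒ u∈ = proj₂ (∈-filter⁻ lead? {xs = allVec r} u∈)

    ⇒∈A : ∀ {u} → Lead u → u ∈ A
    ⇒∈A {u} l = ∈-filter⁺ lead? (∈-allVec u) l

    isCode : IsSimplexCodeGenerator 3 r A
    isCode = (λ i → lead-nonzero (List.lookup A i) (∈A⇒ (∈-lookup {xs = A} i))) , distinct , complete
      where
      distinct : ∀ i j → i ≢ j → ¬ ScalarMultiple (List.lookup A i) (List.lookup A j)
      distinct i j i≢j (zero , e) = lead-nonzero (List.lookup A i) (∈A⇒ (∈-lookup {xs = A} i)) e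
      distinct i j i≢j (suc zero , e) =
          i≢j (lookup-injective A! i j (Vec-ext λ s → toℕ-injective
          (trans (e s) ([1*]% (lookup (List.lookup A j) s)))))
      distinct i j i≢j (suc (suc zero) , e) =
          lead-neg (List.lookup A j) (∈A⇒ (∈-lookup {xs = A} j)) (subst Lead eq (∈A⇒ (∈-lookup {xs = A} i)))
        where
        eq : List.lookup A i ≡ negV (List.lookup A j)
        eq = Vec-ext λ s → toℕ-injective (trans (e s) (trans ([2*]% (lookup (List.lookup A j) s))
            (cong toℕ (sym (lookup-map s neg3 (List.lookup A j))))))
      complete : ∀ w → NonZeroVec w → Σ (Fin (length A)) λ i → ScalarMultiple w (List.lookup A i)
      complete w nz with lead-cases w
      ... | inj₁ e = contradiction nz (subst (¬_ ∘ NonZeroVec) (sym e) (¬NonZero-zeroV {2} {r}))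
      ... | inj₂ (inj₁ l) =
          Any.index w∈ , suc zero , λ s → trans (sym ([1*]% (lookup w s)))
          (cong (λ c → (1 * toℕ (lookup c s)) % 3) (Any.lookup-index w∈))
        where
        w∈ : w ∈ A
        w∈ = ⇒∈A l
      ... | inj₂ (inj₂ l) = Any.index w∈ , suc (suc zero) , λ s →
          trans (cong toℕ (sym (trans (lookup-map s neg3 (negV w))
          (trans (cong neg3 (lookup-map s neg3 w)) (neg3-neg3 (lookup w s))))))
                      (trans (cong toℕ (lookup-map s neg3 (negV w))) (trans (sym ([2*]% (lookup (negV w) s)))
                        (cong (λ c → (2 * toℕ (lookup c s)) % 3) (Any.lookup-index w∈))))
        where
        w∈ : negV w ∈ A
        w∈ = ⇒∈A l

    -- The origin of the block `(B, -B, 0)`: equidistributed columns run `a` times through the whole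
    -- space, and the space splits in this way.
    all↭ : allVec r ↭ A ++ map negV A ++ List.[ zeroV ]
    all↭ = unique-↭ (allVec! r) (Unique.++⁺ A! (Unique.++⁺ (Unique.map⁺ negV-injective A!) ([] ∷ []) disj₁)
        disj₂) (λ u _ → mem u) (λ u _ → ∈-allVec u)
      where
      open Count (_≟V_ {r})
      disj₁ : ∀ {u} → ¬ (u ∈ map negV A × u ∈ List.[ zeroV ])
      disj₁ (u∈ , here refl) = let v , v∈ , e = ∈-map⁻ negV u∈ in
        ¬NonZero-zeroV {2} {r} (lead-neg-nonzero zeroV (subst Lead
            (trans (sym (negV-negV v)) (cong negV (sym e))) (∈A⇒ v∈)))
      disj₂ : ∀ {u} → ¬ (u ∈ A × u ∈ map negV A ++ List.[ zeroV ])
      disj₂ {u} (u∈ , u∈') with ∈-++⁻ (map negV A) u∈'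
      ... | inj₂ (here refl) = ¬NonZero-zeroV {2} {r} (lead-nonzero zeroV (∈A⇒ u∈))
      ... | inj₁ u∈'' = let v , v∈ , e = ∈-map⁻ negV u∈'' in lead-neg v (∈A⇒ v∈) (subst Lead e (∈A⇒ u∈))
      mem : ∀ u → u ∈ A ++ map negV A ++ List.[ zeroV ]
      mem u with lead-cases u
      ... | inj₁ e = ∈-++⁺ʳ A (∈-++⁺ʳ (map negV A) (here e))
      ... | inj₂ (inj₁ l) = ∈-++⁺ˡ (⇒∈A l)
      ... | inj₂ (inj₂ l) = ∈-++⁺ʳ A (∈-++⁺ˡ (subst (_∈ map negV A) (negV-negV u) (∈-map⁺ negV (⇒∈A l))))

    M-c↭ : ∀ a → map (λ c → divCol c ∷ʳ cst 1 3) (concat (replicate a (allVec r))) ↭ M-c a A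
    M-c↭ a = ↭-trans (↭-reflexive (map-concat-replicate F a (allVec r)))
      (concat-replicate-↭ a (↭-trans (map⁺ F all↭) (↭-reflexive
        (trans (List.map-++ F A _) (cong (map F A ++_) (trans (List.map-++ F (map negV A) _)
        (cong₂ _++_ (sym (List.map-∘ A)) (cong (λ z → List.[ z ∷ʳ cst 1 3 ]) (divCol-zeroV {2} {r})))))))))
      where
      F : Vec (Fin 3) r → Vec ℚ (suc r)
      F c = divCol c ∷ʳ cst 1 3

  -- After reducing `e` and `t` to residues the claim is a finite table.
  linear₂ : ∀ e t → ¬ Modular._≈_ 2 e 0 → sum {2} (λ a → ⟦ Modular._≈?_ 2 (toℕ a * e + t) 0 ⟧) ≡ 1
  linear₂ e t e≉0 =
      trans (sum-cong-≗ {2} (λ a → ind-cong (toℕ a * e + t ≈? 0) ((toℕ a * (e % 2) + t % 2) % 2 ≟ 0)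
        (λ z → ≈0⇒% (≈-trans (red a) z)) (λ z → ≈-trans (≈-sym (red a)) (%⇒≈0 z))))
          (go (e % 2) (t % 2) (m%n<n e 2) (m%n<n t 2) (e≉0 ∘ %⇒≈0))
    where
    open Modular 2
    red : ∀ a → toℕ a * (e % 2) + t % 2 ≈ toℕ {2} a * e + t
    red a = ≈-+ (≈-*ˡ (toℕ a) (≈-% e)) (≈-% t)
    go : ∀ e t → e < 2 → t < 2 → e ≢ 0 → sum {2} (λ a → ⟦ (toℕ a * e + t) % 2 ≟ 0 ⟧) ≡ 1
    go 0 _ _ _ ne = contradiction refl ne
    go 1 0 _ _ _ = refl
    go 1 1 _ _ _ = refl
    go 1 (suc (suc t)) _ (s≤s (s≤s ())) _
    go (suc (suc e)) _ (s≤s (s≤s ())) _ _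

  linear₃ : ∀ e t → ¬ Modular._≈_ 3 e 0 → sum {3} (λ a → ⟦ Modular._≈?_ 3 (toℕ a * e + t) 0 ⟧) ≡ 1
  linear₃ e t e≉0 =
      trans (sum-cong-≗ {3} (λ a → ind-cong (toℕ a * e + t ≈? 0) ((toℕ a * (e % 3) + t % 3) % 3 ≟ 0)
        (λ z → ≈0⇒% (≈-trans (red a) z)) (λ z → ≈-trans (≈-sym (red a)) (%⇒≈0 z))))
          (go (e % 3) (t % 3) (m%n<n e 3) (m%n<n t 3) (e≉0 ∘ %⇒≈0))
    where
    open Modular 3
    red : ∀ a → toℕ a * (e % 3) + t % 3 ≈ toℕ {3} a * e + t
    red a = ≈-+ (≈-*ˡ (toℕ a) (≈-% e)) (≈-% t)
    go : ∀ e t → e < 3 → t < 3 → e ≢ 0 → sum {3} (λ a → ⟦ (toℕ a * e + t) % 3 ≟ 0 ⟧) ≡ 1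
    go 0 _ _ _ ne = contradiction refl ne
    go 1 0 _ _ _ = refl
    go 1 1 _ _ _ = refl
    go 1 2 _ _ _ = refl
    go 2 0 _ _ _ = refl
    go 2 1 _ _ _ = refl
    go 2 2 _ _ _ = refl
    go (suc (suc (suc e))) _ (s≤s (s≤s (s≤s ()))) _ _
    go _ (suc (suc (suc t))) _ (s≤s (s≤s (s≤s ()))) _

  module Classify (S : Setting) (3≤m : 3 ≤ Setting.m S) (2≤k : 2 ≤ Setting.k S) where
    open Setting S
    open Core S
    open Generation S
    open Cases S

    Case-3 Case-4a Case-4b Case-6 Case-8 Case-b Case-c : Set
    Case-3 = m ≡ 3 × n ≡ 3 * k × GenBy (M-3 k)
    Case-4a = m ≡ 4 × n ≡ 3 * k × GenBy (M-4a k)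
    Case-4b = m ≡ 4 × n ≡ 4 * k × GenBy (M-4b k)
    Case-6 = m ≡ 6 × n ≡ 3 * k × GenBy (M-6 k)
    Case-8 = m ≡ 8 × n ≡ 3 * k × GenBy (M-8 k)
    Case-b = Σ ℕ λ a → Σ ℕ λ ℓ → 1 ≤ a × 3 ≤ ℓ × ¬ (a ≡ 1 × ℓ ≡ 3) ×
          k ≡ 2 ^ (ℓ ∸ 3) * a × m ≡ 2 ^ ℓ × n ≡ 2 ^ (ℓ ∸ 1) * a ×
          Σ (List (Vec (Fin 2) (ℓ ∸ 1))) λ A → IsSimplexCodeGenerator 2 (ℓ ∸ 1) A × GenBy (M-b a A)
    Case-c = Σ ℕ λ a → Σ ℕ λ ℓ → 1 ≤ a × 2 ≤ ℓ × ¬ (a ≡ 1 × ℓ ≡ 2) ×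
          k ≡ 3 ^ (ℓ ∸ 2) * a × m ≡ 3 ^ ℓ × n ≡ 3 ^ (ℓ ∸ 1) * a ×
          Σ (List (Vec (Fin 3) (ℓ ∸ 1))) λ A → IsSimplexCodeGenerator 3 (ℓ ∸ 1) A × GenBy (M-c a A)

    -- By `equi` all vectors occur equally often among the columns; `c₀` serves to name this
    -- multiplicity `a`, which becomes the number of repeated blocks.
    module Columns {p : ℕ} {{p≢0 : NonZero p}} {r : ℕ} (col : Fin n → Vec (Fin p) r)
      (c₀ : Vec (Fin p) r) (equi : ∀ c → sum (λ i → ⟦ Vectors._≟V_ p c (col i) ⟧) * p ^ r ≡ n) where
      open Vectors p
      open Count (_≟V_ {r}) public

      a : ℕ
      a = sum (λ i → ⟦ c₀ ≟V col i ⟧)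

      n≡ : n ≡ p ^ r * a
      n≡ = trans (sym (equi c₀)) (*-comm a (p ^ r))

      0<a : 0 < a
      0<a = n≢0⇒n>0 λ a≡0 → <-irrefl (sym (trans n≡ (trans (cong (p ^ r *_) a≡0) (*-zeroʳ (p ^ r))))) n>0

      cnt-col : ∀ c → cnt c (toList (tabulate col)) ≡ a
      cnt-col c = trans (cnt-tabulate c col) (*-cancelʳ-≡ _ _ (p ^ r) {{m^n≢0 p r}}
          (trans (equi c) (sym (equi c₀))))

      columns-all : toList (tabulate col) ↭ concat (replicate a (allVec r))
      columns-all = cnt-≡⇒↭ _ _ λ c → trans (cnt-col c) (sym (trans (cnt-concat-replicate c a (allVec r))
        (trans (cong (a *_) (cnt-unique c (allVec! r) (∈-allVec c))) (*-identityʳ a))))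

      mapped : ∀ {A : Set} (F : Vec (Fin p) r → A) {R : List (Vec (Fin p) r)} → toList (tabulate col) ↭ R →
          toList (tabulate (F ∘ col)) ↭ map F R
      mapped F {R} q = subst (_↭ map F R) (map-toList-tabulate F col) (map⁺ F q)

    self : h ≋ g → Case-4b ⊎ Case-b
    self h≋g = go basis
      where
      open Self h≋g
      h-const : ∀ i → h i ≡ h i₀
      h-const i = *-cancelˡ-≡ (h i) (h i₀) 2 (trans (2h≡N i) (sym (2h≡N i₀)))
      4k≡ : ∀ k → 4 * k ≡ 2 * (2 * k)
      4k≡ = solve-∀
      open Code S 2 ≤-refl linear₂ (h i₀) (2 * k) (2h≡N i₀) h-const (trans n≡4k (4k≡ k)) zeros
      go : (∃ λ r → Σ (Frame r) Frame.Spans) → Case-4b ⊎ Case-b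
      -- Rank 0 would mean `m = 2`.
      go (0 , F , sp) = contradiction (subst (3 ≤_) (Frame.spans-size F sp) 3≤m) λ { (s≤s (s≤s ())) }
      -- Rank 1 means `m = 4`: the two vectors of length 1 occur `2k` times each, which is the
      -- sporadic case of dimension `4k - 1`.
      go (1 , F , sp) =
          inj₁ (spans-size sp , n≡4k , genBy sp (↭-trans (mapped (λ c → divCol c ∷ʳ cst 1 2)
          (cnt-≡⇒↭ _ R λ c → trans (cnt-col c) (trans a≡ (sym (cntR c)))))
             (↭-reflexive (trans (List.map-++ G (replicate (2 * k) _) _)
               (cong₂ _++_ (List.map-replicate G (2 * k) _) (List.map-replicate G (2 * k) _))))))
        where
        open Frame F
        open Columns col (zero ∷ []) equidistributed
        G : Vec (Fin 2) 1 → Vec ℚ 2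
        G c = divCol c ∷ʳ cst 1 2
        R = replicate (2 * k) (suc zero ∷ []) ++ replicate (2 * k) (zero ∷ [])
        a≡ : a ≡ 2 * k
        a≡ = *-cancelˡ-≡ a (2 * k) 2 (trans (sym n≡) (trans n≡4k (4k≡ k)))
        cntR : ∀ c → cnt c R ≡ 2 * k
        cntR c = trans (cnt-++ c (replicate (2 * k) (suc zero ∷ [])) _)
            (trans (cong₂ _+_ (cnt-replicate c (2 * k) (suc zero ∷ [])) (cnt-replicate c (2 * k) (zero ∷ [])))
            (fin c))
          where
          open Vectors 2 using (_≟V_)
          fin : ∀ c → 2 * k * ⟦ c ≟V (suc zero ∷ []) ⟧ + 2 * k * ⟦ c ≟V (zero ∷ []) ⟧ ≡ 2 * k
          fin (zero ∷ []) = cong₂ _+_ (*-zeroʳ (2 * k)) (*-identityʳ (2 * k))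
          fin (suc zero ∷ []) = trans (cong₂ _+_ (*-identityʳ (2 * k)) (*-zeroʳ (2 * k))) (+-identityʳ (2 * k))
      -- `ℓ` exceeds the rank by one, since `h` supplies the last row.
      go (suc (suc r) , F , sp) =
          inj₂ (a , 3 + r , 0<a , s≤s (s≤s (s≤s z≤n)) , excl , k≡ , spans-size sp , n≡ , Binary.A (2 + r) ,
          Binary.isCode (2 + r)
          , genBy sp (↭-trans (mapped (λ c → divCol c ∷ʳ cst 1 2) columns-all) (Binary.M-b↭ (2 + r) a)))
        where
        open Frame F
        open Columns col zeroV equidistributed
        k≡ : k ≡ 2 ^ r * a
        k≡ = *-cancelˡ-≡ k (2 ^ r * a) 4 (trans (sym n≡4k) (trans n≡ (lem (2 ^ r) a)))
          where
          lem : ∀ P a → 2 * (2 * P) * a ≡ 4 * (P * a)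
          lem = solve-∀
        -- The excluded pair would give `k = 1`.
        excl : ¬ (a ≡ 1 × 3 + r ≡ 3)
        excl (a≡1 , e) =
            contradiction (subst (2 ≤_) (trans k≡ (cong₂ (λ x y → 2 ^ x * y) (+-cancelˡ-≡ 3 r 0 e) a≡1)) 2≤k)
            λ { (s≤s ()) }

    three : ¬ h ≋ g → 3 ⊡ h ≋ (λ _ → 0) → Case-3 ⊎ Case-c
    three h≉g 3h≋0 = go basis
      where
      open NonSelf h≉g
      open Three 3h≋0
      h-const : ∀ i → h i ≡ h i₀
      h-const i = *-cancelˡ-≡ (h i) (h i₀) 3 (trans (3h≡N i) (sym (3h≡N i₀)))
      open Code S 3 (s≤s (s≤s z≤n)) linear₃ (h i₀) k (3h≡N i₀) h-const n≡3k (λ o → zeros (Out⇒Other o))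
      go : (∃ λ r → Σ (Frame r) Frame.Spans) → Case-3 ⊎ Case-c
      go (0 , F , sp) =
          inj₁ (spans-size sp , n≡3k , genBy sp (↭-trans (mapped (λ c → divCol c ∷ʳ cst 1 3) columns-all)
          (↭-reflexive eq)))
        where
        open Frame F
        open Columns col [] equidistributed
        cr : ∀ {A : Set} a (x : A) → concat (replicate a List.[ x ]) ≡ replicate a x
        cr zero x = refl
        cr (suc a) x = cong (x ∷_) (cr a x)
        eq : map (λ c → divCol c ∷ʳ cst 1 3) (concat (replicate a List.[ [] ])) ≡ M-3 k
        eq = trans (cong (map (λ c → divCol c ∷ʳ cst 1 3)) (cr a []))
            (trans (List.map-replicate (λ c → divCol c ∷ʳ cst 1 3) a [])
          (cong (λ z → replicate z (col1 (cst 1 3))) (trans (sym (+-identityʳ a)) (trans (sym n≡) n≡3k))))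
      go (suc r , F , sp) =
          inj₂ (a , 2 + r , 0<a , s≤s (s≤s z≤n) , excl , k≡ , spans-size sp , n≡ , Ternary.A (1 + r) ,
          Ternary.isCode (1 + r)
          , genBy sp (↭-trans (mapped (λ c → divCol c ∷ʳ cst 1 3) columns-all) (Ternary.M-c↭ (1 + r) a)))
        where
        open Frame F
        open Columns col zeroV equidistributed
        k≡ : k ≡ 3 ^ r * a
        k≡ = *-cancelˡ-≡ k (3 ^ r * a) 3 (trans (sym n≡3k) (trans n≡ (lem (3 ^ r) a)))
          where
          lem : ∀ P a → 3 * P * a ≡ 3 * (P * a)
          lem = solve-∀
        excl : ¬ (a ≡ 1 × 2 + r ≡ 2)
        excl (a≡1 , e) =
            contradiction (subst (2 ≤_) (trans k≡ (cong₂ (λ x y → 3 ^ x * y) (+-cancelˡ-≡ 2 r 0 e) a≡1)) 2≤k)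
            λ { (s≤s ()) }

    classification : Case-3 ⊎ Case-4a ⊎ Case-4b ⊎ Case-6 ⊎ Case-8 ⊎ Case-b ⊎ Case-c
    classification with h ≋? g
    ... | yes h≋g = [ (λ c → inj₂ (inj₂ (inj₁ c))) , (λ c → inj₂ (inj₂ (inj₂ (inj₂ (inj₂ (inj₁ c)))))) ]′
        (self h≋g)
    ... | no h≉g with 3 ⊡ h ≋? (λ _ → 0)
    ...   | yes 3h = [ inj₁ , (λ c → inj₂ (inj₂ (inj₂ (inj₂ (inj₂ (inj₂ c)))))) ]′ (three h≉g 3h)
    ...   | no 3h≉0 with 4 ⊡ h ≋? (λ _ → 0)
    ...     | yes 4h = [ (λ { (m≡ , G) → inj₂ (inj₁ (m≡ , n≡3k , G)) }) ,
        (λ { (m≡ , G) → inj₂ (inj₂ (inj₂ (inj₂ (inj₁ (m≡ , n≡3k , G))))) }) ]′ (Four.result h≉g 3h≉0 4h)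
      where open NonSelf h≉g
    ...     | no 4h≉0 = let m≡ , G = Six.result h≉g 3h≉0 4h≉0 in inj₂ (inj₂ (inj₂ (inj₁ (m≡ , NonSelf.n≡3k h≉g , G))))

-- Fractions with a common denominator, integrality and rational sums.

module RationalSums where

  open import Defs
  import Data.Nat as ℕ
  open ℕ using (ℕ; zero; suc)
  import Data.Nat.Properties as ℕP
  open import Data.Integer as ℤ using (ℤ; +_; +≤+; +<+)
  import Data.Integer.Properties as ℤP
  import Data.Integer.DivMod as ℤD
  open import Data.Integer.Tactic.RingSolver using (solve-∀)
  open import Data.Rational
  open import Data.Rational.Properties
  import Data.Rational.Unnormalised as ℚᵘ
  open ℚᵘ using (mkℚᵘ; *≡*; *≤*; *<*)
  import Data.Rational.Unnormalised.Properties as ℚᵘP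
  open import Data.Rational.Solver using (module +-*-Solver)
  open import Data.Fin.Base using (Fin; zero; suc)
  open import Data.Product using (_×_; _,_)
  open import Relation.Nullary using (¬_; contradiction)
  open import Relation.Binary.PropositionalEquality
  open import Function using (_∘_)

  module _ (N : ℕ) .{{_ : ℕ.NonZero N}} where

    private
      ↯ : ∀ z N .{{_ : ℕ.NonZero N}} → toℚᵘ (z / N) ℚᵘ.≃ z ℚᵘ./ N
      ↯ z (suc N) = toℚᵘ-fromℚᵘ (mkℚᵘ z N)

    /-+ : ∀ z w → z / N + w / N ≡ (z ℤ.+ w) / N
    /-+ z w = toℚᵘ-injective (ℚᵘP.≃-trans (toℚᵘ-homo-+ (z / N) (w / N))
        (ℚᵘP.≃-trans (ℚᵘP.+-cong (↯ z N) (↯ w N)) (ℚᵘP.≃-trans (go N) (ℚᵘP.≃-sym (↯ (z ℤ.+ w) N)))))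
      where
      ring : ∀ z w n → (z ℤ.* n ℤ.+ w ℤ.* n) ℤ.* n ≡ (z ℤ.+ w) ℤ.* (n ℤ.* n)
      ring = solve-∀
      go : ∀ N .{{_ : ℕ.NonZero N}} → (z ℚᵘ./ N) ℚᵘ.+ (w ℚᵘ./ N) ℚᵘ.≃ (z ℤ.+ w) ℚᵘ./ N
      go (suc N) = *≡* (ring z w (+ suc N))

    /-* : ∀ z w → (z / N) * (w / 1) ≡ (z ℤ.* w) / N
    /-* z w = toℚᵘ-injective (ℚᵘP.≃-trans (toℚᵘ-homo-* (z / N) (w / 1))
        (ℚᵘP.≃-trans (ℚᵘP.*-cong (↯ z N) (↯ w 1)) (ℚᵘP.≃-trans (go N) (ℚᵘP.≃-sym (↯ (z ℤ.* w) N)))))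
      where
      go : ∀ N .{{_ : ℕ.NonZero N}} → (z ℚᵘ./ N) ℚᵘ.* (w ℚᵘ./ 1) ℚᵘ.≃ (z ℤ.* w) ℚᵘ./ N
      go (suc N) = *≡* (cong (z ℤ.* w ℤ.*_) (cong (λ x → + suc x) (sym (ℕP.*-identityʳ N))))

    /-neg : ∀ z → - (z / N) ≡ (ℤ.- z) / N
    /-neg z = toℚᵘ-injective (ℚᵘP.≃-trans (toℚᵘ-homo‿- (z / N))
        (ℚᵘP.≃-trans (ℚᵘP.-‿cong (↯ z N)) (ℚᵘP.≃-trans (go N) (ℚᵘP.≃-sym (↯ (ℤ.- z) N)))))
      where
      go : ∀ N .{{_ : ℕ.NonZero N}} → ℚᵘ.- (z ℚᵘ./ N) ℚᵘ.≃ (ℤ.- z) ℚᵘ./ N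
      go (suc N) = *≡* refl

    /-scale : ∀ M .{{_ : ℕ.NonZero M}} z w → z ℤ.* + M ≡ w ℤ.* + N → z / N ≡ w / M
    /-scale M z w e = toℚᵘ-injective (ℚᵘP.≃-trans (↯ z N) (ℚᵘP.≃-trans (go N M e) (ℚᵘP.≃-sym (↯ w M))))
      where
      go : ∀ N .{{_ : ℕ.NonZero N}} M .{{_ : ℕ.NonZero M}} → z ℤ.* + M ≡ w ℤ.* + N → z ℚᵘ./ N ℚᵘ.≃ w ℚᵘ./ M
      go (suc N) (suc M) e = *≡* e

    /-int : ∀ z → (z ℤ.* + N) / N ≡ ℤ→ℚ z
    /-int z = /-scale 1 (z ℤ.* + N) z (ℤP.*-identityʳ _)

    /-injective : ∀ z w → z / N ≡ w / N → z ≡ w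
    /-injective z w e = go N (ℚᵘP.≃-trans (ℚᵘP.≃-sym (↯ z N)) (ℚᵘP.≃-trans (toℚᵘ-cong e) (↯ w N)))
      where
      go : ∀ N .{{_ : ℕ.NonZero N}} → z ℚᵘ./ N ℚᵘ.≃ w ℚᵘ./ N → z ≡ w
      go (suc N) (*≡* e) = ℤP.*-cancelʳ-≡ z w (+ suc N) e

    /-mono-≤ : ∀ {z w} → z ℤ.≤ w → z / N ≤ w / N
    /-mono-≤ {z} {w} le =
        toℚᵘ-cancel-≤ (ℚᵘP.≤-respˡ-≃ (ℚᵘP.≃-sym (↯ z N)) (ℚᵘP.≤-respʳ-≃ (ℚᵘP.≃-sym (↯ w N)) (go N)))
      where
      go : ∀ N .{{_ : ℕ.NonZero N}} → z ℚᵘ./ N ℚᵘ.≤ w ℚᵘ./ N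
      go (suc N) = *≤* (ℤP.*-monoʳ-≤-nonNeg (+ suc N) le)

    /-mono-< : ∀ {z w} → z ℤ.< w → z / N < w / N
    /-mono-< {z} {w} lt =
        toℚᵘ-cancel-< (ℚᵘP.<-respˡ-≃ (ℚᵘP.≃-sym (↯ z N)) (ℚᵘP.<-respʳ-≃ (ℚᵘP.≃-sym (↯ w N)) (go N)))
      where
      go : ∀ N .{{_ : ℕ.NonZero N}} → z ℚᵘ./ N ℚᵘ.< w ℚᵘ./ N
      go (suc N) = *<* (ℤP.*-monoʳ-<-pos (+ suc N) lt)

    /-cancel-≤ : ∀ {z w} → z / N ≤ w / N → z ℤ.≤ w
    /-cancel-≤ {z} {w} le = ℤP.≮⇒≥ (λ lt → <⇒≱ (/-mono-< lt) le)
      where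
      <⇒≱ : ∀ {p q} → p < q → ¬ q ≤ p
      <⇒≱ lt le = <-irrefl refl (<-≤-trans lt le)

    /-cancel-< : ∀ {z w} → z / N < w / N → z ℤ.< w
    /-cancel-< {z} {w} lt = ℤP.≰⇒> (λ le → <-irrefl refl (<-≤-trans lt (/-mono-≤ le)))

    0/ : 0ℚ ≡ + 0 / N
    0/ = sym (0/n≡0 N)

    1/N : 1ℚ ≡ + N / N
    1/N = sym (/-scale 1 (+ N) (+ 1) (ℤP.*-comm (+ N) (+ 1)))

  ℤ→ℚ-+ : ∀ z w → ℤ→ℚ (z ℤ.+ w) ≡ ℤ→ℚ z + ℤ→ℚ w
  ℤ→ℚ-+ z w = sym (/-+ 1 z w)

  ℤ→ℚ-* : ∀ z w → ℤ→ℚ (z ℤ.* w) ≡ ℤ→ℚ z * ℤ→ℚ w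
  ℤ→ℚ-* z w = sym (/-* 1 z w)

  ℤ→ℚ-injective : ∀ {z w} → ℤ→ℚ z ≡ ℤ→ℚ w → z ≡ w
  ℤ→ℚ-injective = /-injective 1 _ _

  IsInt-+ : ∀ {p q} → IsInt p → IsInt q → IsInt (p + q)
  IsInt-+ (z , refl) (w , refl) = z ℤ.+ w , /-+ 1 z w

  IsInt-neg : ∀ {p} → IsInt p → IsInt (- p)
  IsInt-neg (z , refl) = ℤ.- z , /-neg 1 z

  IsInt-* : ∀ {p q} → IsInt p → IsInt q → IsInt (p * q)
  IsInt-* (z , refl) (w , refl) = z ℤ.* w , /-* 1 z w

  IsInt-ℤ : ∀ z → IsInt (ℤ→ℚ z)
  IsInt-ℤ z = z , refl

  IsInt-0 : IsInt 0ℚ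
  IsInt-0 = + 0 , refl

  IsInt-resp : ∀ {p q} → p ≡ q → IsInt p → IsInt q
  IsInt-resp refl i = i

  p-[p-q] : ∀ p q → p - (p - q) ≡ q
  p-[p-q] = solve 2 (λ p q → p :- (p :- q) := q) refl where open +-*-Solver

  IsInt-shift : ∀ {p q} → IsInt (p - q) → IsInt p → IsInt q
  IsInt-shift {p} {q} d i = IsInt-resp (p-[p-q] p q) (IsInt-+ i (IsInt-neg d))

  sumℚ-cong : ∀ {n} {f g : Fin n → ℚ} → (∀ i → f i ≡ g i) → sumℚ f ≡ sumℚ g
  sumℚ-cong {zero} e = refl
  sumℚ-cong {suc n} e = cong₂ _+_ (e zero) (sumℚ-cong (e ∘ suc))

  sumℚ-+ : ∀ {n} (f g : Fin n → ℚ) → sumℚ (λ i → f i + g i) ≡ sumℚ f + sumℚ g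
  sumℚ-+ {zero} f g = sym (+-identityˡ 0ℚ)
  sumℚ-+ {suc n} f g = trans (cong (λ s → f zero + g zero + s) (sumℚ-+ (f ∘ suc) (g ∘ suc)))
      (ring (f zero) (g zero) (sumℚ (f ∘ suc)) (sumℚ (g ∘ suc)))
    where
    open +-*-Solver
    ring : ∀ a b c d → a + b + (c + d) ≡ a + c + (b + d)
    ring = solve 4 (λ a b c d → a :+ b :+ (c :+ d) := a :+ c :+ (b :+ d)) refl

  sumℚ-*ˡ : ∀ {n} c (f : Fin n → ℚ) → sumℚ (λ i → c * f i) ≡ c * sumℚ f
  sumℚ-*ˡ {zero} c f = sym (*-zeroʳ c)
  sumℚ-*ˡ {suc n} c f =
      trans (cong (λ s → c * f zero + s) (sumℚ-*ˡ c (f ∘ suc))) (sym (*-distribˡ-+ c (f zero) _))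

  sumℚ-*ʳ : ∀ {n} (f : Fin n → ℚ) c → sumℚ (λ i → f i * c) ≡ sumℚ f * c
  sumℚ-*ʳ f c = trans (sumℚ-cong (λ i → *-comm (f i) c)) (trans (sumℚ-*ˡ c f) (*-comm c (sumℚ f)))

  sumℚ-0 : ∀ n → sumℚ {n} (λ _ → 0ℚ) ≡ 0ℚ
  sumℚ-0 zero = refl
  sumℚ-0 (suc n) = trans (+-identityˡ _) (sumℚ-0 n)

  sumℚ-swap : ∀ {m n} (f : Fin m → Fin n → ℚ) → sumℚ (λ i → sumℚ (f i)) ≡ sumℚ (λ j → sumℚ (λ i → f i j))
  sumℚ-swap {zero} {n} f = sym (sumℚ-0 n)
  sumℚ-swap {suc m} f =
      trans (cong (λ s → sumℚ (f zero) + s) (sumℚ-swap (f ∘ suc)))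
      (sym (sumℚ-+ (f zero) (λ j → sumℚ (λ i → f (suc i) j))))

  sumℚ-neg : ∀ {n} (f : Fin n → ℚ) → sumℚ (λ i → - f i) ≡ - sumℚ f
  sumℚ-neg f = trans (sumℚ-cong (λ i → neg1 (f i))) (trans (sumℚ-*ˡ (- 1ℚ) f) (sym (neg1 (sumℚ f))))
    where
    open +-*-Solver
    neg1 : ∀ a → - a ≡ - 1ℚ * a
    neg1 = solve 1 (λ a → :- a := :- con 1ℚ :* a) refl

  sumℚ-minus : ∀ {n} (f g : Fin n → ℚ) → sumℚ (λ i → f i - g i) ≡ sumℚ f - sumℚ g
  sumℚ-minus f g = trans (sumℚ-+ f (λ i → - g i)) (cong (λ s → sumℚ f + s) (sumℚ-neg g))

  IsInt-sum : ∀ {n} {f : Fin n → ℚ} → (∀ i → IsInt (f i)) → IsInt (sumℚ f)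
  IsInt-sum {zero} e = IsInt-0
  IsInt-sum {suc n} e = IsInt-+ (e zero) (IsInt-sum (e ∘ suc))

  sumℚ-/ : ∀ {n} N .{{_ : ℕ.NonZero N}} (f : Fin n → ℤ) → sumℚ (λ i → f i / N) ≡ sumℤ f / N
  sumℚ-/ {zero} N f = sym (0/n≡0 N)
  sumℚ-/ {suc n} N f = trans (cong (λ s → f zero / N + s) (sumℚ-/ N (f ∘ suc)))
      (/-+ N (f zero) (sumℤ (f ∘ suc)))

  sumℚ-nonneg : ∀ {n} {f : Fin n → ℚ} → (∀ i → 0ℚ ≤ f i) → 0ℚ ≤ sumℚ f
  sumℚ-nonneg {zero} e = ≤-refl
  sumℚ-nonneg {suc n} e = +-mono-≤ (e zero) (sumℚ-nonneg (e ∘ suc))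

  sumℚ-≥ : ∀ {n} {f : Fin n → ℚ} → (∀ i → 0ℚ ≤ f i) → ∀ i → f i ≤ sumℚ f
  sumℚ-≥ {suc n} {f} e zero =
      subst (_≤ sumℚ f) (+-identityʳ (f zero)) (+-monoʳ-≤ (f zero) (sumℚ-nonneg (e ∘ suc)))
  sumℚ-≥ {suc n} {f} e (suc i) =
      subst (_≤ sumℚ f) (+-identityˡ (f (suc i))) (+-mono-≤ (e zero) (sumℚ-≥ (e ∘ suc) i))

  δ : ∀ {n} → Fin n → Fin n → ℚ
  δ zero zero = 1ℚ
  δ zero (suc j) = 0ℚ
  δ (suc i) zero = 0ℚ
  δ (suc i) (suc j) = δ i j

  δ-diag : ∀ {n} (i : Fin n) → δ i i ≡ 1ℚ
  δ-diag zero = refl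
  δ-diag (suc i) = δ-diag i

  δ-off : ∀ {n} {i j : Fin n} → i ≢ j → δ i j ≡ 0ℚ
  δ-off {i = zero} {zero} ne = contradiction refl ne
  δ-off {i = zero} {suc j} ne = refl
  δ-off {i = suc i} {zero} ne = refl
  δ-off {i = suc i} {suc j} ne = δ-off (ne ∘ cong suc)

  IsInt-δ : ∀ {n} (i j : Fin n) → IsInt (δ i j)
  IsInt-δ zero zero = + 1 , refl
  IsInt-δ zero (suc j) = IsInt-0
  IsInt-δ (suc i) zero = IsInt-0
  IsInt-δ (suc i) (suc j) = IsInt-δ i j

  0≤δ : ∀ {n} (i j : Fin n) → 0ℚ ≤ δ i j
  0≤δ zero zero = nonNegative⁻¹ 1ℚ
  0≤δ zero (suc j) = ≤-refl
  0≤δ (suc i) zero = ≤-refl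
  0≤δ (suc i) (suc j) = 0≤δ i j

  sumℚ-δ* : ∀ {n} (i : Fin n) (w : Fin n → ℚ) → sumℚ (λ j → δ i j * w j) ≡ w i
  sumℚ-δ* {suc n} zero w =
      trans (cong₂ _+_ (*-identityˡ (w zero)) (trans (sumℚ-cong (λ j → *-zeroˡ (w (suc j)))) (sumℚ-0 n)))
      (+-identityʳ (w zero))
  sumℚ-δ* {suc n} (suc i) w =
      trans (cong₂ _+_ (*-zeroˡ (w zero)) (sumℚ-δ* i (w ∘ suc))) (+-identityˡ (w (suc i)))

  sumℚ-δ : ∀ {n} (i : Fin n) → sumℚ (δ i) ≡ 1ℚ
  sumℚ-δ i = trans (sumℚ-cong (λ j → sym (*-identityʳ (δ i j)))) (sumℚ-δ* i (λ _ → 1ℚ))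

  fractional : ∀ z N .{{_ : ℕ.NonZero N}} → IsInt (z / N - + (z ℤD.%ℕ N) / N)
  fractional z N = q , trans (cong (λ x → x / N - + r / N) (ℤD.a≡a%ℕn+[a/ℕn]*n z N))
     (trans (cong (_- + r / N) (sym (/-+ N (+ r) (q ℤ.* + N)))) (trans (cancel (+ r / N) _) (/-int N q)))
    where
    open +-*-Solver
    r = z ℤD.%ℕ N
    q = z ℤD./ℕ N
    cancel : ∀ a b → a + b - a ≡ b
    cancel = solve 2 (λ a b → a :+ b :- a := b) refl

  frac : ℚ → ℚ
  frac p = + (↥ p ℤD.%ℕ ↧ₙ p) / ↧ₙ p

  frac-range : ∀ p → 0ℚ ≤ frac p × frac p < 1ℚ
  frac-range p = subst (_≤ frac p) (sym (0/ D)) (/-mono-≤ D {+ 0} {+ r} (+≤+ ℕ.z≤n)) , subst (frac p <_)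
      (sym (1/N D)) (/-mono-< D {+ r} {+ D} (+<+ (ℤD.n%ℕd<d (↥ p) D)))
    where
    D = ↧ₙ p
    r = ↥ p ℤD.%ℕ D

  frac-int : ∀ p → IsInt (p - frac p)
  frac-int p = IsInt-resp (cong (_- frac p) (↥p/↧p≡p p)) (fractional (↥ p) (↧ₙ p))

-- From the Ehrhart function to the heights of the elements of Λ.

module BoxCounting where

  open Multiplicities using (module Count; Vec-ext)
  open RationalSums
  open import Defs
  import Data.Nat as ℕ
  open ℕ using (ℕ; zero; suc; _∸_)
  import Data.Nat.Properties as ℕP
  open import Data.Nat.Combinatorics using (_C_; nCk+nC[k+1]≡[n+1]C[k+1]; k>n⇒nCk≡0)
  open import Data.Integer as ℤ using (ℤ; +_)
  import Data.Integer.Properties as ℤP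
  open import Data.Integer.Tactic.RingSolver using (solve-∀)
  open import Data.Rational using (ℚ; 0ℚ; 1ℚ; _+_; _*_; _-_; -_; _≤_; _<_)
  open import Data.Rational.Properties
  open import Data.Rational.Solver using (module +-*-Solver)
  open import Data.Fin.Base using (Fin; zero; suc; toℕ; fromℕ<)
  open import Data.Fin.Properties using (toℕ-fromℕ<; toℕ-injective) renaming (_≟_ to _≟F_)
  open import Data.Vec as Vec using (Vec; lookup; tabulate)
  open import Data.Vec.Properties using (lookup∘tabulate; tabulate∘lookup; tabulate-cong; ≡-dec)
  open import Data.List as List using (List; []; _∷_; length; map; filter)
  open import Data.List.Properties using (length-map; length-tabulate; filter-none)
  open import Data.List.Membership.Propositional using (_∈_)
  open import Data.List.Membership.Propositional.Properties using
      (∈-filter⁺; ∈-filter⁻; ∈-map⁺; ∈-map⁻; ∈-tabulate⁺; ∈-tabulate⁻)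
  open import Data.List.Relation.Unary.All as All using (All)
  open import Data.List.Relation.Unary.Unique.Propositional using (Unique)
  import Data.List.Relation.Unary.Unique.Propositional.Properties as Unique
  open import Data.Product using (Σ; _×_; _,_; proj₁; proj₂)
  open import Data.Sum using (inj₁; inj₂)
  open import Relation.Nullary using (¬_; Dec; yes; no; ¬?)
  open import Relation.Binary.PropositionalEquality
  open import Function using (_∘_)

  length-filter-split : ∀ {A : Set} {P : A → Set} (P? : ∀ x → Dec (P x)) xs →
      length (filter P? xs) ℕ.+ length (filter (¬? ∘ P?) xs) ≡ length xs
  length-filter-split P? [] = refl
  length-filter-split P? (x ∷ xs) with P? x
  ... | yes _ = cong suc (length-filter-split P? xs)
  ... | no _ = trans (ℕP.+-suc _ _) (cong suc (length-filter-split P? xs))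

  -- The coefficients after multiplying a power series by `1 - t`; at index 0 nothing is subtracted.
  difference : (ℕ → ℤ) → ℕ → ℤ
  difference f zero = f zero
  difference f (suc j) = f (suc j) ℤ.- f j

  differences : ℕ → (ℕ → ℤ) → ℕ → ℤ
  differences zero f = f
  differences (suc s) f = difference (differences s f)

  sumℤ-cong : ∀ {n} {f g : Fin n → ℤ} → (∀ i → f i ≡ g i) → sumℤ f ≡ sumℤ g
  sumℤ-cong {zero} e = refl
  sumℤ-cong {suc n} e = cong₂ ℤ._+_ (e zero) (sumℤ-cong (e ∘ suc))

  sumℤ-+ : ∀ {n} (f g : Fin n → ℤ) → sumℤ (λ i → f i ℤ.+ g i) ≡ sumℤ f ℤ.+ sumℤ g
  sumℤ-+ {zero} f g = refl
  sumℤ-+ {suc n} f g = trans (cong (ℤ._+_ (f zero ℤ.+ g zero)) (sumℤ-+ (f ∘ suc) (g ∘ suc)))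
      (ring (f zero) (g zero) (sumℤ (f ∘ suc)) (sumℤ (g ∘ suc)))
    where
    ring : ∀ a b c d → a ℤ.+ b ℤ.+ (c ℤ.+ d) ≡ a ℤ.+ c ℤ.+ (b ℤ.+ d)
    ring = solve-∀

  sumℤ-neg : ∀ {n} (f : Fin n → ℤ) → sumℤ (λ i → ℤ.- f i) ≡ ℤ.- sumℤ f
  sumℤ-neg {zero} f = refl
  sumℤ-neg {suc n} f = trans (cong (ℤ._+_ (ℤ.- f zero)) (sumℤ-neg (f ∘ suc)))
      (sym (ℤP.neg-distrib-+ (f zero) (sumℤ (f ∘ suc))))

  sumℤ-0 : ∀ n → sumℤ {n} (λ _ → + 0) ≡ + 0
  sumℤ-0 zero = refl
  sumℤ-0 (suc n) = trans (ℤP.+-identityˡ _) (sumℤ-0 n)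

  signed : ℕ → (ℕ → ℤ) → ℕ → ℤ
  signed s f j = sumℤ {suc j} (λ i → signℤ (toℕ i) ℤ.* (+ (s C toℕ i)) ℤ.* f (j ∸ toℕ i))

  -- The binomial expansion of `(1 - t)^s`, by Pascal's rule. For `s = d + 1` and the Ehrhart
  -- function the right-hand side is `hstarCoeff`.
  differences≡signed : ∀ s f j → differences s f j ≡ signed s f j
  differences≡signed zero f j = sym (trans (cong₂ ℤ._+_ (ℤP.*-identityˡ (f j)) (trans (sumℤ-cong {j} (λ i →
      trans (cong (λ c → signℤ (suc (toℕ i)) ℤ.* (+ c) ℤ.* f (j ∸ suc (toℕ i)))
          (k>n⇒nCk≡0 {0} {suc (toℕ i)} ℕP.0<1+n))
        (cong (ℤ._* f (j ∸ suc (toℕ i))) (ℤP.*-zeroʳ (signℤ (suc (toℕ i))))))) (sumℤ-0 j)))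
          (ℤP.+-identityʳ (f j)))
  differences≡signed (suc s) f zero = differences≡signed s f zero
  differences≡signed (suc s) f (suc j) = begin
    differences s f (suc j) ℤ.- differences s f j ≡⟨ cong₂ ℤ._-_ (differences≡signed s f (suc j))
        (differences≡signed s f j) ⟩
    T₀ s ℤ.+ sumℤ (tail s) ℤ.- signed s f j ≡⟨ ring (T₀ s) (sumℤ (tail s)) (signed s f j) ⟩
    T₀ s ℤ.+ (sumℤ (tail s) ℤ.+ ℤ.- signed s f j) ≡⟨ cong (λ z → T₀ s ℤ.+ (sumℤ (tail s) ℤ.+ z)) (sumℤ-neg body)
        ⟨
    T₀ s ℤ.+ (sumℤ (tail s) ℤ.+ sumℤ (λ i → ℤ.- body i)) ≡⟨ cong (ℤ._+_ (T₀ s))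
        (sumℤ-+ (tail s) (λ i → ℤ.- body i)) ⟨
    T₀ s ℤ.+ sumℤ (λ i → tail s i ℤ.+ ℤ.- body i) ≡⟨ cong (ℤ._+_ (T₀ s)) (sumℤ-cong pascal) ⟩
    T₀ (suc s) ℤ.+ sumℤ (tail (suc s)) ∎
    where
    open ≡-Reasoning
    T₀ : ℕ → ℤ
    T₀ s = (+ 1) ℤ.* (+ (s C 0)) ℤ.* f (suc j)
    tail : ℕ → Fin (suc j) → ℤ
    tail s i = (ℤ.- signℤ (toℕ i)) ℤ.* (+ (s C suc (toℕ i))) ℤ.* f (j ∸ toℕ i)
    body : Fin (suc j) → ℤ
    body i = signℤ (toℕ i) ℤ.* (+ (s C toℕ i)) ℤ.* f (j ∸ toℕ i)
    ring : ∀ a b c → a ℤ.+ b ℤ.- c ≡ a ℤ.+ (b ℤ.+ ℤ.- c)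
    ring = solve-∀
    ring' : ∀ e a b x → (ℤ.- e) ℤ.* b ℤ.* x ℤ.+ ℤ.- (e ℤ.* a ℤ.* x) ≡ (ℤ.- e) ℤ.* (a ℤ.+ b) ℤ.* x
    ring' = solve-∀
    pascal : ∀ i → tail s i ℤ.+ ℤ.- body i ≡ tail (suc s) i
    pascal i = trans (ring' (signℤ (toℕ i)) (+ (s C toℕ i)) (+ (s C suc (toℕ i))) (f (j ∸ toℕ i)))
      (cong (λ c → (ℤ.- signℤ (toℕ i)) ℤ.* (+ c) ℤ.* f (j ∸ toℕ i)) (nCk+nC[k+1]≡[n+1]C[k+1] s (toℕ i)))

  record Counted {A : Set} (P : A → Set) (c : ℕ) : Set where
    field
      list : List A
      list! : Unique list
      sound : ∀ {x} → x ∈ list → P x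
      complete : ∀ {x} → P x → x ∈ list
      size : length list ≡ c

  module Ehrhart {d : ℕ} (v : Vertices d) (independent : AffinelyIndependent v) where

    Point : Set
    Point = Vec ℚ (suc d)

    coord : (Fin (suc d) → ℚ) → Fin d → ℚ
    coord x j = sumℚ (λ i → x i * ℤ→ℚ (lookup (v i) j))

    coord-+ : ∀ x y j → coord (λ i → x i + y i) j ≡ coord x j + coord y j
    coord-+ x y j = trans (sumℚ-cong (λ i → *-distribʳ-+ (ℤ→ℚ (lookup (v i) j)) (x i) (y i)))
        (sumℚ-+ (λ i → x i * ℤ→ℚ (lookup (v i) j)) (λ i → y i * ℤ→ℚ (lookup (v i) j)))

    coord-neg : ∀ x j → coord (λ i → - x i) j ≡ - coord x j
    coord-neg x j = trans (sumℚ-cong (λ i → sym (neg-distribˡ-* (x i) (ℤ→ℚ (lookup (v i) j)))))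
        (sumℚ-neg (λ i → x i * ℤ→ℚ (lookup (v i) j)))

    coord-cong : ∀ {x y} → (∀ i → x i ≡ y i) → ∀ j → coord x j ≡ coord y j
    coord-cong e j = sumℚ-cong (λ i → cong (_* ℤ→ℚ (lookup (v i) j)) (e i))

    barycentric-unique : ∀ x y → (∀ j → coord x j ≡ coord y j) → sumℚ x ≡ sumℚ y → ∀ i → x i ≡ y i
    barycentric-unique x y e s i = p-q≡0 (independent (λ i → x i - y i)
        (λ j → trans (coord-+ x (λ i → - y i) j) (trans (cong (λ z → coord x j + z) (coord-neg y j))
          (trans (cong (_- coord y j) (e j)) (+-inverseʳ (coord y j)))))
        (trans (sumℚ-minus x y) (trans (cong (_- sumℚ y) s) (+-inverseʳ (sumℚ y)))) i)
      where
      open +-*-Solver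
      p-q≡0 : ∀ {p q} → p - q ≡ 0ℚ → p ≡ q
      p-q≡0 {p} {q} e = trans (solve 2 (λ p q → p := p :- q :+ q) refl p q)
          (trans (cong (_+ q) e) (+-identityˡ q))

    -- points of nΔ ∩ ℤᵈ, in barycentric coordinates, with the first t coordinates < 1
    record Region (t n : ℕ) (x : Point) : Set where
      constructor region
      field
        nonneg : ∀ i → 0ℚ ≤ lookup x i
        below : ∀ i → toℕ i ℕ.< t → lookup x i < 1ℚ
        total : sumℚ (lookup x) ≡ ℕ→ℚ n
        integral : ∀ j → IsInt (coord (lookup x) j)
    open Region public

    -- Affine independence identifies a lattice point with its barycentric coordinates.
    base : ∀ {n c} → LatticePointCount v n c → Counted (Region 0 n) c
    base {n} {c} (f , inj , dil , compl) = record
      { list = List.tabulate point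
      ; list! = Unique.tabulate⁺ (λ {i} {j} e → inj (Vec-ext (λ l →
        ℤ→ℚ-injective (trans (sym (proj₂ (proj₂ (proj₂ (dil i))) l))
          (trans (coord-cong (λ s → trans (sym (lookup∘tabulate (w i) s))
            (trans (cong (λ z → lookup z s) e) (lookup∘tabulate (w j) s))) l)
            (proj₂ (proj₂ (proj₂ (dil j))) l))))))
      ; sound = λ x∈ → let i , e = ∈-tabulate⁻ x∈ in subst (Region 0 n) (sym e) (point-ok i)
      ; complete = λ {x} r → let y = tabulate (λ j → proj₁ (integral r j))
                                 i , e = compl y (lookup x , nonneg r , total r , λ j → trans (proj₂ (integral r j)) (cong ℤ→ℚ (sym (lookup∘tabulate (λ j → proj₁ (integral r j)) j))))
                             in subst (_∈ List.tabulate point) (Vec-ext (λ s → trans (lookup∘tabulate (w i) s)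
                                 (barycentric-unique (w i) (lookup x) (λ j → trans (proj₂
                                   (proj₂ (proj₂ (dil i))) j) (trans (cong (λ z → ℤ→ℚ (lookup z j)) e)
                                      (trans (cong ℤ→ℚ (lookup∘tabulate (λ j → proj₁ (integral r j)) j))
                                        (sym (proj₂ (integral r j))))))
                                    (trans (proj₁ (proj₂ (proj₂ (dil i)))) (sym (total r))) s)))
                                      (∈-tabulate⁺ {f = point} i)
      ; size = length-tabulate point }
      where
      w : Fin c → Fin (suc d) → ℚ
      w i = proj₁ (dil i)
      point : Fin c → Point
      point i = tabulate (w i)
      point-ok : ∀ i → Region 0 n (point i)
      point-ok i = region (λ s → subst (0ℚ ≤_) (sym (lookup∘tabulate (w i) s)) (proj₁ (proj₂ (dil i)) s))
          (λ _ ())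
        (trans (sumℚ-cong (lookup∘tabulate (w i))) (proj₁ (proj₂ (proj₂ (dil i)))))
        (λ j → lookup (f i) j , trans (coord-cong (lookup∘tabulate (w i)) j) (proj₂ (proj₂ (proj₂ (dil i))) j))

    module Step (t : ℕ) (t<n : t ℕ.< suc d) where

      iₜ : Fin (suc d)
      iₜ = fromℕ< t<n

      small? : (x : Point) → Dec (lookup x iₜ < 1ℚ)
      small? x = lookup x iₜ <? 1ℚ

      filtered : ∀ {n c} (C : Counted (Region t n) c) → Counted (Region (suc t) n)
          (length (filter small? (Counted.list C)))
      filtered {n} C = record
        { list = filter small? list
        ; list! = Unique.filter⁺ small? list!
        ; sound = λ x∈ → let x∈' , lt = ∈-filter⁻ small? {xs = list} x∈ ; r = sound x∈' in
            region (nonneg r) (λ i i≤t → below' r lt i (ℕP.m≤n⇒m<n∨m≡n (ℕ.s≤s⁻¹ i≤t))) (total r) (integral r)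
        ; complete = λ r → ∈-filter⁺ small? (complete (region (nonneg r)
          (λ i i<t → below r i (ℕP.m<n⇒m<1+n i<t)) (total r) (integral r)))
            (below r iₜ (ℕP.≤-reflexive (cong suc (toℕ-fromℕ< t<n))))
        ; size = refl }
        where
        open Counted C
        open import Data.Sum using (_⊎_)
        below' : ∀ {x} → Region t n x → lookup x iₜ < 1ℚ → ∀ i → (toℕ i ℕ.< t ⊎ toℕ i ≡ t) → lookup x i < 1ℚ
        below' r lt i (inj₁ i<t) = below r i i<t
        below' {x} r lt i (inj₂ e) =
            subst (λ s → lookup x s < 1ℚ) (toℕ-injective (trans (toℕ-fromℕ< t<n) (sym e))) lt

      private
        ℕ→ℚ-suc : ∀ n → ℕ→ℚ (suc n) ≡ ℕ→ℚ n + 1ℚ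
        ℕ→ℚ-suc n = trans (cong ℤ→ℚ (cong +_ (ℕP.+-comm 1 n))) (ℤ→ℚ-+ (+ n) (+ 1))

        p+q-q : ∀ p q → p + q - q ≡ p
        p+q-q = solve 2 (λ p q → p :+ q :- q := p) refl where open +-*-Solver

        p-q+q : ∀ p q → p - q + q ≡ p
        p-q+q = solve 2 (λ p q → p :- q :+ q := p) refl where open +-*-Solver

      up down : Point → Point
      up x = tabulate (λ i → lookup x i + δ iₜ i)
      down x = tabulate (λ i → lookup x i - δ iₜ i)

      up-down : ∀ x → up (down x) ≡ x
      up-down x = trans (tabulate-cong (λ i → trans (cong (_+ δ iₜ i)
          (lookup∘tabulate (λ i → lookup x i - δ iₜ i) i)) (p-q+q (lookup x i) (δ iₜ i)))) (tabulate∘lookup x)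

      down-up : ∀ x → down (up x) ≡ x
      down-up x = trans (tabulate-cong (λ i → trans (cong (_- δ iₜ i)
          (lookup∘tabulate (λ i → lookup x i + δ iₜ i) i)) (p+q-q (lookup x i) (δ iₜ i)))) (tabulate∘lookup x)

      coord-δ : ∀ j → coord (δ iₜ) j ≡ ℤ→ℚ (lookup (v iₜ) j)
      coord-δ j = sumℚ-δ* iₜ (λ i → ℤ→ℚ (lookup (v i) j))

      i≢iₜ : ∀ i → toℕ i ℕ.< t → iₜ ≢ i
      i≢iₜ i i<t refl = ℕP.<-irrefl (toℕ-fromℕ< t<n) i<t

      up-region : ∀ {n x} → Region t n x → Region t (suc n) (up x) × ¬ lookup (up x) iₜ < 1ℚ
      up-region {n} {x} r = region
          (λ i → subst (0ℚ ≤_) (sym (at i)) (+-mono-≤ (nonneg r i) (0≤δ iₜ i)))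
          (λ i i<t → subst (_< 1ℚ)
            (sym (trans (at i) (trans (cong (λ z → lookup x i + z) (δ-off (i≢iₜ i i<t))) (+-identityʳ _))))
            (below r i i<t))
          (trans (sumℚ-cong at) (trans (sumℚ-+ (lookup x) (δ iₜ))
            (trans (cong₂ _+_ (total r) (sumℚ-δ iₜ)) (sym (ℕ→ℚ-suc n)))))
          (λ j → IsInt-resp
            (sym (trans (coord-cong at j) (trans (coord-+ (lookup x) (δ iₜ) j)
            (cong (λ z → coord (lookup x) j + z) (coord-δ j))))) (IsInt-+ (integral r j)
            (IsInt-ℤ (lookup (v iₜ) j))))
        , λ lt → <-irrefl refl
            (<-≤-trans (subst (_< 1ℚ) (trans (at iₜ) (cong (λ z → lookup x iₜ + z) (δ-diag iₜ))) lt)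
             (subst (_≤ lookup x iₜ + 1ℚ) (+-identityˡ 1ℚ) (+-mono-≤ (nonneg r iₜ) (≤-refl {1ℚ}))))
        where
        at : ∀ i → lookup (up x) i ≡ lookup x i + δ iₜ i
        at = lookup∘tabulate (λ i → lookup x i + δ iₜ i)

      down-region : ∀ {n x} → Region t (suc n) x → ¬ lookup x iₜ < 1ℚ → Region t n (down x)
      down-region {n} {x} r big = region
          (λ i → subst (0ℚ ≤_) (sym (at i)) (nonneg' i))
          (λ i i<t → subst (_< 1ℚ)
            (sym (trans (at i) (trans (cong (λ z → lookup x i - z) (δ-off (i≢iₜ i i<t))) (+-identityʳ _))))
            (below r i i<t))
          (trans (sumℚ-cong at) (trans (sumℚ-minus (lookup x) (δ iₜ))
            (trans (cong₂ _-_ (trans (total r) (ℕ→ℚ-suc n)) (sumℚ-δ iₜ)) (p+q-q (ℕ→ℚ n) 1ℚ))))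
          (λ j → IsInt-resp
            (sym (trans (coord-cong at j) (trans (coord-+ (lookup x) (λ i → - δ iₜ i) j)
            (cong (λ z → coord (lookup x) j + z) (trans (coord-neg (δ iₜ) j) (cong -_ (coord-δ j)))))))
             (IsInt-+ (integral r j) (IsInt-neg (IsInt-ℤ (lookup (v iₜ) j)))))
        where
        at : ∀ i → lookup (down x) i ≡ lookup x i - δ iₜ i
        at = lookup∘tabulate (λ i → lookup x i - δ iₜ i)
        nonneg' : ∀ i → 0ℚ ≤ lookup x i - δ iₜ i
        nonneg' i with iₜ ≟F i
        ... | yes refl = subst (_≤ lookup x i - δ i i) (+-inverseʳ (δ i i))
            (+-mono-≤ (subst (_≤ lookup x i) (sym (δ-diag i)) (≮⇒≥ big)) (≤-refl { - δ i i}))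
        ... | no ne = subst (0ℚ ≤_) (sym (trans (cong (λ z → lookup x i - z) (δ-off ne)) (+-identityʳ _)))
            (nonneg r i)

      -- The points whose new coordinate is at least 1 are, after one copy of that vertex is taken
      -- away, the points of the preceding dilate; `up` and `down` are the two directions of this
      -- bijection.
      split : ∀ {n c c'} (C : Counted (Region t (suc n)) c) → Counted (Region t n) c' →
          length (filter small? (Counted.list C)) ℕ.+ c' ≡ c
      split {n} {c} {c'} C C' =
          trans (cong (length (filter small? list) ℕ.+_) (sym eq))
          (trans (length-filter-split small? list) size)
        where
        open Counted C
        open Counted C' using () renaming (list to list'; list! to list!'; sound to sound'; complete to
            complete'; size to size')
        open Count (≡-dec {n = suc d} _≟_)
        eq : length (filter (¬? ∘ small?) list) ≡ c'
        eq = trans (unique-length (Unique.filter⁺ (¬? ∘ small?) list!)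
            (Unique.map⁺ (λ {x} {y} e → trans (sym (down-up x)) (trans (cong down e) (down-up y))) list!')
               (λ x x∈ → let x∈' , big = ∈-filter⁻ (¬? ∘ small?) {xs = list} x∈ in
                  subst (_∈ map up list') (up-down x) (∈-map⁺ up (complete' (down-region (sound x∈') big))))
               (λ x x∈ → let y , y∈ , e = ∈-map⁻ up x∈ ; r , big = up-region (sound' y∈) in
                  subst (_∈ filter (¬? ∘ small?) list) (sym e) (∈-filter⁺ (¬? ∘ small?) (complete r) big)))
             (trans (length-map up list') size')

      -- Non-negative coordinates with sum 0 are all below 1, so nothing is filtered out.
      split₀ : ∀ {c} (C : Counted (Region t 0) c) → length (filter small? (Counted.list C)) ≡ c
      split₀ {c} C =
          trans (sym (ℕP.+-identityʳ _)) (trans (cong (length (filter small? list) ℕ.+_)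
          (sym (cong length none))) (trans (length-filter-split small? list) size))
        where
        open Counted C
        none : filter (¬? ∘ small?) list ≡ []
        none = filter-none (¬? ∘ small?) (All.tabulate (λ x∈ big → let r = sound x∈ in big
           (≤-<-trans (≤-trans (sumℚ-≥ (nonneg r) iₜ) (≤-reflexive (total r))) (positive⁻¹ 1ℚ))))

    iterate : ∀ {L} → IsEhrhartFunction v L → ∀ t → t ℕ.≤ suc d →
      Σ (ℕ → ℕ) λ Lₜ → (∀ n → Counted (Region t n) (Lₜ n)) × (∀ n → + Lₜ n ≡ differences t (λ n → + L n) n)
    iterate {L} ehr zero _ = L , (λ n → base (ehr n)) , λ n → refl
    iterate {L} ehr (suc t) t<n = L' , (λ n → filtered (C n)) , eq'
      where
      open Step t t<n
      prev = iterate ehr t (ℕP.<⇒≤ t<n)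
      Lₜ = proj₁ prev
      C = proj₁ (proj₂ prev)
      eq = proj₂ (proj₂ prev)
      L' : ℕ → ℕ
      L' n = length (filter small? (Counted.list (C n)))
      eq' : ∀ n → + L' n ≡ difference (differences t (λ n → + L n)) n
      eq' zero = trans (cong +_ (split₀ (C 0))) (eq 0)
      eq' (suc n) = trans (cancel (+ L' (suc n)) (+ Lₜ n)) (cong₂ ℤ._-_
          (trans (cong +_ (split (C (suc n)) (C n))) (eq (suc n))) (eq n))
        where
        cancel : ∀ a b → a ≡ a ℤ.+ b ℤ.- b
        cancel = solve-∀

    Box : ℕ → Point → Set
    Box = Region (suc d)

    boxes : ∀ {m k} → HasHStar v m k → Σ (ℕ → ℕ) λ c → (∀ n → Counted (Box n) (c n)) ×
        (∀ n → + c n ≡ targetCoeff m k n)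
    boxes (L , ehr , hs) = let c , C , e = iterate ehr (suc d) ℕP.≤-refl in
      c , C , λ n → trans (e n) (trans (differences≡signed (suc d) (λ n → + L n) n) (hs n))

-- Lattice pyramids and integral affine forms.

module Pyramids where

  open Multiplicities using (Vec-ext)
  open RationalSums
  open BoxCounting
  open import Defs
  import Data.Nat as ℕ
  open ℕ using (ℕ; zero; suc)
  import Data.Nat.Properties as ℕP
  open import Data.Nat.Divisibility using (divides)
  open import Data.Nat.GCD using (module Bézout; module GCD)
  open import Data.Integer as ℤ using (ℤ; +_; -[1+_])
  import Data.Integer.Properties as ℤP
  open import Data.Integer.Tactic.RingSolver using (solve-∀)
  open import Data.Rational using (ℚ; 0ℚ; 1ℚ; _+_; _*_; _-_; -_; 1/_; ≢-nonZero)
  open import Data.Rational.Properties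
  open import Data.Rational.Solver using (module +-*-Solver)
  open import Data.Fin.Base using (Fin; zero; suc; toℕ; fromℕ; punchIn; opposite)
  open import Data.Fin.Properties using (any?; opposite-involutive; toℕ-injective)
  open import Data.Vec as Vec using (Vec; []; _∷_; _∷ʳ_; lookup; tabulate; zipWith; head; replicate)
  open import Data.Vec.Properties using (lookup∘tabulate; tabulate∘lookup; tabulate-cong; lookup-zipWith;
      lookup-map; lookup-replicate)
  open import Data.Vec.Functional using (insertAt)
  open import Data.Vec.Functional.Properties using (insertAt-lookup; insertAt-punchIn)
  open import Data.Product using (Σ; ∃; _×_; _,_; proj₁; proj₂)
  open import Relation.Nullary using (¬_; yes; no; contradiction; ¬?)
  open import Relation.Binary.PropositionalEquality
  open import Function using (_∘_)

  sumℚ-remove : ∀ {n} (p : Fin (suc n)) (f : Fin (suc n) → ℚ) → sumℚ f ≡ f p + sumℚ (f ∘ punchIn p)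
  sumℚ-remove zero f = refl
  sumℚ-remove {suc n} (suc p) f =
      trans (cong (λ s → f zero + s) (sumℚ-remove p (f ∘ suc)))
      (ring (f zero) (f (suc p)) (sumℚ (f ∘ suc ∘ punchIn p)))
    where
    open +-*-Solver
    ring : ∀ a b c → a + (b + c) ≡ b + (a + c)
    ring = solve 3 (λ a b c → a :+ (b :+ c) := b :+ (a :+ c)) refl

  -- Elimination in the first column: a pivot row `p` clears it from the other rows. A relation
  -- among the reduced rows lifts by giving row `p` the coefficient `s`, chosen so that the first
  -- column cancels.
  dependent : ∀ n (M : Fin (suc n) → Fin n → ℚ) → Σ (Fin (suc n) → ℚ) λ c →
      (∃ λ i → c i ≢ 0ℚ) × (∀ j → sumℚ (λ i → c i * M i j) ≡ 0ℚ)
  dependent zero M = (λ _ → 1ℚ) , (zero , λ ()) , λ ()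
  dependent (suc n) M with any? (λ i → ¬? (M i zero ≟ 0ℚ))
  ... | no all0 = c , (suc (proj₁ (proj₁ (proj₂ ih))) , proj₂ (proj₁ (proj₂ ih))) , van
    where
    ih = dependent n (λ i j → M (suc i) (suc j))
    c : Fin (suc (suc n)) → ℚ
    c zero = 0ℚ
    c (suc i) = proj₁ ih i
    M0 : ∀ i → M i zero ≡ 0ℚ
    M0 i with M i zero ≟ 0ℚ
    ... | yes e = e
    ... | no ne = contradiction (i , ne) all0
    van : ∀ j → sumℚ (λ i → c i * M i j) ≡ 0ℚ
    van zero = trans (sumℚ-cong (λ i → trans (cong (c i *_) (M0 i)) (*-zeroʳ (c i)))) (sumℚ-0 (suc (suc n)))
    van (suc j) = trans (cong₂ _+_ (*-zeroˡ (M zero (suc j))) (proj₂ (proj₂ ih) j)) (+-identityˡ 0ℚ)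
  ... | yes (p , Mp≢0) =
      c , (punchIn p (proj₁ (proj₁ (proj₂ ih))) , λ e → proj₂ (proj₁ (proj₂ ih))
      (trans (sym (insertAt-punchIn c' p s _)) e)) , van
    where
    μ : ℚ
    μ = (1/ M p zero) {{≢-nonZero Mp≢0}}
    μMp : μ * M p zero ≡ 1ℚ
    μMp = *-inverseˡ (M p zero) {{≢-nonZero Mp≢0}}
    R : Fin (suc n) → Fin (suc n) → ℚ
    R i = M (punchIn p i)
    ih = dependent n (λ i j → R i (suc j) - R i zero * μ * M p (suc j))
    c' = proj₁ ih
    σ = sumℚ (λ i → c' i * R i zero)
    s = - (σ * μ)
    c : Fin (suc (suc n)) → ℚ
    c = insertAt c' p s
    expand : ∀ j → sumℚ (λ i → c i * M i j) ≡ s * M p j + sumℚ (λ i → c' i * R i j)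
    expand j = trans (sumℚ-remove p (λ i → c i * M i j)) (cong₂ _+_ (cong (_* M p j) (insertAt-lookup c' p s))
      (sumℚ-cong (λ i → cong (_* R i j) (insertAt-punchIn c' p s i))))
    open +-*-Solver
    ring₀ : ∀ σ μ m → (- (σ * μ)) * m + σ ≡ σ * (1ℚ - μ * m)
    ring₀ = solve 3 (λ σ μ m → (:- (σ :* μ)) :* m :+ σ := σ :* (con 1ℚ :- μ :* m)) refl
    ring₁ : ∀ c a b μ m → c * (a - b * μ * m) ≡ c * a + c * b * (- (μ * m))
    ring₁ = solve 5 (λ c a b μ m → c :* (a :- b :* μ :* m) := c :* a :+ c :* b :* (:- (μ :* m))) refl
    ring₂ : ∀ σ μ m t → (- (σ * μ)) * m + t ≡ t + σ * (- (μ * m))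
    ring₂ = solve 4 (λ σ μ m t → (:- (σ :* μ)) :* m :+ t := t :+ σ :* (:- (μ :* m))) refl
    van : ∀ j → sumℚ (λ i → c i * M i j) ≡ 0ℚ
    van zero = trans (expand zero) (trans (ring₀ σ μ (M p zero))
        (trans (cong (λ z → σ * (1ℚ - z)) μMp) (trans (cong (σ *_) (+-inverseʳ 1ℚ)) (*-zeroʳ σ))))
    van (suc j) = trans (expand (suc j)) (trans (ring₂ σ μ (M p (suc j)) _)
        (trans (cong (λ z → sumℚ (λ i → c' i * R i (suc j)) + z)
        (sym (sumℚ-*ʳ (λ i → c' i * R i zero) (- (μ * M p (suc j))))))
       (trans (sym (sumℚ-+ (λ i → c' i * R i (suc j)) (λ i → c' i * R i zero * (- (μ * M p (suc j))))))
         (trans (sumℚ-cong (λ i → sym (ring₁ (c' i) (R i (suc j)) (R i zero) μ (M p (suc j)))))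
         (proj₂ (proj₂ ih) j)))))

  _+ᵥ_ : ∀ {D} → Vec ℤ D → Vec ℤ D → Vec ℤ D
  _+ᵥ_ = zipWith ℤ._+_

  _·ᵥ_ : ∀ {D} → ℤ → Vec ℤ D → Vec ℤ D
  c ·ᵥ x = Vec.map (c ℤ.*_) x

  record Linear {D D'} (f : Vec ℤ D → Vec ℤ D') : Set where
    field
      +-homo : ∀ x y → f (x +ᵥ y) ≡ f x +ᵥ f y
      ·-homo : ∀ c x → f (c ·ᵥ x) ≡ c ·ᵥ f x
  open Linear

  -- Lattice automorphisms are built and composed as maps; only at the end are they turned into
  -- matrices, and the inverse matrix is then that of the inverse map.
  record LinIso (D : ℕ) : Set where
    field
      to from : Vec ℤ D → Vec ℤ D
      to-linear : Linear to
      from-linear : Linear from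
      to∘from : ∀ x → to (from x) ≡ x
      from∘to : ∀ x → from (to x) ≡ x

  dotℤ : ∀ {D} → Vec ℤ D → Vec ℤ D → ℤ
  dotℤ ℓ x = sumℤ (λ j → lookup ℓ j ℤ.* lookup x j)

  e : ∀ {D} → Fin D → Vec ℤ D
  e zero = + 1 ∷ replicate _ (+ 0)
  e (suc j) = + 0 ∷ e j

  lookup-e : ∀ {D} (i k : Fin D) → lookup (e k) i ≡ idMat i k
  lookup-e i k with toℕ i ℕ.≟ toℕ k
  ... | yes p = diag i k (toℕ-injective p)
    where
    diag : ∀ {D} (i k : Fin D) → i ≡ k → lookup (e k) i ≡ + 1
    diag zero zero _ = refl
    diag (suc i) (suc .i) refl = diag i i refl
  ... | no p = off i k (p ∘ cong toℕ)
    where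
    off : ∀ {D} (i k : Fin D) → i ≢ k → lookup (e k) i ≡ + 0
    off zero zero ne = contradiction refl ne
    off zero (suc k) ne = refl
    off (suc i) zero ne = lookup-replicate i (+ 0)
    off (suc i) (suc k) ne = off i k (ne ∘ cong suc)

  functional : ∀ {D} (φ : Vec ℤ D → ℤ) → (∀ x y → φ (x +ᵥ y) ≡ φ x ℤ.+ φ y) → (∀ c x → φ (c ·ᵥ x) ≡ c ℤ.* φ x)
    → ∀ x → φ x ≡ sumℤ (λ j → φ (e j) ℤ.* lookup x j)
  functional φ φ+ φ· [] = φ· (+ 0) []
  functional φ φ+ φ· (x ∷ xs) =
      trans (cong φ (cong₂ _∷_ (sym (trans (ℤP.+-identityʳ _) (ℤP.*-identityʳ x))) (Vec-ext eq)))
     (trans (φ+ (x ·ᵥ e zero) (+ 0 ∷ xs)) (cong₂ ℤ._+_ (trans (φ· x (e zero)) (ℤP.*-comm x _))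
       (functional (λ y → φ (+ 0 ∷ y)) (λ y z → φ+ (+ 0 ∷ y) (+ 0 ∷ z))
         (λ c y → trans (cong (λ a → φ (a ∷ (c ·ᵥ y))) (sym (ℤP.*-zeroʳ c))) (φ· c (+ 0 ∷ y))) xs)))
    where
    eq : ∀ i → lookup xs i ≡ lookup ((x ·ᵥ replicate _ (+ 0)) +ᵥ xs) i
    eq i = sym (trans (lookup-zipWith ℤ._+_ i (x ·ᵥ replicate _ (+ 0)) xs) (trans (cong (ℤ._+ lookup xs i)
       (trans (lookup-map i (x ℤ.*_) (replicate _ (+ 0))) (trans (cong (x ℤ.*_) (lookup-replicate i (+ 0)))
         (ℤP.*-zeroʳ x)))) (ℤP.+-identityˡ _)))

  mat : ∀ {D} → (Vec ℤ D → Vec ℤ D) → Fin D → Fin D → ℤ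
  mat f i j = lookup (f (e j)) i

  mat-apply : ∀ {D} {f : Vec ℤ D → Vec ℤ D} → Linear f → ∀ x i →
      lookup (f x) i ≡ sumℤ (λ j → mat f i j ℤ.* lookup x j)
  mat-apply {f = f} lin x i = functional (λ x → lookup (f x) i)
    (λ x y → trans (cong (λ z → lookup z i) (+-homo lin x y)) (lookup-zipWith ℤ._+_ i (f x) (f y)))
    (λ c x → trans (cong (λ z → lookup z i) (·-homo lin c x)) (lookup-map i (c ℤ.*_) (f x))) x

  module _ {D} (F : LinIso D) where
    open LinIso F

    unimodular : Unimodular (mat to)
    unimodular = mat from , (λ i k → trans (sym (mat-apply to-linear (from (e k)) i))
        (trans (cong (λ z → lookup z i) (to∘from (e k))) (lookup-e i k)))
      , (λ i k → trans (sym (mat-apply from-linear (to (e k)) i))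
          (trans (cong (λ z → lookup z i) (from∘to (e k))) (lookup-e i k)))

  -- `one` says that the matrix with rows `(α, β)` and `(-t, s)` has determinant 1. Its first row is
  -- the form `a x + n y` divided by `g`. The case `g = 0` is included; there `α` and `β` are not
  -- determined by `a` and `n`.
  record BezoutData (a : ℤ) (n : ℕ) : Set where
    field
      g : ℕ
      α β s t : ℤ
      a≡ : a ≡ + g ℤ.* α
      n≡ : + n ≡ + g ℤ.* β
      one : α ℤ.* s ℤ.+ β ℤ.* t ≡ + 1

  bezout-ℕ : ∀ m n → BezoutData (+ m) n
  bezout-ℕ m n with Bézout.lemma m n
  ... | Bézout.result zero gcd _ = record { g = 0 ; α = + 1 ; β = + 0 ; s = + 1 ; t = + 0
      ; a≡ = cong +_ (zero-div (GCD.gcd∣m gcd)) ; n≡ = cong +_ (zero-div (GCD.gcd∣n gcd)) ; one = refl }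
    where
    open import Data.Nat.Divisibility using (_∣_; 0∣⇒≡0)
    zero-div : ∀ {a} → 0 ∣ a → a ≡ 0
    zero-div = 0∣⇒≡0
  ... | Bézout.result (suc d) gcd id with GCD.gcd∣m gcd | GCD.gcd∣n gcd
  ...   | divides α refl | divides β refl = go id
    where
    D = suc d
    prod : ∀ α → + (α ℕ.* D) ≡ + D ℤ.* + α
    prod α = trans (cong +_ (ℕP.*-comm α D)) (ℤP.pos-* D α)
    cancel : ∀ x α y β → D ℕ.+ y ℕ.* (β ℕ.* D) ≡ x ℕ.* (α ℕ.* D) → 1 ℕ.+ y ℕ.* β ≡ x ℕ.* α
    cancel x α y β eq = ℕP.*-cancelʳ-≡ (1 ℕ.+ y ℕ.* β) (x ℕ.* α) D
        (trans (cong (D ℕ.+_) (ℕP.*-assoc y β D)) (trans eq (sym (ℕP.*-assoc x α D))))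
    lift : ∀ x α y β → 1 ℕ.+ y ℕ.* β ≡ x ℕ.* α → + α ℤ.* + x ℤ.+ + β ℤ.* (ℤ.- + y) ≡ + 1
    lift x α y β eq =
        trans (cong (ℤ._+ + β ℤ.* (ℤ.- + y)) (trans (ℤP.*-comm (+ α) (+ x))
        (trans (sym (ℤP.pos-* x α)) (trans (cong +_ (sym eq))
      (cong (ℤ._+_ (+ 1)) (ℤP.pos-* y β)))))) (ring (+ y) (+ β))
      where
      ring : ∀ y β → + 1 ℤ.+ y ℤ.* β ℤ.+ β ℤ.* (ℤ.- y) ≡ + 1
      ring = solve-∀
    go : Bézout.Identity D (α ℕ.* D) (β ℕ.* D) → BezoutData (+ (α ℕ.* D)) (β ℕ.* D)
    go (Bézout.+- x y eq) = record { g = D ; α = + α ; β = + β ; s = + x ; t = ℤ.- + y ; a≡ = prod α ; n≡ =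
        prod β
      ; one = lift x α y β (cancel x α y β eq) }
    go (Bézout.-+ x y eq) = record { g = D ; α = + α ; β = + β ; s = ℤ.- + x ; t = + y ; a≡ = prod α ; n≡ =
        prod β
      ; one = trans (ℤP.+-comm (+ α ℤ.* (ℤ.- + x)) (+ β ℤ.* + y)) (lift y β x α (cancel y β x α eq)) }

  bezout : ∀ a n → BezoutData a n
  bezout (+ m) n = bezout-ℕ m n
  bezout -[1+ m ] n = record { g = g ; α = ℤ.- α ; β = β ; s = ℤ.- s ; t = t ; a≡ =
      trans (cong (λ x → ℤ.- x) a≡) (ℤP.neg-distribʳ-* (+ g) α) ; n≡ = n≡
      ; one = trans (cong (ℤ._+ β ℤ.* t) (neg-neg α s)) one }
    where
    open BezoutData (bezout-ℕ (suc m) n)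
    neg-neg : ∀ a b → (ℤ.- a) ℤ.* (ℤ.- b) ≡ a ℤ.* b
    neg-neg = solve-∀

  -- A Euclidean algorithm, one coordinate at a time: on the tail the form is already `g'` times a
  -- coordinate, and the matrix of determinant 1 from `bezout a g'` merges this with the next
  -- coefficient `a`. A single negative coefficient is repaired by a sign change, so `g` is a
  -- natural number.
  straighten : ∀ D (ℓ : Vec ℤ (suc D)) → Σ (LinIso (suc D)) λ F → Σ ℕ λ g → ∀ x →
      dotℤ ℓ x ≡ + g ℤ.* head (LinIso.to F x)
  straighten zero (+ n ∷ []) = record { to = λ x → x ; from = λ x → x ; to-linear = id-linear ; from-linear =
      id-linear ; to∘from = λ _ → refl ; from∘to = λ _ → refl }
      , n , λ { (x ∷ []) → ℤP.+-identityʳ _ }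
    where
    id-linear : ∀ {D} → Linear {D} (λ x → x)
    id-linear = record { +-homo = λ _ _ → refl ; ·-homo = λ _ _ → refl }
  straighten zero (-[1+ n ] ∷ []) = record { to = neg ; from = neg ; to-linear = neg-linear ; from-linear =
      neg-linear ; to∘from = invol ; from∘to = invol }
      , suc n , λ { (x ∷ []) → trans (ℤP.+-identityʳ _) (swap (+ suc n) x) }
    where
    neg : Vec ℤ 1 → Vec ℤ 1
    neg = Vec.map (λ x → ℤ.- x)
    swap : ∀ n x → (ℤ.- n) ℤ.* x ≡ n ℤ.* (ℤ.- x)
    swap = solve-∀
    neg-linear : Linear neg
    neg-linear = record { +-homo = λ { (x ∷ []) (y ∷ []) → cong (_∷ []) (ℤP.neg-distrib-+ x y) } ; ·-homo =
        λ { c (x ∷ []) → cong (_∷ []) (ℤP.neg-distribʳ-* c x) } }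
    invol : ∀ x → neg (neg x) ≡ x
    invol (x ∷ []) = cong (_∷ []) (ℤP.neg-involutive x)
  straighten (suc D) (a ∷ ℓ) = record { to = to ; from = from ; to-linear =
      record { +-homo = to-+ ; ·-homo = to-· } ; from-linear = record { +-homo = from-+ ; ·-homo = from-· }
        ; to∘from = to-from ; from∘to = from-to }
      , g , dot≡
    where
    ih = straighten D ℓ
    open LinIso (proj₁ ih) renaming (to to to'; from to from'; to-linear to to'-linear; from-linear to
        from'-linear; to∘from to to'∘from'; from∘to to from'∘to')
    g' = proj₁ (proj₂ ih)
    open BezoutData (bezout a g')
    mix : ℤ → Vec ℤ (suc D) → Vec ℤ (suc (suc D))
    mix x (y ∷ ys) = (α ℤ.* x ℤ.+ β ℤ.* y) ∷ (s ℤ.* y ℤ.- t ℤ.* x) ∷ ys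
    to from : Vec ℤ (suc (suc D)) → Vec ℤ (suc (suc D))
    to (x ∷ xs) = mix x (to' xs)
    from (w ∷ w' ∷ ws) = (s ℤ.* w ℤ.- β ℤ.* w') ∷ from' ((t ℤ.* w ℤ.+ α ℤ.* w') ∷ ws)
    mix-+ : ∀ x x' y y' → mix (x ℤ.+ x') (y +ᵥ y') ≡ mix x y +ᵥ mix x' y'
    mix-+ x x' (y ∷ ys) (y' ∷ ys') = cong₂ _∷_ (r₁ α β x x' y y') (cong (_∷ (ys +ᵥ ys')) (r₂ s t x x' y y'))
      where
      r₁ : ∀ α β x x' y y' → α ℤ.* (x ℤ.+ x') ℤ.+ β ℤ.* (y ℤ.+ y') ≡ α ℤ.* x ℤ.+ β ℤ.* y ℤ.+
          (α ℤ.* x' ℤ.+ β ℤ.* y')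
      r₁ = solve-∀
      r₂ : ∀ s t x x' y y' → s ℤ.* (y ℤ.+ y') ℤ.- t ℤ.* (x ℤ.+ x') ≡ s ℤ.* y ℤ.- t ℤ.* x ℤ.+
          (s ℤ.* y' ℤ.- t ℤ.* x')
      r₂ = solve-∀
    mix-· : ∀ c x y → mix (c ℤ.* x) (c ·ᵥ y) ≡ c ·ᵥ mix x y
    mix-· c x (y ∷ ys) = cong₂ _∷_ (r₁ c α β x y) (cong (_∷ (c ·ᵥ ys)) (r₂ c s t x y))
      where
      r₁ : ∀ c α β x y → α ℤ.* (c ℤ.* x) ℤ.+ β ℤ.* (c ℤ.* y) ≡ c ℤ.* (α ℤ.* x ℤ.+ β ℤ.* y)
      r₁ = solve-∀
      r₂ : ∀ c s t x y → s ℤ.* (c ℤ.* y) ℤ.- t ℤ.* (c ℤ.* x) ≡ c ℤ.* (s ℤ.* y ℤ.- t ℤ.* x)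
      r₂ = solve-∀
    to-+ : ∀ x y → to (x +ᵥ y) ≡ to x +ᵥ to y
    to-+ (x ∷ xs) (y ∷ ys) =
        trans (cong (mix (x ℤ.+ y)) (+-homo to'-linear xs ys)) (mix-+ x y (to' xs) (to' ys))
    to-· : ∀ c x → to (c ·ᵥ x) ≡ c ·ᵥ to x
    to-· c (x ∷ xs) = trans (cong (mix (c ℤ.* x)) (·-homo to'-linear c xs)) (mix-· c x (to' xs))
    from-+ : ∀ x y → from (x +ᵥ y) ≡ from x +ᵥ from y
    from-+ (w ∷ w' ∷ ws) (z ∷ z' ∷ zs) =
        cong₂ _∷_ (r₁ s β w w' z z') (trans (cong (λ q → from' (q ∷ (ws +ᵥ zs))) (r₂ t α w w' z z'))
        (+-homo from'-linear (_ ∷ ws) (_ ∷ zs)))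
      where
      r₁ : ∀ s β w w' z z' → s ℤ.* (w ℤ.+ z) ℤ.- β ℤ.* (w' ℤ.+ z') ≡ s ℤ.* w ℤ.- β ℤ.* w' ℤ.+
          (s ℤ.* z ℤ.- β ℤ.* z')
      r₁ = solve-∀
      r₂ : ∀ t α w w' z z' → t ℤ.* (w ℤ.+ z) ℤ.+ α ℤ.* (w' ℤ.+ z') ≡ t ℤ.* w ℤ.+ α ℤ.* w' ℤ.+
          (t ℤ.* z ℤ.+ α ℤ.* z')
      r₂ = solve-∀
    from-· : ∀ c x → from (c ·ᵥ x) ≡ c ·ᵥ from x
    from-· c (w ∷ w' ∷ ws) =
        cong₂ _∷_ (r₁ c s β w w') (trans (cong (λ q → from' (q ∷ (c ·ᵥ ws))) (r₂ c t α w w'))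
        (·-homo from'-linear c (_ ∷ ws)))
      where
      r₁ : ∀ c s β w w' → s ℤ.* (c ℤ.* w) ℤ.- β ℤ.* (c ℤ.* w') ≡ c ℤ.* (s ℤ.* w ℤ.- β ℤ.* w')
      r₁ = solve-∀
      r₂ : ∀ c t α w w' → t ℤ.* (c ℤ.* w) ℤ.+ α ℤ.* (c ℤ.* w') ≡ c ℤ.* (t ℤ.* w ℤ.+ α ℤ.* w')
      r₂ = solve-∀
    by-one : ∀ x → (α ℤ.* s ℤ.+ β ℤ.* t) ℤ.* x ≡ x
    by-one x = trans (cong (ℤ._* x) one) (ℤP.*-identityˡ x)
    to-from : ∀ x → to (from x) ≡ x
    to-from (w ∷ w' ∷ ws) = trans (cong (mix (s ℤ.* w ℤ.- β ℤ.* w')) (to'∘from' ((t ℤ.* w ℤ.+ α ℤ.* w') ∷ ws)))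
        (cong₂ _∷_ (trans (r₁ α β s t w w') (by-one w)) (cong (_∷ ws) (trans (r₂ α β s t w w') (by-one w'))))
      where
      r₁ : ∀ α β s t w w' → α ℤ.* (s ℤ.* w ℤ.- β ℤ.* w') ℤ.+ β ℤ.* (t ℤ.* w ℤ.+ α ℤ.* w') ≡
          (α ℤ.* s ℤ.+ β ℤ.* t) ℤ.* w
      r₁ = solve-∀
      r₂ : ∀ α β s t w w' → s ℤ.* (t ℤ.* w ℤ.+ α ℤ.* w') ℤ.- t ℤ.* (s ℤ.* w ℤ.- β ℤ.* w') ≡
          (α ℤ.* s ℤ.+ β ℤ.* t) ℤ.* w'
      r₂ = solve-∀
    from-mix : ∀ x y → from (mix x y) ≡ x ∷ from' y
    from-mix x (y ∷ ys) =
        cong₂ _∷_ (trans (r₁ α β s t x y) (by-one x)) (cong (λ q → from' (q ∷ ys))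
        (trans (r₂ α β s t x y) (by-one y)))
      where
      r₁ : ∀ α β s t x y → s ℤ.* (α ℤ.* x ℤ.+ β ℤ.* y) ℤ.- β ℤ.* (s ℤ.* y ℤ.- t ℤ.* x) ≡ (α ℤ.* s ℤ.+ β ℤ.* t)
          ℤ.* x
      r₁ = solve-∀
      r₂ : ∀ α β s t x y → t ℤ.* (α ℤ.* x ℤ.+ β ℤ.* y) ℤ.+ α ℤ.* (s ℤ.* y ℤ.- t ℤ.* x) ≡ (α ℤ.* s ℤ.+ β ℤ.* t)
          ℤ.* y
      r₂ = solve-∀
    from-to : ∀ x → from (to x) ≡ x
    from-to (x ∷ xs) = trans (from-mix x (to' xs)) (cong (x ∷_) (from'∘to' xs))
    head-mix : ∀ x y → head (mix x y) ≡ α ℤ.* x ℤ.+ β ℤ.* head y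
    head-mix x (y ∷ ys) = refl
    dot≡ : ∀ x → dotℤ (a ∷ ℓ) x ≡ + g ℤ.* head (to x)
    dot≡ (x ∷ xs) =
        trans (cong₂ ℤ._+_ (cong (ℤ._* x) a≡) (trans (proj₂ (proj₂ ih) xs) (cong (ℤ._* head (to' xs)) n≡)))
       (trans (ring (+ g) α β x (head (to' xs))) (cong (+ g ℤ.*_) (sym (head-mix x (to' xs)))))
      where
      ring : ∀ g α β x y → g ℤ.* α ℤ.* x ℤ.+ g ℤ.* β ℤ.* y ≡ g ℤ.* (α ℤ.* x ℤ.+ β ℤ.* y)
      ring = solve-∀

  -- `straighten` produces a first coordinate, whereas `IsLatticePyramid` asks for the last one.
  flip : ∀ {D} → Vec ℤ D → Vec ℤ D
  flip x = tabulate (λ i → lookup x (opposite i))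

  flip-flip : ∀ {D} (x : Vec ℤ D) → flip (flip x) ≡ x
  flip-flip x =
      trans (tabulate-cong (λ i → trans (lookup∘tabulate (λ i → lookup x (opposite i)) (opposite i))
      (cong (lookup x) (opposite-involutive i)))) (tabulate∘lookup x)

  flip-linear : ∀ {D} → Linear (flip {D})
  flip-linear = record
    { +-homo = λ x y → Vec-ext (λ i → trans (at (x +ᵥ y) i) (trans (lookup-zipWith ℤ._+_ (opposite i) x y)
      (sym (trans (lookup-zipWith ℤ._+_ i (flip x) (flip y)) (cong₂ ℤ._+_ (at x i) (at y i))))))
    ; ·-homo = λ c x → Vec-ext (λ i → trans (at (c ·ᵥ x) i) (trans (lookup-map (opposite i) (c ℤ.*_) x)
      (sym (trans (lookup-map i (c ℤ.*_) (flip x)) (cong (c ℤ.*_) (at x i)))))) }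
    where
    at : ∀ {D} (x : Vec ℤ D) i → lookup (flip x) i ≡ lookup x (opposite i)
    at x i = lookup∘tabulate (λ i → lookup x (opposite i)) i

  flip-last : ∀ {D} (x : Vec ℤ (suc D)) → lookup (flip x) (fromℕ D) ≡ head x
  flip-last {D} (x ∷ xs) =
      trans (lookup∘tabulate (λ i → lookup (x ∷ xs) (opposite i)) (fromℕ D))
      (cong (lookup (x ∷ xs)) (opposite-involutive zero))

  flipped : ∀ {D} → LinIso D → LinIso D
  flipped F = record { to = flip ∘ to ; from = from ∘ flip
    ; to-linear = record { +-homo =
      λ x y → trans (cong flip (+-homo to-linear x y)) (+-homo flip-linear (to x) (to y))
                         ; ·-homo = λ c x → trans (cong flip (·-homo to-linear c x))
                           (·-homo flip-linear c (to x)) }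
    ; from-linear = record { +-homo =
      λ x y → trans (cong from (+-homo flip-linear x y)) (+-homo from-linear (flip x) (flip y))
                           ; ·-homo = λ c x → trans (cong from (·-homo flip-linear c x))
                             (·-homo from-linear c (flip x)) }
    ; to∘from = λ x → trans (cong flip (to∘from (flip x))) (flip-flip x)
    ; from∘to = λ x → trans (cong from (flip-flip (to x))) (from∘to x) }
    where open LinIso F

  lookup-∷ʳ-last : ∀ {A : Set} {D} (xs : Vec A D) x → lookup (xs ∷ʳ x) (fromℕ D) ≡ x
  lookup-∷ʳ-last [] x = refl
  lookup-∷ʳ-last (_ ∷ xs) x = lookup-∷ʳ-last xs x

  -- The factor `g` divides 1. So an integral form that attains -1 is primitive, and straightening
  -- leaves no multiplier.
  unit-factor : ∀ g z → + g ℤ.* z ≡ -[1+ 0 ] → z ≡ -[1+ 0 ]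
  unit-factor g z eq = trans (sym (ℤP.*-identityˡ z)) (trans (cong (λ n → + n ℤ.* z) (sym g≡1)) eq)
    where
    g≡1 : g ≡ 1
    g≡1 = ℕP.m*n≡1⇒m≡1 g ℤ.∣ z ∣ (trans (sym (ℤP.abs-* (+ g) z)) (cong ℤ.∣_∣ eq))

  module Solve {d : ℕ} (v : Vertices d) (independent : AffinelyIndependent v) where
    open Ehrhart v independent

    -- The target and the vertices, each extended by a coordinate (`s` and 1), are `d + 2` vectors
    -- in dimension `d + 1`, hence dependent. Affine independence forces the coefficient of the
    -- target to be non-zero, so the relation can be solved for it.
    barycentric : ∀ (b : Fin d → ℚ) (s : ℚ) → Σ (Fin (suc d) → ℚ) λ x → (∀ j → coord x j ≡ b j) × sumℚ x ≡ s
    barycentric b s =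
        (λ i → c (suc i) * ν) , (λ j → trans (sumℚ-cong (λ i → r (c (suc i)) ν (ℤ→ℚ (lookup (v i) j))))
        (trans (sumℚ-*ʳ (λ i → c (suc i) * ℤ→ℚ (lookup (v i) j)) ν)
          (solve-for (b j) (coord (c ∘ suc) j) (proj₂ (proj₂ dep) (suc j)))))
        , trans (sumℚ-*ʳ (c ∘ suc) ν) (solve-for s (sumℚ (c ∘ suc))
            (trans (cong (λ z → c zero * s + z) (sumℚ-cong (λ i → sym (*-identityʳ (c (suc i))))))
            (proj₂ (proj₂ dep) zero)))
      where
      M : Fin (suc (suc d)) → Fin (suc d) → ℚ
      M zero zero = s
      M zero (suc j) = b j
      M (suc i) zero = 1ℚ
      M (suc i) (suc j) = ℤ→ℚ (lookup (v i) j)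
      dep = dependent (suc d) M
      c = proj₁ dep
      c₀≢0 : c zero ≢ 0ℚ
      c₀≢0 c₀≡0 = contra (proj₁ (proj₂ dep))
        where
        drop : ∀ {a t} → c zero * a + t ≡ 0ℚ → t ≡ 0ℚ
        drop {a} {t} eq =
            trans (sym (+-identityˡ t)) (trans (cong (_+ t) (sym (trans (cong (_* a) c₀≡0) (*-zeroˡ a)))) eq)
        rest : ∀ i → c (suc i) ≡ 0ℚ
        rest = independent (c ∘ suc) (λ j → drop {b j} (proj₂ (proj₂ dep) (suc j)))
          (trans (sumℚ-cong (λ i → sym (*-identityʳ (c (suc i))))) (drop {s} (proj₂ (proj₂ dep) zero)))
        contra : ¬ ∃ λ i → c i ≢ 0ℚ
        contra (zero , ne) = ne c₀≡0
        contra (suc i , ne) = ne (rest i)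
      ν : ℚ
      ν = - (1/ c zero) {{≢-nonZero c₀≢0}}
      open +-*-Solver
      r : ∀ c ν w → c * ν * w ≡ c * w * ν
      r = solve 3 (λ c ν w → c :* ν :* w := c :* w :* ν) refl
      r₂ : ∀ c μ a t → t * (- μ) ≡ μ * c * a - μ * (c * a + t)
      r₂ = solve 4 (λ c μ a t → t :* (:- μ) := μ :* c :* a :- μ :* (c :* a :+ t)) refl
      solve-for : ∀ a t → c zero * a + t ≡ 0ℚ → t * ν ≡ a
      solve-for a t eq =
          trans (r₂ (c zero) μ a t)
          (trans (cong₂ _-_ (trans (cong (_* a) (*-inverseˡ (c zero) {{≢-nonZero c₀≢0}})) (*-identityˡ a))
          (trans (cong (μ *_) eq) (*-zeroʳ μ))) (+-identityʳ a))
        where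
        μ : ℚ
        μ = (1/ c zero) {{≢-nonZero c₀≢0}}

    frac-InLambda : ∀ x → (∀ j → IsInt (coord x j)) → IsInt (sumℚ x) → InLambda v (frac ∘ x)
    frac-InLambda x ij is =
        (λ i → frac-range (x i)) , (λ j → IsInt-shift (diff j) (ij j)) , IsInt-shift
        (IsInt-resp (sumℚ-minus x (frac ∘ x)) (IsInt-sum (λ i → frac-int (x i)))) is
      where
      diff : ∀ j → IsInt (coord x j - coord (frac ∘ x) j)
      diff j = IsInt-resp (trans (coord-+ x (λ i → - frac (x i)) j)
          (cong (λ z → coord x j + z) (coord-neg (frac ∘ x) j)))
        (IsInt-sum (λ i → IsInt-* (frac-int (x i)) (IsInt-ℤ (lookup (v i) j))))

  pyramid : ∀ {d} (v : Vertices (suc d)) → AffinelyIndependent v → ∀ i₀ → (∀ x → InLambda v x → x i₀ ≡ 0ℚ) →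
      IsLatticePyramid v
  pyramid {d} v independent i₀ vanish = mat to , unimodular F , b , i₀ , apex-eq , others
    where
    open Ehrhart v independent
    open Solve v independent

    -- The fractional parts of `x` belong to Λ, so the one at `i₀` is 0 by hypothesis.
    IsInt-at : ∀ x → (∀ j → IsInt (coord x j)) → IsInt (sumℚ x) → IsInt (x i₀)
    IsInt-at x ij is = IsInt-resp (trans (cong (λ z → x i₀ - z) (vanish (frac ∘ x) (frac-InLambda x ij is)))
        (+-identityʳ (x i₀))) (frac-int (x i₀))

    -- Row `j` expresses the j-th unit direction through the vertices, with coefficient sum 0. Its
    -- entry at `i₀` is therefore the j-th coefficient of the linear part of the barycentric
    -- coordinate of `i₀`.
    dual : Fin (suc d) → Fin (suc (suc d)) → ℚ
    dual j = proj₁ (barycentric (δ j) 0ℚ)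

    dual-coord : ∀ j j' → coord (dual j) j' ≡ δ j j'
    dual-coord j = proj₁ (proj₂ (barycentric (δ j) 0ℚ))

    dual-sum : ∀ j → sumℚ (dual j) ≡ 0ℚ
    dual-sum j = proj₂ (proj₂ (barycentric (δ j) 0ℚ))

    dual-int : ∀ j → IsInt (dual j i₀)
    dual-int j = IsInt-at (dual j) (λ j' → IsInt-resp (sym (dual-coord j j')) (IsInt-δ j j'))
        (IsInt-resp (sym (dual-sum j)) IsInt-0)

    ℓ : Vec ℤ (suc d)
    ℓ = tabulate (proj₁ ∘ dual-int)

    V : Fin (suc (suc d)) → Fin (suc d) → ℚ
    V a j = ℤ→ℚ (lookup (v a) j)

    -- The direction `v a - v i₀` is expanded in unit directions on one side and has coefficients
    -- `δ a - δ i₀` on the other; uniqueness of coefficients allows the comparison at `i₀`.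
    pairing : ∀ a → sumℚ (λ j → dual j i₀ * (V a j - V i₀ j)) ≡ δ a i₀ - 1ℚ
    pairing a = trans (barycentric-unique y z coords (trans sum-y (sym sum-z)) i₀)
        (cong (λ q → δ a i₀ - q) (δ-diag i₀))
      where
      y z : Fin (suc (suc d)) → ℚ
      y i = sumℚ (λ j → dual j i * (V a j - V i₀ j))
      z i = δ a i - δ i₀ i
      swap : ∀ (w : Fin (suc (suc d)) → ℚ) → sumℚ (λ i → y i * w i) ≡ sumℚ
          (λ j → sumℚ (λ i → dual j i * w i) * (V a j - V i₀ j))
      swap w = trans (sumℚ-cong (λ i → sym (sumℚ-*ʳ (λ j → dual j i * (V a j - V i₀ j)) (w i))))
          (trans (sumℚ-swap (λ i j → dual j i * (V a j - V i₀ j) * w i))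
        (sumℚ-cong (λ j → trans (sumℚ-cong (λ i → r (dual j i) (V a j - V i₀ j) (w i)))
          (sumℚ-*ʳ (λ i → dual j i * w i) (V a j - V i₀ j)))))
        where
        open +-*-Solver
        r : ∀ a b c → a * b * c ≡ a * c * b
        r = solve 3 (λ a b c → a :* b :* c := a :* c :* b) refl
      δ-sym : ∀ {n} (i j : Fin n) → δ i j ≡ δ j i
      δ-sym zero zero = refl
      δ-sym zero (suc j) = refl
      δ-sym (suc i) zero = refl
      δ-sym (suc i) (suc j) = δ-sym i j
      coords : ∀ j → coord y j ≡ coord z j
      coords j = trans (swap (λ i → V i j)) (trans (sumℚ-cong (λ j' →
          cong (_* (V a j' - V i₀ j')) (trans (dual-coord j' j) (δ-sym j' j))))
          (trans (sumℚ-δ* j (λ j' → V a j' - V i₀ j'))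
         (sym (trans (coord-+ (δ a) (λ i → - δ i₀ i) j) (cong₂ _+_ (sumℚ-δ* a (λ i → V i j))
           (trans (coord-neg (δ i₀) j) (cong -_ (sumℚ-δ* i₀ (λ i → V i j)))))))))
      sum-y : sumℚ y ≡ 0ℚ
      sum-y = trans (sumℚ-cong (λ i → sym (*-identityʳ (y i))))
          (trans (swap (λ _ → 1ℚ))
          (trans (sumℚ-cong (λ j → trans (cong (_* (V a j - V i₀ j))
          (trans (sumℚ-cong (λ i → *-identityʳ (dual j i))) (dual-sum j))) (*-zeroˡ (V a j - V i₀ j))))
          (sumℚ-0 (suc d))))
      sum-z : sumℚ z ≡ 0ℚ
      sum-z = trans (sumℚ-minus (δ a) (δ i₀)) (trans (cong₂ _-_ (sumℚ-δ a) (sumℚ-δ i₀)) (+-inverseʳ 1ℚ))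

    dotℚ : ∀ a → ℤ→ℚ (dotℤ ℓ (v a)) ≡ sumℚ (λ j → dual j i₀ * V a j)
    dotℚ a = trans (sym (sumℚ-/ 1 (λ j → lookup ℓ j ℤ.* lookup (v a) j)))
        (sumℚ-cong (λ j → trans (ℤ→ℚ-* (lookup ℓ j) (lookup (v a) j))
       (cong (_* V a j) (trans (cong ℤ→ℚ (lookup∘tabulate (proj₁ ∘ dual-int) j)) (sym (proj₂ (dual-int j)))))))

    ℓ-value : ∀ a → a ≢ i₀ → dotℤ ℓ (v a) ℤ.- dotℤ ℓ (v i₀) ≡ -[1+ 0 ]
    ℓ-value a ne = ℤ→ℚ-injective (trans (ℤ→ℚ-+ (dotℤ ℓ (v a)) (ℤ.- dotℤ ℓ (v i₀)))
        (trans (cong₂ _+_ (dotℚ a) (trans (sym (/-neg 1 (dotℤ ℓ (v i₀)))) (cong -_ (dotℚ i₀))))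
       (trans (sym (sumℚ-minus (λ j → dual j i₀ * V a j) (λ j → dual j i₀ * V i₀ j)))
         (trans (sumℚ-cong (λ j → r (dual j i₀) (V a j) (V i₀ j)))
         (trans (pairing a) (cong (_- 1ℚ) (δ-off ne)))))))
      where
      open +-*-Solver
      r : ∀ a b c → a * b - a * c ≡ a * (b - c)
      r = solve 3 (λ a b c → a :* b :- a :* c := a :* (b :- c)) refl

    st = straighten d ℓ
    F : LinIso (suc d)
    F = flipped (proj₁ st)
    open LinIso F

    apex : Vec ℤ (suc d)
    apex = replicate d (+ 0) ∷ʳ + 1

    -- The translation moves `v i₀` to the apex. From there to any other vertex the last coordinate
    -- drops by exactly 1, so the others land at height 0.
    b : Vec ℤ (suc d)
    b = tabulate (λ i → lookup apex i ℤ.- lookup (to (v i₀)) i)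

    aff-at : ∀ a i → lookup (affMap (mat to) b (v a)) i ≡ lookup (to (v a)) i ℤ.+
        (lookup apex i ℤ.- lookup (to (v i₀)) i)
    aff-at a i = trans (lookup∘tabulate (λ i → lookup (matVec (mat to) (v a)) i ℤ.+ lookup b i) i)
      (cong₂ ℤ._+_ (trans (lookup∘tabulate (λ i → sumℤ (λ j → mat to i j ℤ.* lookup (v a) j)) i)
        (sym (mat-apply to-linear (v a) i))) (lookup∘tabulate (λ i → lookup apex i ℤ.- lookup (to (v i₀)) i) i))

    apex-eq : affMap (mat to) b (v i₀) ≡ apex
    apex-eq = Vec-ext (λ i → trans (aff-at i₀ i) (cancel (lookup (to (v i₀)) i) (lookup apex i)))
      where
      cancel : ∀ x a → x ℤ.+ (a ℤ.- x) ≡ a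
      cancel = solve-∀

    others : ∀ a → a ≢ i₀ → lookup (affMap (mat to) b (v a)) (fromℕ d) ≡ + 0
    others a ne =
        trans (aff-at a (fromℕ d)) (trans (cong₂ (λ x y → x ℤ.+ (lookup apex (fromℕ d) ℤ.- y))
        (flip-last (to₀ (v a))) (flip-last (to₀ (v i₀))))
       (trans (cong (λ y → head (to₀ (v a)) ℤ.+ (y ℤ.- head (to₀ (v i₀))))
         (lookup-∷ʳ-last (replicate d (+ 0)) (+ 1)))
         (trans (ring₁ (head (to₀ (v a))) (head (to₀ (v i₀)))) (cong (ℤ._+_ (+ 1)) diff))))
      where
      to₀ = LinIso.to (proj₁ st)
      g = proj₁ (proj₂ st)
      ring₁ : ∀ x y → x ℤ.+ (+ 1 ℤ.- y) ≡ + 1 ℤ.+ (x ℤ.- y)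
      ring₁ = solve-∀
      ring₂ : ∀ g x y → g ℤ.* (x ℤ.- y) ≡ g ℤ.* x ℤ.- g ℤ.* y
      ring₂ = solve-∀
      diff : head (to₀ (v a)) ℤ.- head (to₀ (v i₀)) ≡ -[1+ 0 ]
      diff = unit-factor g _ (trans (ring₂ (+ g) (head (to₀ (v a))) (head (to₀ (v i₀))))
          (trans (cong₂ ℤ._-_ (sym (proj₂ (proj₂ st) (v a))) (sym (proj₂ (proj₂ st) (v i₀)))) (ℓ-value a ne)))

-- Clearing denominators: the group Λ as residues modulo N.

module Scaling where

  open FiniteSums using (sum; module Modular)
  open ResidueGroups
  open Multiplicities using (Vec-ext)
  open CyclicCases
  open RationalSums
  open BoxCounting
  open Pyramids using (pyramid)
  open import Defs
  import Data.Nat as ℕ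
  open ℕ using (ℕ; zero; suc; _∸_; _%_; z≤n; s≤s)
  import Data.Nat.Properties as ℕP
  import Data.Nat.DivMod as ℕD
  open import Data.Nat.Coprimality using (1-coprimeTo) renaming (sym to coprime-sym)
  open import Data.Integer as ℤ using (ℤ; +_; -[1+_]; +≤+; +<+)
  import Data.Integer.Properties as ℤP
  open import Data.Integer.Tactic.RingSolver using (solve-∀)
  open import Data.Rational using (ℚ; mkℚ; 0ℚ; 1ℚ; _+_; _*_; _-_; -_; _≤_; _<_; _/_; ↥_; ↧ₙ_)
  open import Data.Rational.Properties
  open import Data.Rational.Solver using (module +-*-Solver)
  open import Data.Fin.Base using (Fin; zero; suc)
  open import Data.Vec as Vec using (Vec; []; _∷_; lookup; tabulate; toList)
  open import Data.Vec.Properties using (lookup∘tabulate; tabulate-cong; lookup-map)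
  open import Data.List as List using (List; []; _∷_; length; _++_)
  import Data.List.Properties as List
  open import Data.List.Membership.Propositional using (_∈_; find)
  open import Data.List.Membership.Propositional.Properties using (∈-++⁻; ∈-++⁺ˡ; ∈-++⁺ʳ; ∈-map⁺; ∈-map⁻)
  open import Data.List.Relation.Unary.Any as Any using (here; there)
  import Data.List.Relation.Unary.All as All
  open import Data.List.Relation.Unary.Unique.Propositional using (Unique)
  import Data.List.Relation.Unary.Unique.Propositional.Properties as Unique
  open import Data.List.Relation.Binary.Permutation.Propositional using (_↭_)
  open import Data.Product using (Σ; ∃; _×_; _,_; proj₁; proj₂)
  open import Data.Sum using (_⊎_; inj₁; inj₂)
  open import Relation.Nullary using (¬_; yes; no; contradiction; ¬?)
  open import Relation.Binary.PropositionalEquality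
  open import Function using (_∘_)

  indicator-≡ : ∀ {a b} → a ≡ b → indicator a b ≡ + 1
  indicator-≡ {a} {b} e with a ℕ.≟ b
  ... | yes _ = refl
  ... | no ne = contradiction e ne

  indicator-≢ : ∀ {a b} → a ≢ b → indicator a b ≡ + 0
  indicator-≢ {a} {b} ne with a ℕ.≟ b
  ... | yes e = contradiction e ne
  ... | no _ = refl

  targetCoeff-values : ∀ {m k j x y z} → indicator j 0 ≡ x → indicator j k ≡ y → indicator j (2 ℕ.* k) ≡ z →
      targetCoeff m k j ≡ x ℤ.+ + (m ∸ 2) ℤ.* y ℤ.+ z
  targetCoeff-values refl refl refl = refl

  single : ∀ {A : Set} {xs : List A} → length xs ≡ 1 → ∀ {x y} → x ∈ xs → y ∈ xs → x ≡ y
  single {xs = _ ∷ []} _ (here refl) (here refl) = refl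

  cst-/ : ∀ a N .{{_ : ℕ.NonZero N}} → cst a N ≡ + a / N
  cst-/ a (suc N) = refl

  ↥-int : ∀ z → ↥ (ℤ→ℚ z) ≡ z
  ↥-int z = cong ↥_ (↥p/↧p≡p (mkℚ z 0 (coprime-sym (1-coprimeTo ℤ.∣ z ∣))))

  sumℤ-pos : ∀ {n} (f : Fin n → ℕ) → sumℤ (λ i → + f i) ≡ + sum f
  sumℤ-pos {zero} f = refl
  sumℤ-pos {suc n} f = cong (ℤ._+_ (+ f zero)) (sumℤ-pos (f ∘ suc))

  HasDenominator : ℕ → ℚ → Set
  HasDenominator N q = Σ (ℕ.NonZero N) λ nz → ∃ λ z → q ≡ (z / N) {{nz}}

  denominator-*ʳ : ∀ {N} M → ℕ.NonZero M → ∀ {q} → HasDenominator N q → HasDenominator (N ℕ.* M) q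
  denominator-*ʳ {N} M M≢0 (N≢0 , z , refl) = ℕP.m*n≢0 N M {{N≢0}} {{M≢0}} , z ℤ.* + M ,
     /-scale N {{N≢0}} (N ℕ.* M) {{ℕP.m*n≢0 N M {{N≢0}} {{M≢0}}}} z (z ℤ.* + M)
         (trans (cong (z ℤ.*_) (ℤP.pos-* N M)) (ring z (+ N) (+ M)))
    where
    ring : ∀ z n m → z ℤ.* (n ℤ.* m) ≡ z ℤ.* m ℤ.* n
    ring = solve-∀

  denominator-*ˡ : ∀ {N} M → ℕ.NonZero M → ∀ {q} → HasDenominator N q → HasDenominator (M ℕ.* N) q
  denominator-*ˡ {N} M M≢0 {q} D = subst (λ n → HasDenominator n q) (ℕP.*-comm N M) (denominator-*ʳ M M≢0 D)

  common-denominator-Vec : ∀ {r} (x : Vec ℚ r) → Σ ℕ λ N → ℕ.NonZero N × ∀ i → HasDenominator N (lookup x i)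
  common-denominator-Vec [] = 1 , _ , λ ()
  common-denominator-Vec (q ∷ x) with common-denominator-Vec x
  ... | N , N≢0 , D = ↧ₙ q ℕ.* N , ℕP.m*n≢0 (↧ₙ q) N {{_}} {{N≢0}} ,
      λ { zero → denominator-*ʳ N N≢0 (_ , ↥ q , sym (↥p/↧p≡p q)) ; (suc i) → denominator-*ˡ (↧ₙ q) _ (D i) }

  common-denominator : ∀ {r} (xs : List (Vec ℚ r)) → Σ ℕ λ N → ℕ.NonZero N × ∀ {x} → x ∈ xs → ∀ i →
      HasDenominator N (lookup x i)
  common-denominator [] = 1 , _ , λ ()
  common-denominator (x ∷ xs) with common-denominator-Vec x | common-denominator xs
  ... | N , N≢0 , D | M , M≢0 , D' =
      N ℕ.* M , ℕP.m*n≢0 N M {{N≢0}} {{M≢0}} , λ { (here refl) i → denominator-*ʳ M M≢0 (D i) ; (there x∈) i →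
      denominator-*ˡ N N≢0 (D' x∈ i) }

  -- Excludes dimension 0, to which `pyramid` does not apply: there the only coordinate would be
  -- both below 1 and equal to `n`.
  0<dimension : ∀ {d n} (x : Vec ℚ (suc d)) → (∀ i → lookup x i < 1ℚ) → sumℚ (lookup x) ≡ ℕ→ℚ n → 1 ℕ.≤ n →
      0 ℕ.< d
  0<dimension {suc d} x _ _ _ = ℕP.0<1+n
  0<dimension {zero} {n} (q ∷ []) lt tot 1≤n =
      contradiction 1≤n
      (ℕP.<⇒≱ (ℤP.drop‿+<+ (/-cancel-< 1 {+ n} {+ 1} (subst (_< 1ℚ) (trans (sym (+-identityʳ q)) tot)
      (lt zero)))))

  notApex : ∀ {d} (v : Vertices d) → AffinelyIndependent v → ¬ IsLatticePyramid v → 0 ℕ.< d → ∀ i →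
      ¬ (∀ x → InLambda v x → x i ≡ 0ℚ)
  notApex {suc d} v indep np _ i van = np (pyramid v indep i van)

  module BoxPoints (m k d : ℕ) (3≤m : 3 ℕ.≤ m) (2≤k : 2 ℕ.≤ k) (v : Vertices d) (indep : AffinelyIndependent v)
    (c : ℕ → ℕ) (C : ∀ n → Counted (Ehrhart.Box v indep n) (c n)) (c≡ : ∀ n → + c n ≡ targetCoeff m k n) where
    open Ehrhart v indep

    private
      module C n = Counted (C n)

    k>0 : 0 ℕ.< k
    k>0 = ℕP.≤-trans (s≤s z≤n) 2≤k

    k≢0 : k ≢ 0
    k≢0 e = ℕP.<-irrefl (sym e) k>0

    k<2k : k ℕ.< 2 ℕ.* k
    k<2k = ℕP.m<m+n k (ℕP.≤-trans k>0 (ℕP.m≤m+n k 0))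

    c-0 : c 0 ≡ 1
    c-0 = ℤP.+-injective
        (trans (c≡ 0) (trans (targetCoeff-values {m} {k} {0} refl (indicator-≢ (k≢0 ∘ sym))
        (indicator-≢ (λ e → ℕP.<-irrefl e (ℕP.<-trans k>0 k<2k))))
      (cong (λ z → + 1 ℤ.+ z ℤ.+ + 0) (ℤP.*-zeroʳ (+ (m ∸ 2))))))

    c-k : c k ≡ m ∸ 2
    c-k = ℤP.+-injective
        (trans (c≡ k) (trans (targetCoeff-values {m} {k} {k} (indicator-≢ k≢0) (indicator-≡ refl)
        (indicator-≢ (λ e → ℕP.<-irrefl e k<2k)))
      (trans (ℤP.+-identityʳ _) (trans (ℤP.+-identityˡ _) (ℤP.*-identityʳ _)))))

    c-2k : c (2 ℕ.* k) ≡ 1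
    c-2k = ℤP.+-injective
        (trans (c≡ (2 ℕ.* k)) (trans (targetCoeff-values {m} {k} {2 ℕ.* k}
        (indicator-≢ (λ e → ℕP.<-irrefl (sym e) (ℕP.<-trans k>0 k<2k)))
        (indicator-≢ (λ e → ℕP.<-irrefl (sym e) k<2k)) (indicator-≡ refl))
      (cong (λ z → + 0 ℤ.+ z ℤ.+ + 1) (ℤP.*-zeroʳ (+ (m ∸ 2))))))

    c-else : ∀ {n} → n ≢ 0 → n ≢ k → n ≢ 2 ℕ.* k → c n ≡ 0
    c-else {n} a b e =
        ℤP.+-injective
        (trans (c≡ n) (trans (targetCoeff-values {m} {k} {n} (indicator-≢ a) (indicator-≢ b) (indicator-≢ e))
      (cong (λ z → + 0 ℤ.+ z ℤ.+ + 0) (ℤP.*-zeroʳ (+ (m ∸ 2))))))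

    points : List Point
    points = C.list 0 ++ C.list k ++ C.list (2 ℕ.* k)

    same-height : ∀ {a b x} → Box a x → Box b x → a ≡ b
    same-height r s = ℤP.+-injective (ℤ→ℚ-injective (trans (sym (total r)) (total s)))

    points! : Unique points
    points! = Unique.++⁺ (C.list! 0) (Unique.++⁺ (C.list! k) (C.list! (2 ℕ.* k))
        (λ { (x∈ , x∈') → ℕP.<-irrefl (same-height (C.sound k x∈) (C.sound (2 ℕ.* k) x∈')) k<2k }))
      (λ { (x∈ , x∈') → disj x∈ (∈-++⁻ (C.list k) x∈') })
      where
      disj : ∀ {x} → x ∈ C.list 0 → ¬ (x ∈ C.list k ⊎ x ∈ C.list (2 ℕ.* k))
      disj x∈ (inj₁ x∈') = k≢0 (sym (same-height (C.sound 0 x∈) (C.sound k x∈')))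
      disj x∈ (inj₂ x∈') = ℕP.<-irrefl (same-height (C.sound 0 x∈) (C.sound (2 ℕ.* k) x∈'))
          (ℕP.<-trans k>0 k<2k)

    length-points : length points ≡ m
    length-points =
        trans (List.length-++ (C.list 0)) (trans (cong₂ ℕ._+_ (trans (C.size 0) c-0)
        (trans (List.length-++ (C.list k)) (cong₂ ℕ._+_ (trans (C.size k) c-k)
        (trans (C.size (2 ℕ.* k)) c-2k))))
      (trans (cong suc (ℕP.+-comm (m ∸ 2) 1)) (ℕP.m+[n∸m]≡n (ℕP.≤-trans (ℕP.n≤1+n 2) 3≤m))))

    Box⇒InLambda : ∀ {n x} → Box n x → InLambda v (lookup x)
    Box⇒InLambda {n} r = (λ i → nonneg r i , below r i (toℕ<n i)) , integral r , (+ n , total r)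
      where open import Data.Fin.Properties using (toℕ<n)

    InLambda-cong : ∀ {x y} → (∀ i → x i ≡ y i) → InLambda v x → InLambda v y
    InLambda-cong {x} {y} e (rng , int , tot) =
        (λ i → subst (0ℚ ≤_) (e i) (proj₁ (rng i)) , subst (_< 1ℚ) (e i) (proj₂ (rng i))) ,
      (λ j → IsInt-resp (coord-cong e j) (int j)) , IsInt-resp (sumℚ-cong e) tot

    InLambda⇒Box : ∀ {x} → InLambda v (lookup x) → ∃ λ n → Box n x
    InLambda⇒Box {x} (rng , int , (z , e)) = go z e
      where
      go : ∀ z → sumℚ (lookup x) ≡ ℤ→ℚ z → ∃ λ n → Box n x
      go (+ n) e = n , region (proj₁ ∘ rng) (λ i _ → proj₂ (rng i)) e int
      go -[1+ n ] e = contradiction (/-cancel-≤ 1 {+ 0} { -[1+ n ]}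
          (subst (0ℚ ≤_) e (sumℚ-nonneg (proj₁ ∘ rng)))) λ ()

    ∈points⇒Box : ∀ {x} → x ∈ points → ∃ λ n → Box n x × x ∈ C.list n × (n ≡ 0 ⊎ n ≡ 2 ℕ.* k ⊎ n ≡ k)
    ∈points⇒Box x∈ with ∈-++⁻ (C.list 0) x∈
    ... | inj₁ p = 0 , C.sound 0 p , p , inj₁ refl
    ... | inj₂ q with ∈-++⁻ (C.list k) q
    ...   | inj₁ p = k , C.sound k p , p , inj₂ (inj₂ refl)
    ...   | inj₂ p = 2 ℕ.* k , C.sound (2 ℕ.* k) p , p , inj₂ (inj₁ refl)

    ∈points⇒InLambda : ∀ {x} → x ∈ points → InLambda v (lookup x)
    ∈points⇒InLambda x∈ = Box⇒InLambda (proj₁ (proj₂ (∈points⇒Box x∈)))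

    InLambda⇒∈points : ∀ {x} → InLambda v (lookup x) → x ∈ points
    InLambda⇒∈points {x} l with InLambda⇒Box {x} l
    ... | n , r with n ℕ.≟ 0 | n ℕ.≟ k | n ℕ.≟ 2 ℕ.* k
    ... | yes refl | _ | _ = ∈-++⁺ˡ (C.complete 0 r)
    ... | no _ | yes refl | _ = ∈-++⁺ʳ (C.list 0) (∈-++⁺ˡ (C.complete k r))
    ... | no _ | no _ | yes refl = ∈-++⁺ʳ (C.list 0) (∈-++⁺ʳ (C.list k) (C.complete (2 ℕ.* k) r))
    ... | no a | no b | no e = empty (C.list n) (C.complete n r) (trans (C.size n) (c-else a b e))
      where
      empty : ∀ {A : Set} (xs : List Point) {x} → x ∈ xs → length xs ≡ 0 → A
      empty [] () _

    module Scaled (N : ℕ) {{N≢0 : ℕ.NonZero N}} (denominators : ∀ {x} → x ∈ points → ∀ i →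
        HasDenominator N (lookup x i))
      (notPyramid : ¬ IsLatticePyramid v) where
      open Modular N

      -- Defined on all rationals for convenience; it is the numerator over `N` for non-negative `q`
      -- with denominator dividing `N`, such as the coordinates of the box points.
      num : ℚ → ℕ
      num q = ℤ.∣ ↥ (q * (+ N / 1)) ∣

      num-cst : ∀ y → num (cst y N) ≡ y
      num-cst y = trans (cong (λ q → ℤ.∣ ↥ (q * (+ N / 1)) ∣) (cst-/ y N))
          (trans (cong (λ q → ℤ.∣ ↥ q ∣) (trans (/-* N (+ y) (+ N)) (/-int N (+ y))))
          (cong ℤ.∣_∣ (↥-int (+ y))))

      cst-range : ∀ {y} → y ℕ.< N → 0ℚ ≤ cst y N × cst y N < 1ℚ
      cst-range {y} y<N = subst₂ _≤_ (sym (0/ N)) (sym (cst-/ y N)) (/-mono-≤ N {+ 0} {+ y} (+≤+ z≤n)) , subst₂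
          _<_ (sym (cst-/ y N)) (sym (1/N N)) (/-mono-< N {+ y} {+ N} (+<+ y<N))

      numerator : ∀ {q z} → q ≡ z / N → 0ℚ ≤ q → q < 1ℚ → ∃ λ y → y ℕ.< N × q ≡ cst y N
      numerator {z = + y} e _ lt =
          y , ℤP.drop‿+<+ (/-cancel-< N (subst₂ _<_ e (1/N N) lt)) , trans e (sym (cst-/ y N))
      numerator {z = -[1+ n ]} e le _ =
          contradiction (/-cancel-≤ N {+ 0} { -[1+ n ]} (subst₂ _≤_ (0/ N) e le)) λ ()

      InLambda⇒cst : ∀ {x} → InLambda v x → ∀ i → num (x i) ℕ.< N × x i ≡ cst (num (x i)) N
      InLambda⇒cst {x} l i = let y , y<N , e = numerator {z = proj₁ (proj₂ den)} (proj₂ (proj₂ den)) (proj₁ (proj₁ l i)) (proj₂ (proj₁ l i))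
                                 n≡ = trans (cong num e) (num-cst y)
                             in subst (ℕ._< N) (sym n≡) y<N , trans e (cong (λ y → cst y N) (sym n≡))
        where
        den : HasDenominator N (x i)
        den = subst (HasDenominator N) (lookup∘tabulate x i) (denominators
            (InLambda⇒∈points {tabulate x} (InLambda-cong (λ i → sym (lookup∘tabulate x i)) l)) i)

      E : List (Vec ℕ (suc d))
      E = List.map (Vec.map num) points

      open Residues (suc d) N E using (Fun; InE; _≋_; _⊞_; ht)

      back : Vec ℕ (suc d) → Point
      back = Vec.map (λ y → cst y N)

      back-num : ∀ {x} → x ∈ points → back (Vec.map num x) ≡ x
      back-num {x} x∈ = Vec-ext (λ i → trans (lookup-map i (λ y → cst y N) (Vec.map num x))
          (trans (cong (λ y → cst y N) (lookup-map i num x)) (sym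
          (proj₂ (InLambda⇒cst (∈points⇒InLambda x∈) i)))))

      -- `num` forgets signs and so is not injective on ℚ; on the box points, however, `back`
      -- inverts it.
      E! : Unique E
      E! = Unique.map⁻ {f =
          back} (subst Unique (sym (trans (sym (List.map-∘ points))
          (List.map-id-local (All.tabulate back-num)))) points!)

      fraction : Fun → Fin (suc d) → ℚ
      fraction f i = cst (f i % N) N

      InE⇒ : ∀ {f} → InE f → ∃ λ x → x ∈ points × (∀ i → fraction f i ≡ lookup x i) ×
          (∀ i → f i % N ≡ num (lookup x i))
      InE⇒ {f} f∈ = let x , x∈ , e = ∈-map⁻ (Vec.map num) f∈
                        at = λ i → trans (sym (lookup∘tabulate (λ i → f i % N) i)) (trans (cong (λ y → lookup y i) e) (lookup-map i num x))
        in x , x∈ , (λ i → trans (cong (λ y → cst y N) (at i)) (sym (proj₂ (InLambda⇒cst (∈points⇒InLambda x∈) i)))) , at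

      InE⇒InLambda : ∀ {f} → InE f → InLambda v (fraction f)
      InE⇒InLambda f∈ = let x , x∈ , e , _ = InE⇒ f∈ in InLambda-cong (λ i → sym (e i)) (∈points⇒InLambda x∈)

      InLambda⇒InE : ∀ {f} → InLambda v (fraction f) → InE f
      InLambda⇒InE {f} l =
          subst (_∈ E) (Vec-ext (λ i → trans (lookup-map i num x)
          (trans (cong num (lookup∘tabulate (fraction f) i)) (trans (num-cst (f i % N))
          (sym (lookup∘tabulate (λ i → f i % N) i))))))
          (∈-map⁺ (Vec.map num) (InLambda⇒∈points {x} (InLambda-cong
            (λ i → sym (lookup∘tabulate (fraction f) i)) l)))
        where x = tabulate (fraction f)

      num-InE : ∀ {x} → InLambda v x → InE (num ∘ x)
      num-InE {x} l =
          InLambda⇒InE (InLambda-cong (λ i → trans (proj₂ (InLambda⇒cst l i))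
          (cong (λ y → cst y N) (sym (ℕD.m<n⇒m%n≡m (proj₁ (InLambda⇒cst l i)))))) l)

      cst-+ : ∀ a b → cst a N + cst b N ≡ cst (a ℕ.+ b) N
      cst-+ a b = trans (cong₂ _+_ (cst-/ a N) (cst-/ b N)) (trans (/-+ N (+ a) (+ b))
          (sym (cst-/ (a ℕ.+ b) N)))

      cst-% : ∀ a → IsInt (cst a N - cst (a % N) N)
      cst-% a = IsInt-resp (cong₂ _-_ (sym (cst-/ a N)) (sym (cst-/ (a % N) N))) (fractional (+ a) N)

      cst-≈ : ∀ {a b} → a ≈ b → IsInt (cst a N - cst b N)
      cst-≈ {a} {b} e =
          IsInt-resp (trans (cong (λ y → cst a N - cst (a % N) N - (cst b N - cst y N)) (sym (un e)))
          (ring (cst a N) (cst (a % N) N) (cst b N))) (IsInt-+ (cst-% a) (IsInt-neg (cst-% b)))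
        where
        open +-*-Solver
        ring : ∀ a r b → a - r - (b - r) ≡ a - b
        ring = solve 3 (λ a r b → a :- r :- (b :- r) := a :- b) refl

      InLambda-shift : ∀ {x y} → (∀ i → 0ℚ ≤ y i × y i < 1ℚ) → (∀ i → IsInt (x i - y i)) →
          (∀ j → IsInt (coord x j)) → IsInt (sumℚ x) → InLambda v y
      InLambda-shift {x} {y} rng diff int tot =
          rng , (λ j → IsInt-shift (IsInt-resp (trans (coord-+ x (λ i → - y i) j)
          (cong (λ z → coord x j + z) (coord-neg y j)))
          (IsInt-sum (λ i → IsInt-* (diff i) (IsInt-ℤ (lookup (v i) j))))) (int j)) , IsInt-shift
            (IsInt-resp (sumℚ-minus x y) (IsInt-sum diff)) tot

      add : ∀ {f g} → InE f → InE g → InE (f ⊞ g)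
      add {f} {g} f∈ g∈ = InLambda⇒InE (InLambda-shift {λ i → fraction f i + fraction g i}
          (λ i → cst-range (ℕD.m%n<n (f i ℕ.+ g i) N))
          (λ i → IsInt-resp (cong (_- cst ((f i ℕ.+ g i) % N) N) (sym (cst-+ (f i % N) (g i % N))))
            (cst-≈ (≈-trans (≈-+ (≈-% (f i)) (≈-% (g i))) (≈-sym (≈-% (f i ℕ.+ g i))))))
          (λ j → IsInt-resp (sym (coord-+ (fraction f) (fraction g) j))
            (IsInt-+ (proj₁ (proj₂ lf) j) (proj₁ (proj₂ lg) j)))
          (IsInt-resp (sym (sumℚ-+ (fraction f) (fraction g))) (IsInt-+ (proj₂ (proj₂ lf)) (proj₂ (proj₂ lg)))))
        where
        lf = InE⇒InLambda {f} f∈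
        lg = InE⇒InLambda {g} g∈

      cst-0 : cst 0 N ≡ 0ℚ
      cst-0 = trans (cst-/ 0 N) (sym (0/ N))

      0∈ : InE (λ _ → 0)
      0∈ = InLambda⇒InE (InLambda-cong (λ i → sym z) ((λ i → ≤-refl , positive⁻¹ 1ℚ) ,
          (λ j → IsInt-sum (λ i → IsInt-* IsInt-0 (IsInt-ℤ (lookup (v i) j)))) , IsInt-sum {suc d}
          (λ _ → IsInt-0)))
        where
        z : cst (0 % N) N ≡ 0ℚ
        z = trans (cong (λ y → cst y N) 0%N) cst-0

      height : ∀ {n x} {f : Fin (suc d) → ℕ} → Box n x → (∀ i → lookup x i ≡ cst (f i) N) → sum f ≡ N ℕ.* n
      height {n} {x} {f} r e =
          ℤP.+-injective (/-injective N (+ sum f) (+ (N ℕ.* n)) (trans (cong (_/ N) (sym (sumℤ-pos f)))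
          (trans (sym (sumℚ-/ N (λ i → + f i)))
         (trans (sumℚ-cong (λ i → trans (sym (cst-/ (f i) N)) (sym (e i))))
           (trans (total r) (trans (sym (/-int N (+ n))) (cong (_/ N)
           (trans (sym (ℤP.pos-* n N)) (cong +_ (ℕP.*-comm n N))))))))))

      top : ∃ (_∈ C.list (2 ℕ.* k))
      top = nonempty (C.list (2 ℕ.* k)) (trans (C.size (2 ℕ.* k)) c-2k)
        where
        nonempty : ∀ (xs : List Point) → length xs ≡ 1 → ∃ (_∈ xs)
        nonempty (x ∷ xs) _ = x , here refl

      top-Box : Box (2 ℕ.* k) (proj₁ top)
      top-Box = C.sound (2 ℕ.* k) (proj₂ top)

      g : Fun
      g i = num (lookup (proj₁ top) i)

      g-cst : ∀ i → g i ℕ.< N × lookup (proj₁ top) i ≡ cst (g i) N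
      g-cst = InLambda⇒cst (Box⇒InLambda top-Box)

      -- The box count 1 at height `2k` leaves only `g` there, and at height 0 non-negative
      -- coordinates with sum 0 vanish.
      hts : ∀ f → InE f → f ≋ (λ _ → 0) ⊎ f ≋ g ⊎ ht f ≡ N ℕ.* k
      hts f f∈ = let x , x∈ , e , e' = InE⇒ {f} f∈ ; n , r , x∈n , cases = ∈points⇒Box x∈ in go x e e' n r x∈n cases
        where
        go : ∀ x → (∀ i → fraction f i ≡ lookup x i) → (∀ i → f i % N ≡ num (lookup x i)) → ∀ n → Box n x →
            x ∈ C.list n → (n ≡ 0 ⊎ n ≡ 2 ℕ.* k ⊎ n ≡ k)
          → f ≋ (λ _ → 0) ⊎ f ≋ g ⊎ ht f ≡ N ℕ.* k
        go x e e' n r x∈n (inj₂ (inj₂ refl)) = inj₂ (inj₂ (height r (λ i → sym (e i))))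
        go x e e' n r x∈n (inj₂ (inj₁ refl)) =
            inj₂ (inj₁ (λ i →
            mk (trans (e' i) (trans (cong (λ y → num (lookup y i))
            (single (trans (C.size (2 ℕ.* k)) c-2k) x∈n (proj₂ top)))
           (sym (ℕD.m<n⇒m%n≡m (proj₁ (g-cst i))))))))
        go x e e' n r x∈n (inj₁ refl) =
            inj₁ (λ i → %⇒≈0 (ℕP.n≤0⇒n≡0 (ℕP.≤-trans (sum-≥ (λ i → f i % N) i)
            (ℕP.≤-reflexive (trans (height r (λ i → sym (e i))) (ℕP.*-zeroʳ N))))))
          where open FiniteSums using (sum-≥)

      -- Otherwise `pyramid` would apply with apex `v i`.
      full : ∀ i → ∃ λ f → InE f × ¬ f i ≈ 0
      full i with Any.any? (λ x → ¬? (lookup x i ≟ 0ℚ)) points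
      ... | yes p = let x , x∈ , ne = find p ; l = ∈points⇒InLambda x∈ ; lt , eq = InLambda⇒cst l i in
           num ∘ lookup x , num-InE l , λ z →
               ne (trans eq (trans (cong (λ y → cst y N) (trans (sym (ℕD.m<n⇒m%n≡m lt)) (≈0⇒% z))) cst-0))
      ... | no none = contradiction van (notApex v indep notPyramid
          (0<dimension (proj₁ top) (λ i → proj₂ (proj₁ (Box⇒InLambda top-Box) i)) (total top-Box)
          (ℕP.≤-trans k>0 (ℕP.<⇒≤ k<2k))) i)
        where
        van : ∀ x → InLambda v x → x i ≡ 0ℚ
        van x l with x i ≟ 0ℚ
        ... | yes e = e
        ... | no ne = contradiction (Any.map (λ { refl e → ne (trans (sym (lookup∘tabulate x i)) e) })
            (InLambda⇒∈points {tabulate x} (InLambda-cong (λ i → sym (lookup∘tabulate x i)) l))) none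

      setting : Setting
      setting = record
        { n = suc d ; N = N ; N≢0 = N≢0 ; k = k ; m = m ; 0<k = k>0 ; E = E ; unique = E! ; size =
          trans (List.length-map (Vec.map num) points) length-points
        ; bounded = λ x∈ i → let y , y∈ , e = ∈-map⁻ (Vec.map num) x∈ in
            subst (ℕ._< N) (sym (trans (cong (λ z → lookup z i) e) (lookup-map i num y)))
                (proj₁ (InLambda⇒cst (∈points⇒InLambda y∈) i))
        ; 0∈ = 0∈ ; add = λ {f} {g} → add {f} {g} ; g = g ; g∈ = num-InE (Box⇒InLambda top-Box) ; g<N =
          proj₁ ∘ g-cst
        ; ht-g = height top-Box (λ i → trans (proj₂ (g-cst i)) (cong (λ y → cst y N)
          (sym (ℕD.m<n⇒m%n≡m (proj₁ (g-cst i))))))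
        ; hts = hts ; full = full }

      open Generation setting using (GenBy)

      transfer : ∀ {r} {M : List (Vec ℚ r)} → GenBy M → GeneratedByMatrix v M
      transfer {r} {M} G = (λ s i → cst (lookup (D i) s) N)
          , subst (_↭ M) (cong toList (tabulate-cong {f = λ i → Vec.map (λ y → cst y N) (D i)} {g =
              λ i → tabulate (λ s → cst (lookup (D i) s) N)} (λ i →
              Vec-ext (λ s → trans (lookup-map s (λ y → cst y N) (D i))
              (sym (lookup∘tabulate (λ s → cst (lookup (D i) s) N) s)))))) columns↭
          , (λ s → InLambda-cong (λ i → cong (λ y → cst y N) (ℕD.m<n⇒m%n≡m (C<N i s)))
              (InE⇒InLambda {λ i → lookup (D i) s} (rows∈ s)))
          , λ x l → let w , e = generate (num ∘ x) (num-InE l) in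
              (λ s → + lookup w s) , λ i → IsInt-resp (cong₂ _-_ (sym (proj₂ (InLambda⇒cst l i)))
                (combination w (D i))) (cst-≈ (e i))
        where
        open Generation.GenBy G renaming (C to D)
        combination : ∀ {r} (w y : Vec ℕ r) → cst (dot w y) N ≡ sumℚ
            (λ s → ℤ→ℚ (+ lookup w s) * cst (lookup y s) N)
        combination [] [] = cst-0
        combination (a ∷ w) (b ∷ y) =
            trans (sym (cst-+ (a ℕ.* b) (dot w y))) (cong₂ _+_ (trans (cst-/ (a ℕ.* b) N)
            (trans (cong (_/ N) (trans (cong +_ (ℕP.*-comm a b)) (ℤP.pos-* b a)))
            (trans (sym (/-* N (+ b) (+ a))) (trans (cong (_* ℤ→ℚ (+ a)) (sym (cst-/ b N)))
              (*-comm _ (ℤ→ℚ (+ a))))))) (combination w y))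

-- The classification, carried back from residues to the simplex.

open import Defs
open import Data.Nat using (ℕ; suc; _+_; _*_; _^_; _∸_; _≤_)
open import Data.Nat.Properties using (+-comm)
open import Data.Vec using (Vec)
open import Data.Fin using (Fin)
open import Data.List using (List)
open import Data.Product using (Σ; _×_; _,_; proj₁; proj₂)
open import Data.Rational using (ℚ)
open import Data.Sum using (_⊎_; map)
open import Relation.Binary.PropositionalEquality using (_≡_; trans)
open import Relation.Nullary using (¬_)

theorem3p1 : (m k d : ℕ) → 3 ≤ m → 2 ≤ k →
    (v : Vertices d) → AffinelyIndependent v →
    HasHStar v m k →
    ¬ IsLatticePyramid v →
    -- (a)
    (m ≡ 3 × d + 1 ≡ 3 * k × GeneratedByMatrix v (M-3 k))
    ⊎ (m ≡ 4 × d + 1 ≡ 3 * k × GeneratedByMatrix v (M-4a k))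
    ⊎ (m ≡ 4 × d + 1 ≡ 4 * k × GeneratedByMatrix v (M-4b k))
    ⊎ (m ≡ 6 × d + 1 ≡ 3 * k × GeneratedByMatrix v (M-6 k))
    ⊎ (m ≡ 8 × d + 1 ≡ 3 * k × GeneratedByMatrix v (M-8 k))
    -- (b)
    ⊎ (Σ ℕ λ a → Σ ℕ λ ℓ → 1 ≤ a × 3 ≤ ℓ × ¬ (a ≡ 1 × ℓ ≡ 3) ×
        k ≡ 2 ^ (ℓ ∸ 3) * a × m ≡ 2 ^ ℓ × d + 1 ≡ 2 ^ (ℓ ∸ 1) * a ×
        Σ (List (Vec (Fin 2) (ℓ ∸ 1))) λ A →
          IsSimplexCodeGenerator 2 (ℓ ∸ 1) A × GeneratedByMatrix v (M-b a A))
    -- (c)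
    ⊎ (Σ ℕ λ a → Σ ℕ λ ℓ → 1 ≤ a × 2 ≤ ℓ × ¬ (a ≡ 1 × ℓ ≡ 2) ×
        k ≡ 3 ^ (ℓ ∸ 2) * a × m ≡ 3 ^ ℓ × d + 1 ≡ 3 ^ (ℓ ∸ 1) * a ×
        Σ (List (Vec (Fin 3) (ℓ ∸ 1))) λ A →
          IsSimplexCodeGenerator 3 (ℓ ∸ 1) A × GeneratedByMatrix v (M-c a A))
theorem3p1 m k d 3≤m 2≤k v independent hstar notPyramid =
    map sporadic (map sporadic (map sporadic (map sporadic (map sporadic (map binary ternary))))) classification
  where
  open BoxCounting.Ehrhart v independent using (boxes)
  count = boxes {m} {k} hstar
  open Scaling.BoxPoints m k d 3≤m 2≤k v independent (proj₁ count) (proj₁ (proj₂ count)) (proj₂ (proj₂ count))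
  denominator = Scaling.common-denominator points
  open Scaled (proj₁ denominator) {{proj₁ (proj₂ denominator)}} (proj₂ (proj₂ denominator)) notPyramid
  open CyclicCases.Generation setting using (GenBy)
  open Classification.Classify setting 3≤m 2≤k using (Case-b; Case-c; classification)
  d+1≡ : ∀ {x} → suc d ≡ x → d + 1 ≡ x
  d+1≡ = trans (+-comm d 1)
  sporadic : ∀ {x y r} {M : List (Vec ℚ r)} → m ≡ x × suc d ≡ y × GenBy M →
      m ≡ x × d + 1 ≡ y × GeneratedByMatrix v M
  sporadic (m≡ , n≡ , G) = m≡ , d+1≡ n≡ , transfer G
  binary : Case-b → _
  binary (a , ℓ , 1≤a , 3≤ℓ , ≢ , k≡ , m≡ , n≡ , A , code , G) =
    a , ℓ , 1≤a , 3≤ℓ , ≢ , k≡ , m≡ , d+1≡ n≡ , A , code , transfer G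
  ternary : Case-c → _
  ternary (a , ℓ , 1≤a , 2≤ℓ , ≢ , k≡ , m≡ , n≡ , A , code , G) =
    a , ℓ , 1≤a , 2≤ℓ , ≢ , k≡ , m≡ , d+1≡ n≡ , A , code , transfer G
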